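{- Let $q=p^r \equiv 5 \pmod{8}$ for a prime $p$. Write $q=x^2+y^2$ for integers $x$ and $y$, such that $x \equiv 1 \pmod{4}$, and $p \nmid x$. Then $$\mathcal{K}_3(G_4(q)) = \frac{q(q-1)(q+2x-7)}{2^{6}}.$$
   Context: $G_4(q)$ is the digraph with vertex set the finite field $\mathbb{F}_q$ where $a \to b$ is an edge if and only if $b-a$ is a nonzero fourth power in $\mathbb{F}_q$ (since $q\equiv 5 \pmod 8$, $-1$ is not a fourth power). For a digraph $G$, $\mathcal{K}_m(G)$ is the number of transitive subtournaments of order $m$ contained in $G$; a tournament of order $m$ is transitive if its vertices can be listed $a_1,\dots,a_m$ with $a_i \to a_j$ for all $i<j$. -}

module Defs where

open import Algebra.Bundles using (CommutativeRing)
import Algebra.Properties.Semiring.Exp as Exp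
open import Data.Fin.Base as Fin using (Fin)
open import Data.Nat.Base using (ℕ)
open import Data.Product.Base using (∃; _×_; _,_; proj₁; swap)
open import Data.Sum.Base using (_⊎_)
open import Function.Base using (id)
open import Function.Bundles using (Inverse)
open import Level using (Level; _⊔_; suc)
open import Relation.Binary.Bundles using (Setoid)
open import Relation.Binary.Core using (Rel; _⇒_; _⇔_)
open import Relation.Binary.Definitions using (Asymmetric; _Respects_; _Respects₂_)
import Relation.Binary.Construct.On as On
open import Relation.Binary.PropositionalEquality.Core using (_≡_)
import Relation.Binary.PropositionalEquality.Properties as ≡
open import Relation.Nullary.Negation.Core using (¬_)
open import Relation.Unary using (Pred; _∈_; _≐_)

private variable
  c ℓ e : Level

-- The quotient of the carrier by the setoid equality has exactly n elements.
HasCardinality : Setoid c ℓ → ℕ → Set (c ⊔ ℓ)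
HasCardinality S n = Inverse S (≡.setoid (Fin n))

-- The library's HeytingField carries a separate apartness relation; here
-- "nonzero" is the negation of the ring's own equality.
record IsField (R : CommutativeRing c ℓ) : Set (c ⊔ ℓ) where
  open CommutativeRing R
  field
    1≉0     : ¬ (1# ≈ 0#)
    inverse : ∀ x → ¬ (x ≈ 0#) → ∃ λ y → x * y ≈ 1#

record Digraph c ℓ e : Set (suc (c ⊔ ℓ ⊔ e)) where
  field
    vertices : Setoid c ℓ
  open Setoid vertices public using (Carrier; _≈_)
  field
    _⟶_    : Rel Carrier e
    ⟶-resp : _⟶_ Respects₂ _≈_

module _ (G : Digraph c ℓ e) where
  open Digraph G

  -- A not necessarily induced subgraph: a set of vertices together with a set
  -- of edges of G between them.
  record Subdigraph : Set (c ⊔ suc ℓ ⊔ suc e) where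
    field
      V      : Pred Carrier ℓ
      E      : Rel Carrier (ℓ ⊔ e)
      V-resp : V Respects _≈_
      E-resp : E Respects₂ _≈_
      E⇒V    : ∀ {a b} → E a b → a ∈ V × b ∈ V
      E⇒⟶    : E ⇒ _⟶_

  open Subdigraph

  -- Asymmetry also excludes loops, so any two distinct vertices are joined by
  -- exactly one edge.
  record IsTournament (H : Subdigraph) : Set (c ⊔ ℓ ⊔ e) where
    field
      asymmetric : Asymmetric (E H)
      total      : ∀ {a b} → a ∈ V H → b ∈ V H → ¬ (a ≈ b) → E H a b ⊎ E H b a

  record IsTransitiveOfOrder (m : ℕ) (H : Subdigraph) : Set (c ⊔ ℓ ⊔ e) where
    field
      vertex     : Fin m → Carrier
      vertex∈V   : ∀ i → vertex i ∈ V H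
      distinct   : ∀ {i j} → vertex i ≈ vertex j → i ≡ j
      exhaustive : ∀ {a} → a ∈ V H → ∃ λ i → vertex i ≈ a
      ordered    : ∀ {i j} → i Fin.< j → E H (vertex i) (vertex j)

  -- Extensional equality: same vertex set and same edge set.
  subdigraphs : Setoid (c ⊔ suc ℓ ⊔ suc e) (c ⊔ ℓ ⊔ e)
  subdigraphs = record
    { Carrier       = Subdigraph
    ; _≈_           = λ H K → (V H ≐ V K) × (E H ⇔ E K)
    ; isEquivalence = record
      { refl  = (id , id) , (id , id)
      ; sym   = λ (p , q) → swap p , swap q
      ; trans = λ ((f , f′) , (g , g′)) ((h , h′) , (k , k′)) →
          ((λ x → h (f x)) , (λ x → f′ (h′ x))) ,
          ((λ x → k (g x)) , (λ x → g′ (k′ x)))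
      }
    }

  -- The equality ignores the chosen listing of the vertices, so each
  -- subtournament is counted once.
  transitiveSubtournaments : ℕ → Setoid (c ⊔ suc ℓ ⊔ suc e) (c ⊔ ℓ ⊔ e)
  transitiveSubtournaments m = On.setoid subdigraphs
    (proj₁ {B = λ H → IsTournament H × IsTransitiveOfOrder m H})

-- The counting function 𝒦 given by its graph: G contains exactly n transitive
-- subtournaments of order m.  The number n is unique when it exists.
𝒦[_]⟨_⟩≡_ : ℕ → Digraph c ℓ e → ℕ → Set (c ⊔ suc ℓ ⊔ suc e)
𝒦[ m ]⟨ G ⟩≡ n = HasCardinality (transitiveSubtournaments G m) n

module _ (F : CommutativeRing c ℓ) where
  open CommutativeRing F
  open Exp semiring using (_^_)

  IsNonzeroPower : ℕ → Pred Carrier (c ⊔ ℓ)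
  IsNonzeroPower k a = ¬ (a ≈ 0#) × ∃ λ w → a ≈ w ^ k

  powerDigraph : ℕ → Digraph c ℓ (c ⊔ ℓ)
  powerDigraph k = record
    { vertices = setoid
    ; _⟶_      = λ a b → IsNonzeroPower k (b - a)
    ; ⟶-resp   = (λ y≈z → resp (+-congʳ y≈z))
               , (λ y≈z → resp (+-congˡ (-‿cong y≈z)))
    }
    where
    resp : ∀ {a b} → a ≈ b → IsNonzeroPower k a → IsNonzeroPower k b
    resp a≈b (a≉0 , w , a≈wᵏ) =
      (λ b≈0 → a≉0 (trans a≈b b≈0)) , w , trans (sym a≈b) a≈wᵏ

module Submission where

-- Why the theorem holds.  A transitive tournament has exactly one listing of
-- its vertices in increasing order, so the transitive subtournaments of order
-- 3 are the triples (a , b , c) for which b - a, c - b and c - a are nonzero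
-- fourth powers (count-triples).  Translation and multiplication by fourth
-- powers give q (q - 1)/4 * N such triples, where N is the number of
-- nonzero fourth powers s for which s - 1 is one too (#triples≡).
--
-- The affine curve a^4 - b^4 = 1 has M = 16 N + 4 points: every nonzero fourth
-- power has four fourth roots, and since q = 5 (mod 8) the element -1 is not a
-- fourth power, so only the points (a , 0) are exceptional.  With η the
-- quadratic character, an element s has the sum of 1 + η z over z^2 = s as its
-- number of fourth roots, and so M is the sum of (1 + η z)(1 + η w) over the
-- hyperbola z^2 - w^2 = 1.  Its four parts are evaluated by elementary
-- substitutions, and M = q - 3 + φ(-1) for the Jacobsthal sum
-- φ(d) = sum of η(t) η(t^2 + d) over t (M≡q-3+φ).
--
-- It remains to identify φ(-1) with 2 x.  The identity M = 16 N + 4 gives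
-- φ(-1) = 2 X with X = 1 (mod 4).  The second moment of φ gives
-- φ(-1)^2 + φ(g)^2 = 4 q for a nonsquare g (jacobsthal), so q = X^2 + Y^2.  In
-- the field itself η(t) is t^((q-1)/2), and expanding φ(1) = -φ(-1) by the
-- binomial theorem leaves, up to sign, the central binomial coefficient
-- (2h choose h) with h = (q-1)/4 (ι-φ𝟙).  All base-p digits of h equal
-- (p-1)/4, so p does not divide that coefficient (central-quarter), nor X.
-- Finally a representation q = x^2 + y^2 with x prime to p and x = 1 (mod 4)
-- determines x (two-squares-unique), so X = x.
--
-- All calculations take place in a copy of the field on Fin q, in which
-- equality is propositional and decidable; the sums over it are integers.

open import Defs
open import Algebra.Bundles using (CommutativeRing)
open import Data.Integer.Base as ℤ using (ℤ; +_)
open import Data.Integer.Divisibility using (_∣_)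
open import Data.Nat.Base as ℕ using (ℕ)
open import Data.Nat.Primality using (Prime)
open import Data.Product.Base using (∃; _×_)
open import Data.Rational.Base using (_/_)
open import Level using (Level)
open import Relation.Binary.PropositionalEquality.Core using (_≡_)
open import Relation.Nullary.Negation.Core using (¬_)

open import Algebra.Bundles using (CommutativeMonoid; RawRing)
import Algebra.Morphism.RingMonomorphism
open import Algebra.Morphism.Structures using (IsRingMonomorphism)
import Algebra.Properties.CommutativeMonoid.Sum
import Algebra.Properties.CommutativeSemiring.Binomial
import Algebra.Properties.CommutativeSemiring.Exp
import Algebra.Properties.Ring
import Algebra.Properties.Semiring.Mult
import Algebra.Properties.Semiring.Sum
import Algebra.Solver.Ring
open import Algebra.Solver.Ring.AlmostCommutativeRing
  using (fromCommutativeRing; _-Raw-AlmostCommutative⟶_; Induced-equivalence)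
open import Algebra.Structures using (IsCommutativeRing)
open import Data.Empty using (⊥)
open import Data.Fin.Base as Fin using (Fin; zero; suc; toℕ; fromℕ<; punchIn; splitAt; join; _↑ˡ_; _↑ʳ_)
open import Data.Fin.Patterns using (0F; 1F; 2F)
open import Data.Fin.Permutation using (permutation)
import Data.Fin.Properties as Fin
import Data.Integer.Divisibility.Signed as S
import Data.Integer.Properties as ℤ
open import Data.Integer.Tactic.RingSolver using (solve-∀)
open import Data.Maybe.Base using (just; nothing)
open import Data.Nat.Base using (zero; suc)
open import Data.Nat.Combinatorics using (_C_; nCk≡n!/k![n-k]!; k![n∸k]!∣n!)
open import Data.Nat.Coprimality as Coprime using (Coprime; coprime-divisor)
import Data.Nat.Divisibility as ℕ
import Data.Nat.DivMod as ℕ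
import Data.Nat.GCD as GCD
open import Data.Nat.Primality
  using (euclidsLemma; prime[2]; prime⇒irreducible; prime⇒nonTrivial; prime⇒nonZero)
import Data.Nat.Properties as ℕ
import Data.Nat.Tactic.RingSolver as ℕSolver
open import Data.Product.Base using (_,_; proj₁; proj₂)
import Data.Rational.Properties as ℚ
open import Data.Rational.Unnormalised.Base using (mkℚᵘ; *≡*)
open import Data.Sum.Base using (_⊎_; inj₁; inj₂; [_,_]′)
open import Data.Unit.Base using (⊤; tt)
open import Function.Base using (_∘_; id)
open import Function.Bundles using (Inverse)
open import Level using (0ℓ; _⊔_)
open import Relation.Binary.Bundles using (Setoid)
open import Relation.Binary.Definitions using (WeaklyDecidable; tri<; tri≈; tri>)
open import Relation.Binary.PropositionalEquality
  using (_≢_; refl; sym; trans; cong; cong₂; subst; subst₂; module ≡-Reasoning)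
open import Relation.Nullary.Decidable
  using (Dec; yes; no; ¬?; _×-dec_; _⊎-dec_; _→-dec_; map′; from-yes; decidable-stable)
open import Relation.Nullary.Negation.Core using (contradiction)

-- Central binomial coefficients modulo a prime.

module CentralBinomials where

  open import Data.Nat.Base
  open import Data.Nat.Properties
  open import Data.Nat.Divisibility hiding (_∣_)
  open import Data.Nat.DivMod hiding (_/_)

  prime∤⇒coprime : ∀ {p n} → Prime p → p ∤ n → Coprime p n
  prime∤⇒coprime p-prime p∤n (d∣p , d∣n) with prime⇒irreducible p-prime d∣p
  ... | inj₁ d≡1  = d≡1
  ... | inj₂ refl = contradiction d∣n p∤n

  prime∤* : ∀ {p} → Prime p → ∀ m n → p ∤ m → p ∤ n → p ∤ m * n
  prime∤* p-prime m n p∤m p∤n = [ p∤m , p∤n ]′ ∘ euclidsLemma m n p-prime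

  ∤1 : ∀ {p} → Prime p → p ∤ 1
  ∤1 {p} p-prime p∣1 = contradiction (∣1⇒≡1 p∣1) (nonTrivial⇒≢1 {{prime⇒nonTrivial p-prime}})

  -- The central binomial coefficient (2k choose k).
  central : ℕ → ℕ
  central k = (k + k) C k

  central-! : ∀ k → central k * (k ! * k !) ≡ (k + k) !
  central-! k = begin
    central k * (k ! * k !)
      ≡⟨ cong (_* (k ! * k !)) (trans (nCk≡n!/k![n-k]! (m≤m+n k k)) (/-congʳ (cong (λ j → k ! * j !) (m+n∸m≡n k k)))) ⟩
    (k + k) ! ℕ./ (k ! * k !) * (k ! * k !)
      ≡⟨ m/n*n≡m (subst (λ j → k ! * j ! ℕ.∣ (k + k) !) (m+n∸m≡n k k) (k![n∸k]!∣n! (m≤m+n k k))) ⟩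
    (k + k) !                                                      ∎
    where
    open ≡-Reasoning
    instance
      _ = k !* k !≢0
      _ = k !* (k + k ∸ k) !≢0

  central-suc : ∀ k → central (suc k) * suc k ≡ 2 * (suc (k + k)) * central k
  central-suc k = *-cancelʳ-≡ _ _ (suc k * (k ! * k !)) {{m*n≢0 (suc k) (k ! * k !) {{_}} {{k !* k !≢0}}}} (begin
    central (suc k) * suc k * (suc k * (k ! * k !))          ≡⟨ regroup (central (suc k)) (suc k) (k !) ⟩
    central (suc k) * (suc k ! * suc k !)                    ≡⟨ central-! (suc k) ⟩
    (suc k + suc k) !                                        ≡⟨ cong (λ j → suc j !) (+-suc k k) ⟩
    suc (suc (k + k)) * (suc (k + k) * (k + k) !)            ≡⟨ cong (λ j → suc (suc (k + k)) * (suc (k + k) * j)) (central-! k) ⟨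
    suc (suc (k + k)) * (suc (k + k) * (central k * (k ! * k !))) ≡⟨ regroup′ k (central k) (k ! * k !) ⟩
    2 * suc (k + k) * central k * (suc k * (k ! * k !))      ∎)
    where
    open ≡-Reasoning
    regroup : ∀ c s f → c * s * (s * (f * f)) ≡ c * ((s * f) * (s * f))
    regroup = ℕSolver.solve-∀
    regroup′ : ∀ k c f → suc (suc (k + k)) * (suc (k + k) * (c * f)) ≡ 2 * suc (k + k) * c * (suc k * f)
    regroup′ = ℕSolver.solve-∀

  module _ {p : ℕ} (p-prime : Prime p) where

    private instance
      p≢0 : NonZero p
      p≢0 = prime⇒nonZero p-prime

    p∤small : ∀ {n} → .{{NonZero n}} → n < p → p ∤ n
    p∤small n<p = >⇒∤ n<p

    -- The multiples of p contribute p^a a! to (p a)!, and the other factors a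
    -- number w prime to p.
    factorial-p-part : ∀ a → ∃ λ w → (p * a) ! ≡ p ^ a * a ! * w × p ∤ w
    factorial-p-part zero = 1 , cong _! (*-zeroʳ p) , ∤1 p-prime
    factorial-p-part (suc a) with factorial-p-part a
    ... | w , eq , p∤w with block (pred p) (≤-reflexive (suc-pred p))
      where
      -- The factors p a + 1, ..., p a + j with j < p are prime to p.
      block : ∀ j → j < p → ∃ λ u → (p * a + j) ! ≡ (p * a) ! * u × p ∤ u
      block zero _ = 1 , trans (cong _! (+-identityʳ (p * a))) (sym (*-identityʳ _)) , ∤1 p-prime
      block (suc j) 1+j<p with block j (<-trans (n<1+n j) 1+j<p)
      ... | u , eq , p∤u = (p * a + suc j) * u
          , trans (cong _! (+-suc (p * a) j)) (trans (cong₂ _*_ (sym (+-suc (p * a) j)) eq) (regroup (p * a + suc j) ((p * a) !) u))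
          , prime∤* p-prime (p * a + suc j) u (λ p∣ → p∤small 1+j<p (∣m+n∣m⇒∣n p∣ (m∣m*n a))) p∤u
        where
        regroup : ∀ s f u → s * (f * u) ≡ f * (s * u)
        regroup = ℕSolver.solve-∀
    ...   | u , eq′ , p∤u = w * u , (begin
        (p * suc a) !                            ≡⟨ cong _! top ⟩
        suc (p * a + pred p) * (p * a + pred p) ! ≡⟨ cong₂ _*_ (sym top) eq′ ⟩
        p * suc a * ((p * a) ! * u)              ≡⟨ cong (λ f → p * suc a * (f * u)) eq ⟩
        p * suc a * (p ^ a * a ! * w * u)        ≡⟨ regroup p (suc a) (p ^ a) (a !) w u ⟩
        p * p ^ a * (suc a * a !) * (w * u)      ∎) , prime∤* p-prime w u p∤w p∤u
      where
      open ≡-Reasoning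
      top : p * suc a ≡ suc (p * a + pred p)
      top = trans (*-suc p a) (trans (+-comm p (p * a)) (trans (cong (_+_ (p * a)) (sym (suc-pred p))) (+-suc (p * a) (pred p))))
      regroup : ∀ p s q f w u → p * s * (q * f * w * u) ≡ p * q * (s * f) * (w * u)
      regroup = ℕSolver.solve-∀

    -- After cancelling what the multiples of p contribute, (2pa choose pa) and
    -- (2a choose a) differ by factors w^2 and w₂ prime to p.
    central-p* : ∀ a → p ∤ central a → p ∤ central (p * a)
    central-p* a p∤c p∣c′ with factorial-p-part a | factorial-p-part (a + a)
    ... | w , eq , p∤w | w₂ , eq₂ , p∤w₂ = prime∤* p-prime (central a) w₂ p∤c p∤w₂
        (subst (p ℕ.∣_) relation (∣m⇒∣m*n (w * w) p∣c′))
      where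
      open ≡-Reasoning
      P : ℕ
      P = p ^ a
      relation : central (p * a) * (w * w) ≡ central a * w₂
      relation = *-cancelʳ-≡ _ _ (P * P * (a ! * a !)) {{m*n≢0 (P * P) (a ! * a !) {{m*n≢0 P P {{m^n≢0 p a}} {{m^n≢0 p a}}}} {{a !* a !≢0}}}} (begin
        central (p * a) * (w * w) * (P * P * (a ! * a !))         ≡⟨ regroup (central (p * a)) w P (a !) ⟩
        central (p * a) * (P * a ! * w * (P * a ! * w))           ≡⟨ cong (λ f → central (p * a) * (f * f)) eq ⟨
        central (p * a) * ((p * a) ! * (p * a) !)                 ≡⟨ central-! (p * a) ⟩
        (p * a + p * a) !                                         ≡⟨ cong _! (*-distribˡ-+ p a a) ⟨
        (p * (a + a)) !                                           ≡⟨ eq₂ ⟩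
        p ^ (a + a) * (a + a) ! * w₂
          ≡⟨ cong₂ (λ s t → s * t * w₂) (^-distribˡ-+-* p a a) (sym (central-! a)) ⟩
        P * P * (central a * (a ! * a !)) * w₂                    ≡⟨ regroup′ (central a) w₂ P (a ! * a !) ⟩
        central a * w₂ * (P * P * (a ! * a !))                    ∎)
        where
        regroup : ∀ c w P f → c * (w * w) * (P * P * (f * f)) ≡ c * (P * f * w * (P * f * w))
        regroup = ℕSolver.solve-∀
        regroup′ : ∀ c w P f → P * P * (c * f) * w ≡ c * w * (P * P * f)
        regroup′ = ℕSolver.solve-∀

    -- By (k+1) * (2k+2 choose k+1) = 2 (2k+1) * (2k choose k), where 2k + 1 is
    -- prime to p while the last base-p digit of k is less than (p - 1)/2.
    central-p*+ : ∀ a j → j + j < p → p ∤ central a → p ∤ central (p * a + j)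
    central-p*+ a zero    _ p∤c = subst (λ k → p ∤ central k) (sym (+-identityʳ (p * a))) (central-p* a p∤c)
    central-p*+ a (suc j) 2+2j<p p∤c p∣c′ = prime∤* p-prime (2 * suc (k + k)) (central k)
        (prime∤* p-prime 2 (suc (k + k)) (p∤small 2<p) p∤1+2k) (central-p*+ a j (<-trans (n<1+n _) (<-trans (n<1+n _) 2+2j<p′)) p∤c)
        (subst (p ℕ.∣_) (trans (cong (λ s → central s * s) (+-suc (p * a) j)) (central-suc k)) (∣m⇒∣m*n (p * a + suc j) p∣c′))
      where
      k : ℕ
      k = p * a + j
      2+2j<p′ : suc (suc (j + j)) < p
      2+2j<p′ = subst (λ s → suc s < p) (+-suc j j) 2+2j<p
      2<p : 2 < p
      2<p = ≤-<-trans (s≤s (s≤s z≤n)) 2+2j<p′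
      p∤1+2k : p ∤ suc (k + k)
      p∤1+2k p∣ = p∤small (<-trans (n<1+n _) 2+2j<p′) (∣m+n∣m⇒∣n (subst (p ℕ.∣_) (regroup p a j) p∣) (∣m⇒∣m*n (a + a) ∣-refl))
        where
        regroup : ∀ p a j → suc (p * a + j + (p * a + j)) ≡ p * (a + a) + suc (j + j)
        regroup = ℕSolver.solve-∀

    -- Every base-p digit of h = (p^r - 1)/4 is d = (p - 1)/4, and 2 d < p.
    central-quarter : ∀ {d} → p ≡ 1 + 4 * d → ∀ r {h} → p ^ r ≡ 1 + 4 * h → p ∤ central h
    central-quarter {d} p≡1+4d = λ r {h} eq → subst (λ k → p ∤ central k)
        (*-cancelˡ-≡ (proj₁ (go r)) h 4 (suc-injective (trans (sym (proj₁ (proj₂ (go r)))) eq))) (proj₂ (proj₂ (go r)))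
      where
      go : ∀ r → ∃ λ h → p ^ r ≡ 1 + 4 * h × p ∤ central h
      go zero    = 0 , refl , ∤1 p-prime
      go (suc r) with go r
      ... | h , eq , p∤c = p * h + d , trans (cong (p *_) eq) (trans (regroup p h) (trans (cong (_+ 4 * (p * h)) p≡1+4d) (regroup′ (p * h) d)))
          , central-p*+ h d (subst (d + d <_) (sym p≡1+4d) (s≤s (subst (d + d ≤_) (regroup″ d) (m≤m+n (d + d) (d + d))))) p∤c
        where
        regroup : ∀ p h → p * (1 + 4 * h) ≡ p + 4 * (p * h)
        regroup = ℕSolver.solve-∀
        regroup′ : ∀ x d → 1 + 4 * d + 4 * x ≡ 1 + 4 * (x + d)
        regroup′ = ℕSolver.solve-∀
        regroup″ : ∀ d → d + d + (d + d) ≡ 4 * d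
        regroup″ = ℕSolver.solve-∀

  power≡5⇒base≡5 : ∀ p r → p ^ r % 8 ≡ 5 → p % 8 ≡ 5
  power≡5⇒base≡5 p r p^r≡5 with p % 8 ≟ 5
  ... | yes p≡5 = p≡5
  ... | no  p≢5 = contradiction (subst (Good (p % 8)) p^r≡5 (invariant r)) not-5
    where
    -- Closed under multiplication by v when v is not 5 modulo 8, but not
    -- containing 5.
    Good : ℕ → ℕ → Set
    Good v w = w ≡ 1 ⊎ w ≡ v ⊎ w % 2 ≡ 0
    good? : ∀ v w → Dec (Good v w)
    good? v w = (w ≟ 1) ⊎-dec (w ≟ v) ⊎-dec (w % 2 ≟ 0)
    not-5 : ¬ Good (p % 8) 5
    not-5 (inj₂ (inj₁ 5≡p%8)) = p≢5 (sym 5≡p%8)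
    closed? : Dec (∀ (v w : Fin 8) → toℕ v ≢ 5 → Good (toℕ v) (toℕ w) → Good (toℕ v) (toℕ v * toℕ w % 8))
    closed? = Fin.all? λ v → Fin.all? λ w →
      ¬? (toℕ v ≟ 5) →-dec (good? (toℕ v) (toℕ w) →-dec good? (toℕ v) (toℕ v * toℕ w % 8))
    invariant : ∀ r → Good (p % 8) (p ^ r % 8)
    invariant zero = inj₁ refl
    invariant (suc r) = subst (Good (p % 8)) (sym (%-distribˡ-* p (p ^ r) 8))
      (subst₂ (λ v w → v ≢ 5 → Good v w → Good v (v * w % 8)) (Fin.toℕ-fromℕ< (m%n<n p 8)) (Fin.toℕ-fromℕ< (m%n<n (p ^ r) 8))
        (from-yes closed? (fromℕ< (m%n<n p 8)) (fromℕ< (m%n<n (p ^ r) 8))) p≢5 (invariant r))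

open CentralBinomials using (prime∤⇒coprime; central-quarter; power≡5⇒base≡5)

open import Data.Integer.Base
  using (-[1+_]; 0ℤ; 1ℤ; _+_; _*_; -_; _-_; _⊖_; _≤_)

import Algebra.Properties.AbelianGroup ℤ.+-0-abelianGroup as ℤ+
import Algebra.Properties.Semiring.Sum ℤ.+-*-semiring as ∑
open ∑ using (sum; ∑-distrib-+; ∑-comm; *-distribˡ-sum; *-distribʳ-sum)
  renaming (sum-cong-≗ to sum-cong)

private variable
  n : ℕ

-- Representations of a prime power as a sum of two squares.

prime∣* : ∀ {p} → Prime p → ∀ i j → + p ∣ i * j → + p ∣ i ⊎ + p ∣ j
prime∣* {p} p-prime i j p∣ij = euclidsLemma ℤ.∣ i ∣ ℤ.∣ j ∣ p-prime (subst (p ℕ.∣_) (ℤ.abs-* i j) p∣ij)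

∣i∣j⇒∣i+j : ∀ {k i j} → k ∣ i → k ∣ j → k ∣ i + j
∣i∣j⇒∣i+j {k} {i} {j} p q = S.∣⇒∣ᵤ {k} {i + j} (S.∣m∣n⇒∣m+n (S.∣ᵤ⇒∣ {k} {i} p) (S.∣ᵤ⇒∣ {k} {j} q))

i*i≡∣i∣*∣i∣ : ∀ i → i * i ≡ + (ℤ.∣ i ∣ ℕ.* ℤ.∣ i ∣)
i*i≡∣i∣*∣i∣ (+ n)    = sym (ℤ.pos-* n n)
i*i≡∣i∣*∣i∣ -[1+ n ] = refl

i²≡j²⇒i≡±j : ∀ i j → i * i ≡ j * j → i ≡ j ⊎ i ≡ - j
i²≡j²⇒i≡±j i j eq with ℤ.i*j≡0⇒i≡0∨j≡0 (i - j) {i + j} (trans (factor i j) (ℤ.i≡j⇒i-j≡0 eq))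
  where
  factor : ∀ i j → (i - j) * (i + j) ≡ i * i - j * j
  factor = solve-∀
... | inj₁ d = inj₁ (ℤ.i-j≡0⇒i≡j _ _ d)
... | inj₂ s = inj₂ (ℤ.i-j≡0⇒i≡j _ _ (trans (cong (_+_ i) (ℤ.neg-involutive j)) s))

-- In a representation of n^2 as c^2 + d^2 with n dividing c, one of the two
-- squares vanishes.
multiple-leg : ∀ n c d → + n ∣ c → c * c + d * d ≡ + n * + n → c ≡ 0ℤ ⊎ d ≡ 0ℤ
multiple-leg n c d (ℕ.divides k ∣c∣≡kn) eq with c ≟ℤ 0ℤ | d ≟ℤ 0ℤ
  where
  _≟ℤ_ = ℤ._≟_
... | yes c≡0 | _       = inj₁ c≡0
... | no _    | yes d≡0 = inj₂ d≡0
... | no c≢0  | no d≢0  = contradiction natural (ℕ.<⇒≢ smaller ∘ sym)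
  where
  natural : ℤ.∣ c ∣ ℕ.* ℤ.∣ c ∣ ℕ.+ ℤ.∣ d ∣ ℕ.* ℤ.∣ d ∣ ≡ n ℕ.* n
  natural = ℤ.+-injective (begin
    + (ℤ.∣ c ∣ ℕ.* ℤ.∣ c ∣) + + (ℤ.∣ d ∣ ℕ.* ℤ.∣ d ∣)  ≡⟨ cong₂ _+_ (i*i≡∣i∣*∣i∣ c) (i*i≡∣i∣*∣i∣ d) ⟨
    c * c + d * d                              ≡⟨ eq ⟩
    + n * + n                                  ≡⟨ ℤ.pos-* n n ⟨
    + (n ℕ.* n)                                ∎)
    where open ≡-Reasoning
  n≤∣c∣ : n ℕ.≤ ℤ.∣ c ∣
  n≤∣c∣ = ℕ.∣⇒≤ {{ℕ.≢-nonZero (c≢0 ∘ ℤ.∣i∣≡0⇒i≡0)}} (ℕ.divides k ∣c∣≡kn)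
  smaller : n ℕ.* n ℕ.< ℤ.∣ c ∣ ℕ.* ℤ.∣ c ∣ ℕ.+ ℤ.∣ d ∣ ℕ.* ℤ.∣ d ∣
  smaller = ℕ.≤-<-trans (ℕ.*-mono-≤ n≤∣c∣ n≤∣c∣) (ℕ.m<m+n _ (ℕ.>-nonZero⁻¹ _
    {{ℕ.m*n≢0 ℤ.∣ d ∣ ℤ.∣ d ∣ {{ℕ.≢-nonZero (d≢0 ∘ ℤ.∣i∣≡0⇒i≡0)}} {{ℕ.≢-nonZero (d≢0 ∘ ℤ.∣i∣≡0⇒i≡0)}}}}))

2i≢1+2j : ∀ i j → + 2 * i ≡ 1ℤ + + 2 * j → ⊥
2i≢1+2j i j eq = contradiction (ℕ.∣1⇒≡1 (subst (+ 2 ∣_) (trans (factor i j) (trans (cong (_- + 2 * j) eq) (cancel j)))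
    (S.∣⇒∣ᵤ {+ 2} {+ 2 * (i - j)} (S.divides (i - j) (ℤ.*-comm (+ 2) (i - j)))))) λ ()
  where
  factor : ∀ i j → + 2 * (i - j) ≡ + 2 * i - + 2 * j
  factor = solve-∀
  cancel : ∀ j → 1ℤ + + 2 * j - + 2 * j ≡ 1ℤ
  cancel = solve-∀

coprime-^ : ∀ {p n} → Coprime p n → ∀ r → Coprime (p ℕ.^ r) n
coprime-^ c zero (d∣1 , _) = ℕ.∣1⇒≡1 d∣1
coprime-^ {p} {n} c (suc r) {d} (d∣p*pʳ , d∣n) = coprime-^ c r (coprime-divisor d⊥p d∣p*pʳ , d∣n)
  where
  d⊥p : Coprime d p
  d⊥p (k∣d , k∣p) = c (k∣p , ℕ.∣-trans k∣d d∣n)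

module _ {p r : ℕ} (p-prime : Prime p) (p∤2 : ¬ (+ p ∣ + 2)) {q : ℕ} (q≡pʳ : q ≡ p ℕ.^ r) (p∣q : + p ∣ + q)
         {k : ℤ} (q-odd : + q ≡ 1ℤ + + 2 * k) where

  private
    Q : ℤ
    Q = + q

    Q≢0 : Q ≢ 0ℤ
    Q≢0 Q≡0 = 2i≢1+2j 0ℤ k (trans (sym Q≡0) q-odd)

    -- Two representations of q compared by the identity
    -- (x Y - y X)^2 + (x X + y Y)^2 = q^2.
    module _ {x y X Y : ℤ} (eq : Q ≡ x * x + y * y) (eq′ : Q ≡ X * X + Y * Y)
             (4∣x-1 : + 4 ∣ x - 1ℤ) (4∣X-1 : + 4 ∣ X - 1ℤ) where

      legs : (x * Y - y * X) * (x * Y - y * X) + (x * X + y * Y) * (x * X + y * Y) ≡ Q * Q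
      legs = trans (brahmagupta x y X Y) (sym (cong₂ _*_ eq eq′))
        where
        brahmagupta : ∀ x y X Y → (x * Y - y * X) * (x * Y - y * X) + (x * X + y * Y) * (x * X + y * Y) ≡ (x * x + y * y) * (X * X + Y * Y)
        brahmagupta = solve-∀

      x≢-X : x ≡ - X → ⊥
      x≢-X refl = contradiction (ℕ.∣⇒≤ (subst (+ 4 ∣_) (collect X) (∣i∣j⇒∣i+j {+ 4} { - X - 1ℤ} {X - 1ℤ} 4∣x-1 4∣X-1))) (ℕ.<⇒≱ (ℕ.n<1+n 3) ∘ ℕ.m≤n⇒m≤1+n)
        where
        collect : ∀ X → - X - 1ℤ + (X - 1ℤ) ≡ - + 2
        collect = solve-∀

      parallel : x * Y - y * X ≡ 0ℤ → x ≡ X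
      parallel xY-yX≡0 = [ id , (λ x≡-X → contradiction x≡-X x≢-X) ]′ (i²≡j²⇒i≡±j x X x²≡X²)
        where
        open ≡-Reasoning
        identity : ∀ x y X Y → (x * x - X * X) * (X * X + Y * Y) ≡ X * X * (x * x + y * y - (X * X + Y * Y)) + (x * Y - y * X) * (x * Y + y * X)
        identity = solve-∀
        vanish : ∀ a Q b → a * (Q - Q) + 0ℤ * b ≡ 0ℤ
        vanish = solve-∀
        product : (x * x - X * X) * Q ≡ 0ℤ
        product = begin
          (x * x - X * X) * Q                       ≡⟨ cong ((x * x - X * X) *_) eq′ ⟩
          (x * x - X * X) * (X * X + Y * Y)         ≡⟨ identity x y X Y ⟩
          X * X * (x * x + y * y - (X * X + Y * Y)) + (x * Y - y * X) * (x * Y + y * X)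
            ≡⟨ cong₂ (λ u v → X * X * u + v * (x * Y + y * X)) (cong₂ _-_ (sym eq) (sym eq′)) xY-yX≡0 ⟩
          X * X * (Q - Q) + 0ℤ * (x * Y + y * X)    ≡⟨ vanish (X * X) Q (x * Y + y * X) ⟩
          0ℤ                                        ∎
        x²≡X² : x * x ≡ X * X
        x²≡X² = [ ℤ.i-j≡0⇒i≡j _ _ , (λ Q≡0 → contradiction Q≡0 Q≢0) ]′ (ℤ.i*j≡0⇒i≡0∨j≡0 (x * x - X * X) product)

      -- Here q would be x^2 + X^2, an even number.
      perpendicular : x * X + y * Y ≡ 0ℤ → ⊥
      perpendicular xX+yY≡0 = 2i≢1+2j (1ℤ + (+ 4 * a + + 8 * (a * a) + + 4 * b + + 8 * (b * b))) k (begin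
          + 2 * (1ℤ + (+ 4 * a + + 8 * (a * a) + + 4 * b + + 8 * (b * b)))  ≡⟨ squares a b ⟩
          (1ℤ + a * + 4) * (1ℤ + a * + 4) + (1ℤ + b * + 4) * (1ℤ + b * + 4)     ≡⟨ cong₂ (λ u v → u * u + v * v) x≡1+4a X≡1+4b ⟨
          x * x + X * X                                                       ≡⟨ Q≡x²+X² ⟨
          Q                                                                   ≡⟨ q-odd ⟩
          1ℤ + + 2 * k                                                        ∎)
        where
        open ≡-Reasoning
        a b : ℤ
        a = S.quotient (S.∣ᵤ⇒∣ {+ 4} {x - 1ℤ} 4∣x-1)
        b = S.quotient (S.∣ᵤ⇒∣ {+ 4} {X - 1ℤ} 4∣X-1)
        unshift : ∀ x → x ≡ 1ℤ + (x - 1ℤ)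
        unshift = solve-∀
        x≡1+4a : x ≡ 1ℤ + a * + 4
        x≡1+4a = trans (unshift x) (cong (_+_ 1ℤ) (S._∣_.equality (S.∣ᵤ⇒∣ {+ 4} {x - 1ℤ} 4∣x-1)))
        X≡1+4b : X ≡ 1ℤ + b * + 4
        X≡1+4b = trans (unshift X) (cong (_+_ 1ℤ) (S._∣_.equality (S.∣ᵤ⇒∣ {+ 4} {X - 1ℤ} 4∣X-1)))
        squares : ∀ a b → + 2 * (1ℤ + (+ 4 * a + + 8 * (a * a) + + 4 * b + + 8 * (b * b))) ≡ (1ℤ + a * + 4) * (1ℤ + a * + 4) + (1ℤ + b * + 4) * (1ℤ + b * + 4)
        squares = solve-∀
        identity : ∀ x y X Y → (x * x + y * y) * (X * X + Y * Y) - (x * x) * (X * X + Y * Y) - (X * X) * (x * x + y * y)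
                             ≡ (x * X + y * Y) * (y * Y - x * X)
        identity = solve-∀
        factor : ∀ Q x X → (Q - (x * x + X * X)) * Q ≡ Q * Q - (x * x) * Q - (X * X) * Q
        factor = solve-∀
        product : (Q - (x * x + X * X)) * Q ≡ 0ℤ
        product = begin
          (Q - (x * x + X * X)) * Q                    ≡⟨ factor Q x X ⟩
          Q * Q - (x * x) * Q - (X * X) * Q            ≡⟨ cong₂ (λ u v → u * v - (x * x) * v - (X * X) * u) eq eq′ ⟩
          (x * x + y * y) * (X * X + Y * Y) - (x * x) * (X * X + Y * Y) - (X * X) * (x * x + y * y) ≡⟨ identity x y X Y ⟩
          (x * X + y * Y) * (y * Y - x * X)            ≡⟨ cong (_* (y * Y - x * X)) xX+yY≡0 ⟩
          0ℤ * (y * Y - x * X)                         ≡⟨ ℤ.*-zeroˡ (y * Y - x * X) ⟩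
          0ℤ                                           ∎
        Q≡x²+X² : Q ≡ x * x + X * X
        Q≡x²+X² = [ ℤ.i-j≡0⇒i≡j _ _ , (λ Q≡0 → contradiction Q≡0 Q≢0) ]′ (ℤ.i*j≡0⇒i≡0∨j≡0 (Q - (x * x + X * X)) product)

      q∣cross : Q ∣ x * Y - y * X → x ≡ X
      q∣cross q∣ = [ parallel , (λ D≡0 → contradiction D≡0 perpendicular) ]′ (multiple-leg q (x * Y - y * X) (x * X + y * Y) q∣ legs)

    q⊥ : ∀ i → ¬ (+ p ∣ i) → Coprime q ℤ.∣ i ∣
    q⊥ i p∤i = subst (λ n → Coprime n ℤ.∣ i ∣) (sym q≡pʳ) (coprime-^ (prime∤⇒coprime p-prime p∤i) r)

    -- The two cross terms have the product q (x^2 - X^2).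
    module Cross (x y X Y : ℤ) (eq : Q ≡ x * x + y * y) (eq′ : Q ≡ X * X + Y * Y) where
      q∣AB : q ℕ.∣ ℤ.∣ x * Y - y * X ∣ ℕ.* ℤ.∣ x * Y + y * X ∣
      q∣AB = subst (q ℕ.∣_) (ℤ.abs-* (x * Y - y * X) (x * Y + y * X)) (S.∣⇒∣ᵤ {Q} {(x * Y - y * X) * (x * Y + y * X)} (S.divides (x * x - X * X) (begin
        (x * Y - y * X) * (x * Y + y * X)                     ≡⟨ identity x y X Y ⟩
        x * x * (X * X + Y * Y) - X * X * (x * x + y * y)     ≡⟨ cong₂ (λ u v → x * x * u - X * X * v) (sym eq′) (sym eq) ⟩
        x * x * Q - X * X * Q                                 ≡⟨ factor (x * x) (X * X) Q ⟩
        (x * x - X * X) * Q                                   ∎)))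
        where
        open ≡-Reasoning
        identity : ∀ x y X Y → (x * Y - y * X) * (x * Y + y * X) ≡ x * x * (X * X + Y * Y) - X * X * (x * x + y * y)
        identity = solve-∀
        factor : ∀ a b Q → a * Q - b * Q ≡ (a - b) * Q
        factor = solve-∀

  -- Not both cross terms are divisible by p, as otherwise p would divide
  -- 2 x Y, then Y, and then X.  Hence q divides one of them.
  two-squares-unique : ∀ {x y X Y} → Q ≡ x * x + y * y → Q ≡ X * X + Y * Y →
    ¬ (+ p ∣ x) → ¬ (+ p ∣ X) → + 4 ∣ x - 1ℤ → + 4 ∣ X - 1ℤ → x ≡ X
  two-squares-unique {x} {y} {X} {Y} eq eq′ p∤x p∤X 4∣x-1 4∣X-1 with p ℕ.∣? ℤ.∣ A ∣ | p ℕ.∣? ℤ.∣ B ∣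
    where
    A B : ℤ
    A = x * Y - y * X
    B = x * Y + y * X
  ... | no p∤A | _ = q∣cross {x} { - y} {X} {Y} (trans eq (cong (_+_ (x * x)) (neg*neg y))) eq′ 4∣x-1 4∣X-1
      (subst (Q ∣_) (flip x y X Y) (coprime-divisor (q⊥ (x * Y - y * X) p∤A) q∣AB))
    where
    neg*neg : ∀ y → y * y ≡ - y * - y
    neg*neg = solve-∀
    flip : ∀ x y X Y → x * Y + y * X ≡ x * Y - - y * X
    flip = solve-∀
    open Cross x y X Y eq eq′
  ... | yes _ | no p∤B = q∣cross {x} {y} {X} {Y} eq eq′ 4∣x-1 4∣X-1
      (coprime-divisor (q⊥ (x * Y + y * X) p∤B) (subst (q ℕ.∣_) (ℕ.*-comm ℤ.∣ x * Y - y * X ∣ ℤ.∣ x * Y + y * X ∣) q∣AB))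
    where open Cross x y X Y eq eq′
  ... | yes p∣A | yes p∣B = contradiction p∣X p∤X
    where
    double : ∀ x y X Y → (x * Y - y * X) + (x * Y + y * X) ≡ + 2 * (x * Y)
    double = solve-∀
    isolate : ∀ X Y → X * X ≡ (X * X + Y * Y) + Y * - Y
    isolate = solve-∀
    p∣Y : + p ∣ Y
    p∣Y = [ (λ p∣2 → contradiction p∣2 p∤2) , [ (λ p∣x → contradiction p∣x p∤x) , id ]′ ∘ prime∣* p-prime x Y ]′
      (prime∣* p-prime (+ 2) (x * Y) (subst (+ p ∣_) (double x y X Y) (∣i∣j⇒∣i+j {+ p} {x * Y - y * X} {x * Y + y * X} p∣A p∣B)))
    p∣X : + p ∣ X
    p∣X = [ id , id ]′ (prime∣* p-prime X X (subst (+ p ∣_) (sym (trans (isolate X Y) (cong (_+ Y * - Y) (sym eq′))))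
      (∣i∣j⇒∣i+j {+ p} {Q} {Y * - Y} p∣q (subst (p ℕ.∣_) (sym (ℤ.abs-* Y (- Y))) (ℕ.∣m⇒∣m*n ℤ.∣ - Y ∣ p∣Y)))))

-- Finite sums of integers.

sum-const : ∀ n c → sum {n} (λ _ → c) ≡ + n * c
sum-const zero    c = refl
sum-const (suc n) c = trans (cong (_+_ c) (sum-const n c)) (sym (ℤ.suc-* (+ n) c))

sum-0 : ∀ n → sum {n} (λ _ → 0ℤ) ≡ 0ℤ
sum-0 n = trans (sum-const n 0ℤ) (ℤ.*-zeroʳ (+ n))

sum-neg : (f : Fin n → ℤ) → sum (λ i → - f i) ≡ - sum f
sum-neg {zero}  f = refl
sum-neg {suc n} f = trans (cong (_+_ (- f zero)) (sum-neg (f ∘ suc))) (sym (ℤ.neg-distrib-+ (f zero) _))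

sum-minus : (f g : Fin n → ℤ) → sum (λ i → f i - g i) ≡ sum f - sum g
sum-minus f g = trans (∑-distrib-+ f (λ i → - g i)) (cong (_+_ (sum f)) (sum-neg g))

sum-reindex : (π π⁻¹ : Fin n → Fin n) → (∀ i → π (π⁻¹ i) ≡ i) → (∀ i → π⁻¹ (π i) ≡ i) →
              (f : Fin n → ℤ) → sum (λ i → f (π i)) ≡ sum f
sum-reindex π π⁻¹ r l f = sym (∑.sum-permute f (permutation π π⁻¹ r l))

sum-mono : {f g : Fin n → ℤ} → (∀ i → f i ≤ g i) → sum f ≤ sum g
sum-mono {zero}  f≤g = ℤ.≤-refl
sum-mono {suc n} f≤g = ℤ.+-mono-≤ (f≤g zero) (sum-mono (f≤g ∘ suc))

-- Termwise comparable families with equal sums agree.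
sum-≤-≡ : (f g : Fin n → ℤ) → (∀ i → f i ≤ g i) → sum f ≡ sum g → ∀ i → f i ≡ g i
sum-≤-≡ {suc n} f g f≤g eq = λ where
    zero    → f₀≡g₀
    (suc i) → sum-≤-≡ (f ∘ suc) (g ∘ suc) (f≤g ∘ suc) rest i
  where
  f₀≡g₀ : f zero ≡ g zero
  f₀≡g₀ = ℤ.≤-antisym (f≤g zero) (ℤ.≮⇒≥ λ f₀<g₀ →
    ℤ.<⇒≢ (ℤ.+-mono-<-≤ f₀<g₀ (sum-mono (f≤g ∘ suc))) eq)
  rest : sum (f ∘ suc) ≡ sum (g ∘ suc)
  rest = ℤ+.∙-cancelˡ (f zero) _ _ (trans eq (cong (λ c → c + sum (g ∘ suc)) (sym f₀≡g₀)))

-- The indicator of a decidable proposition.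
ind : ∀ {a} {A : Set a} → Dec A → ℤ
ind (yes _) = 1ℤ
ind (no  _) = 0ℤ

ind≥0 : ∀ {a} {A : Set a} (A? : Dec A) → 0ℤ ≤ ind A?
ind≥0 (yes _) = ℤ.+≤+ ℕ.z≤n
ind≥0 (no _)  = ℤ.+≤+ ℕ.z≤n

module _ {a} {A : Set a} where

  ind-yes : (A? : Dec A) → A → ind A? ≡ 1ℤ
  ind-yes (yes _) _ = refl
  ind-yes (no ¬a) a = contradiction a ¬a

  ind-no : (A? : Dec A) → ¬ A → ind A? ≡ 0ℤ
  ind-no (yes a) ¬a = contradiction a ¬a
  ind-no (no _)  _  = refl

ind-cong : ∀ {a b} {A : Set a} {B : Set b} (A? : Dec A) (B? : Dec B) →
           (A → B) → (B → A) → ind A? ≡ ind B?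
ind-cong (yes a) B? f g = sym (ind-yes B? (f a))
ind-cong (no ¬a) B? f g = sym (ind-no B? (¬a ∘ g))

ind-× : ∀ {a b} {A : Set a} {B : Set b} (A? : Dec A) (B? : Dec B) → ind (A? ×-dec B?) ≡ ind A? * ind B?
ind-× (yes _) B? = lemma B?
  where
  lemma : ∀ B? → ind (yes _ ×-dec B?) ≡ 1ℤ * ind B?
  lemma (yes _) = refl
  lemma (no _)  = refl
ind-× (no _) B? = sym (ℤ.*-zeroˡ (ind B?))

-- The Kronecker delta.
δ : Fin n → Fin n → ℤ
δ i j = ind (i Fin.≟ j)

δ-refl : (i : Fin n) → δ i i ≡ 1ℤ
δ-refl i = ind-yes (i Fin.≟ i) refl

δ-≡ : {i j : Fin n} → i ≡ j → δ i j ≡ 1ℤ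
δ-≡ = ind-yes (_ Fin.≟ _)

δ-≢ : {i j : Fin n} → i ≢ j → δ i j ≡ 0ℤ
δ-≢ = ind-no (_ Fin.≟ _)

δ-cong : ∀ {m} {i j : Fin n} {k l : Fin m} → (i ≡ j → k ≡ l) → (k ≡ l → i ≡ j) → δ i j ≡ δ k l
δ-cong = ind-cong (_ Fin.≟ _) (_ Fin.≟ _)

δ-sym : (i j : Fin n) → δ i j ≡ δ j i
δ-sym i j = δ-cong sym sym

sum-δ : (i : Fin n) (f : Fin n → ℤ) → sum (λ j → f j * δ i j) ≡ f i
sum-δ {suc n} zero f = begin
  f zero * 1ℤ + sum (λ j → f (suc j) * 0ℤ)
    ≡⟨ cong₂ _+_ (ℤ.*-identityʳ (f zero)) (trans (sum-cong λ j → ℤ.*-zeroʳ (f (suc j))) (sum-0 n)) ⟩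
  f zero + 0ℤ                              ≡⟨ ℤ.+-identityʳ (f zero) ⟩
  f zero                                   ∎
  where open ≡-Reasoning
sum-δ {suc n} (suc i) f = begin
  f zero * 0ℤ + sum (λ j → f (suc j) * δ (suc i) (suc j))
    ≡⟨ cong₂ _+_ (ℤ.*-zeroʳ (f zero)) (sum-cong λ j → cong (f (suc j) *_) (δ-cong {i = suc i} {suc j} {i} {j} Fin.suc-injective (cong suc))) ⟩
  0ℤ + sum (λ j → f (suc j) * δ i j)                      ≡⟨ ℤ.+-identityˡ _ ⟩
  sum (λ j → f (suc j) * δ i j)                           ≡⟨ sum-δ i (f ∘ suc) ⟩
  f (suc i)                                               ∎
  where open ≡-Reasoning

sum-1* : (f : Fin n → ℤ) → sum (λ i → 1ℤ * f i) ≡ sum f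
sum-1* f = sum-cong λ i → ℤ.*-identityˡ (f i)

sum-δ-1 : (i : Fin n) → sum (δ i) ≡ 1ℤ
sum-δ-1 i = trans (sym (sum-1* (δ i))) (sum-δ i (λ _ → 1ℤ))

-- Finite fields.

-- A field with q elements, carried by Fin q with propositional equality.
record FiniteField (q : ℕ) : Set where
  infixl 6 _⊕_
  infixl 7 _⊗_
  infix  8 ⊝_
  field
    _⊕_ _⊗_ : Fin q → Fin q → Fin q
    ⊝_      : Fin q → Fin q
    𝟘 𝟙     : Fin q
    isCommutativeRing : IsCommutativeRing _≡_ _⊕_ _⊗_ ⊝_ 𝟘 𝟙
    𝟙≢𝟘     : 𝟙 ≢ 𝟘
    inverse : ∀ x → x ≢ 𝟘 → ∃ λ y → x ⊗ y ≡ 𝟙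

module Field {q : ℕ} (𝔽 : FiniteField q) where

  open FiniteField 𝔽 public

  commutativeRing : CommutativeRing 0ℓ 0ℓ
  commutativeRing = record { isCommutativeRing = isCommutativeRing }

  open CommutativeRing commutativeRing public
    using (semiring; commutativeSemiring; ring; *-commutativeMonoid)
    renaming ( +-identityˡ to ⊕-identityˡ; +-identityʳ to ⊕-identityʳ
             ; -‿inverseʳ to ⊝-inverseʳ; *-comm to ⊗-comm; *-assoc to ⊗-assoc
             ; *-identityˡ to ⊗-identityˡ; *-identityʳ to ⊗-identityʳ
             ; zeroˡ to ⊗-zeroˡ; zeroʳ to ⊗-zeroʳ)
  open Algebra.Properties.CommutativeSemiring.Exp commutativeSemiring public
    using (_^_; ^-homo-*; ^-distrib-*)
  open Algebra.Properties.Semiring.Mult semiring public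
    using (×-homo-+; ×1-homo-*; ×-assoc-*) renaming (_×_ to _·_)
  open Algebra.Properties.Ring ring public
    using () renaming (-0#≈0# to ⊝𝟘; -‿involutive to ⊝-involutive; -‿distribˡ-* to ⊝-distribˡ; -‿+-comm to ⊝-⊕)

  -- The canonical ring homomorphism from the integers.
  ι : ℤ → Fin q
  ι (+ n)    = n · 𝟙
  ι -[1+ n ] = ⊝ (suc n · 𝟙)

  ι-neg : ∀ i → ι (- i) ≡ ⊝ ι i
  ι-neg (+ zero)  = sym ⊝𝟘
  ι-neg (+ suc n) = refl
  ι-neg -[1+ n ]  = sym (⊝-involutive _)

  private
    cancel : ∀ a b c → b ⊕ ⊝ c ≡ (a ⊕ b) ⊕ ⊝ (a ⊕ c)
    cancel a b c = sym (begin
      (a ⊕ b) ⊕ ⊝ (a ⊕ c)     ≡⟨ cong₂ _⊕_ (R.+-comm a b) (sym (⊝-⊕ a c)) ⟩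
      (b ⊕ a) ⊕ (⊝ a ⊕ ⊝ c)   ≡⟨ R.+-assoc b a _ ⟩
      b ⊕ (a ⊕ (⊝ a ⊕ ⊝ c))   ≡⟨ cong (b ⊕_) (R.+-assoc a _ _) ⟨
      b ⊕ ((a ⊕ ⊝ a) ⊕ ⊝ c)   ≡⟨ cong (λ z → b ⊕ (z ⊕ ⊝ c)) (⊝-inverseʳ a) ⟩
      b ⊕ (𝟘 ⊕ ⊝ c)           ≡⟨ cong (b ⊕_) (⊕-identityˡ _) ⟩
      b ⊕ ⊝ c                 ∎)
      where
      open ≡-Reasoning
      module R = CommutativeRing commutativeRing

  ι-⊖ : ∀ m n → ι (m ⊖ n) ≡ m · 𝟙 ⊕ ⊝ (n · 𝟙)
  ι-⊖ m       zero    = sym (trans (cong (m · 𝟙 ⊕_) ⊝𝟘) (⊕-identityʳ _))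
  ι-⊖ zero    (suc n) = sym (⊕-identityˡ _)
  ι-⊖ (suc m) (suc n) = begin
    ι (suc m ⊖ suc n)               ≡⟨ cong ι (ℤ.[1+m]⊖[1+n]≡m⊖n m n) ⟩
    ι (m ⊖ n)                       ≡⟨ ι-⊖ m n ⟩
    m · 𝟙 ⊕ ⊝ (n · 𝟙)               ≡⟨ cancel 𝟙 _ _ ⟩
    suc m · 𝟙 ⊕ ⊝ (suc n · 𝟙)       ∎
    where open ≡-Reasoning

  ι-+ : ∀ i j → ι (i + j) ≡ ι i ⊕ ι j
  ι-+ (+ m)    (+ n)    = ×-homo-+ 𝟙 m n
  ι-+ (+ m)    -[1+ n ] = ι-⊖ m (suc n)
  ι-+ -[1+ m ] (+ n)    = trans (ι-⊖ n (suc m)) (CommutativeRing.+-comm commutativeRing _ _)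
  ι-+ -[1+ m ] -[1+ n ] = begin
    ⊝ (suc (suc (m ℕ.+ n)) · 𝟙)        ≡⟨ cong (λ k → ⊝ (k · 𝟙)) (ℕ.+-suc (suc m) n) ⟨
    ⊝ ((suc m ℕ.+ suc n) · 𝟙)          ≡⟨ cong ⊝_ (×-homo-+ 𝟙 (suc m) (suc n)) ⟩
    ⊝ (suc m · 𝟙 ⊕ suc n · 𝟙)          ≡⟨ ⊝-⊕ _ _ ⟨
    ⊝ (suc m · 𝟙) ⊕ ⊝ (suc n · 𝟙)      ∎
    where open ≡-Reasoning

  private
    ι-*⁺ : ∀ m j → ι (+ m * j) ≡ m · 𝟙 ⊗ ι j
    ι-*⁺ zero    j = trans (cong ι (ℤ.*-zeroˡ j)) (sym (⊗-zeroˡ _))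
    ι-*⁺ (suc m) j = begin
      ι (+ suc m * j)            ≡⟨ cong ι (ℤ.suc-* (+ m) j) ⟩
      ι (j + + m * j)            ≡⟨ ι-+ j (+ m * j) ⟩
      ι j ⊕ ι (+ m * j)          ≡⟨ cong₂ _⊕_ (sym (⊗-identityˡ _)) (ι-*⁺ m j) ⟩
      𝟙 ⊗ ι j ⊕ (m · 𝟙) ⊗ ι j    ≡⟨ CommutativeRing.distribʳ commutativeRing (ι j) 𝟙 _ ⟨
      (𝟙 ⊕ m · 𝟙) ⊗ ι j          ∎
      where open ≡-Reasoning

  ι-* : ∀ i j → ι (i * j) ≡ ι i ⊗ ι j
  ι-* (+ m)    j = ι-*⁺ m j
  ι-* -[1+ m ] j = begin
    ι (- (+ suc m) * j)  ≡⟨ cong ι (ℤ.neg-distribˡ-* (+ suc m) j) ⟨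
    ι (- (+ suc m * j))  ≡⟨ ι-neg (+ suc m * j) ⟩
    ⊝ ι (+ suc m * j)    ≡⟨ cong ⊝_ (ι-*⁺ (suc m) j) ⟩
    ⊝ (suc m · 𝟙 ⊗ ι j)  ≡⟨ ⊝-distribˡ _ _ ⟩
    ⊝ (suc m · 𝟙) ⊗ ι j  ∎
    where open ≡-Reasoning

  ι-1 : ι 1ℤ ≡ 𝟙
  ι-1 = ⊕-identityʳ 𝟙

  -- A solver for ring identities with integer coefficients; the element 𝟙 has
  -- to be treated as a variable.
  private
    ℤ-rawRing : RawRing 0ℓ 0ℓ
    ℤ-rawRing = CommutativeRing.rawRing ℤ.+-*-commutativeRing

    ι-morphism : ℤ-rawRing -Raw-AlmostCommutative⟶ fromCommutativeRing commutativeRing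
    ι-morphism = record
      { ⟦_⟧ = ι ; +-homo = ι-+ ; *-homo = ι-* ; -‿homo = ι-neg ; 0-homo = refl ; 1-homo = ι-1 }

    ι-≟ : WeaklyDecidable (Induced-equivalence ι-morphism)
    ι-≟ i j with i ℤ.≟ j
    ... | yes i≡j = just (cong ι i≡j)
    ... | no _    = nothing

  module Solver = Algebra.Solver.Ring ℤ-rawRing (fromCommutativeRing commutativeRing) ι-morphism ι-≟
  open Solver using (solve; _:=_; _:+_; _:*_; :-_; _:-_)

  infix 4 _≟_
  _≟_ : (x y : Fin q) → Dec (x ≡ y)
  _≟_ = Fin._≟_

  x⊝y≡𝟘⇒x≡y : ∀ {x y} → x ⊕ ⊝ y ≡ 𝟘 → x ≡ y
  x⊝y≡𝟘⇒x≡y {x} {y} eq = begin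
    x               ≡⟨ solve 2 (λ x y → x := (x :+ :- y) :+ y) refl x y ⟩
    (x ⊕ ⊝ y) ⊕ y   ≡⟨ cong (_⊕ y) eq ⟩
    𝟘 ⊕ y           ≡⟨ ⊕-identityˡ y ⟩
    y               ∎
    where open ≡-Reasoning

  x≡y⇒x⊝y≡𝟘 : ∀ {x y} → x ≡ y → x ⊕ ⊝ y ≡ 𝟘
  x≡y⇒x⊝y≡𝟘 {x} refl = ⊝-inverseʳ x

  infix 9 _⁻¹

  -- The inverse, extended by 0 to 0 so that it is an involution of the field.
  _⁻¹ : Fin q → Fin q
  x ⁻¹ with x ≟ 𝟘
  ... | yes _  = 𝟘
  ... | no x≢𝟘 = proj₁ (inverse x x≢𝟘)

  ⁻¹-inverseʳ : ∀ {x} → x ≢ 𝟘 → x ⊗ x ⁻¹ ≡ 𝟙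
  ⁻¹-inverseʳ {x} x≢𝟘 with x ≟ 𝟘
  ... | yes x≡𝟘 = contradiction x≡𝟘 x≢𝟘
  ... | no x≢𝟘′ = proj₂ (inverse x x≢𝟘′)

  ⁻¹-inverseˡ : ∀ {x} → x ≢ 𝟘 → x ⁻¹ ⊗ x ≡ 𝟙
  ⁻¹-inverseˡ x≢𝟘 = trans (⊗-comm _ _) (⁻¹-inverseʳ x≢𝟘)

  𝟘⁻¹ : 𝟘 ⁻¹ ≡ 𝟘
  𝟘⁻¹ with 𝟘 ≟ 𝟘
  ... | yes _   = refl
  ... | no 𝟘≢𝟘 = contradiction refl 𝟘≢𝟘

  cancel-⁻¹ : ∀ {c} x → c ≢ 𝟘 → c ⊗ (c ⁻¹ ⊗ x) ≡ x
  cancel-⁻¹ {c} x c≢𝟘 = trans (sym (⊗-assoc c _ x)) (trans (cong (_⊗ x) (⁻¹-inverseʳ c≢𝟘)) (⊗-identityˡ x))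

  cancel-⁻¹′ : ∀ {c} x → c ≢ 𝟘 → c ⁻¹ ⊗ (c ⊗ x) ≡ x
  cancel-⁻¹′ {c} x c≢𝟘 = trans (sym (⊗-assoc _ c x)) (trans (cong (_⊗ x) (⁻¹-inverseˡ c≢𝟘)) (⊗-identityˡ x))

  ⊗-cancelˡ : ∀ {c x y} → c ≢ 𝟘 → c ⊗ x ≡ c ⊗ y → x ≡ y
  ⊗-cancelˡ {c} {x} {y} c≢𝟘 eq = begin
    x              ≡⟨ cancel-⁻¹′ x c≢𝟘 ⟨
    c ⁻¹ ⊗ (c ⊗ x) ≡⟨ cong (c ⁻¹ ⊗_) eq ⟩
    c ⁻¹ ⊗ (c ⊗ y) ≡⟨ cancel-⁻¹′ y c≢𝟘 ⟩
    y              ∎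
    where open ≡-Reasoning

  ⊗-integral : ∀ x {y} → x ⊗ y ≡ 𝟘 → x ≡ 𝟘 ⊎ y ≡ 𝟘
  ⊗-integral x {y} xy≡𝟘 with x ≟ 𝟘
  ... | yes x≡𝟘 = inj₁ x≡𝟘
  ... | no  x≢𝟘 = inj₂ (⊗-cancelˡ x≢𝟘 (trans xy≡𝟘 (sym (⊗-zeroʳ x))))

  ⊗-≢𝟘 : ∀ {x y} → x ≢ 𝟘 → y ≢ 𝟘 → x ⊗ y ≢ 𝟘
  ⊗-≢𝟘 x≢𝟘 y≢𝟘 xy≡𝟘 = [ x≢𝟘 , y≢𝟘 ]′ (⊗-integral _ xy≡𝟘)

  ^-≢𝟘 : ∀ {x} → x ≢ 𝟘 → ∀ n → x ^ n ≢ 𝟘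
  ^-≢𝟘 x≢𝟘 zero    = 𝟙≢𝟘
  ^-≢𝟘 x≢𝟘 (suc n) = ⊗-≢𝟘 x≢𝟘 (^-≢𝟘 x≢𝟘 n)

  ⁻¹-≢𝟘 : ∀ {x} → x ≢ 𝟘 → x ⁻¹ ≢ 𝟘
  ⁻¹-≢𝟘 {x} x≢𝟘 eq = 𝟙≢𝟘 (trans (sym (⁻¹-inverseʳ x≢𝟘)) (trans (cong (x ⊗_) eq) (⊗-zeroʳ x)))

  ⁻¹-involutive : ∀ x → x ⁻¹ ⁻¹ ≡ x
  ⁻¹-involutive x with x ≟ 𝟘
  ... | yes refl = 𝟘⁻¹
  ... | no x≢𝟘 = ⊗-cancelˡ y≢𝟘 (trans (⁻¹-inverseʳ y≢𝟘) (sym (trans (⊗-comm _ x) (proj₂ (inverse x x≢𝟘)))))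
    where
    y≢𝟘 : proj₁ (inverse x x≢𝟘) ≢ 𝟘
    y≢𝟘 eq = 𝟙≢𝟘 (trans (sym (proj₂ (inverse x x≢𝟘))) (trans (cong (x ⊗_) eq) (⊗-zeroʳ x)))

  ⊝-≢𝟘 : ∀ {x} → x ≢ 𝟘 → ⊝ x ≢ 𝟘
  ⊝-≢𝟘 {x} x≢𝟘 eq = x≢𝟘 (trans (sym (⊝-involutive x)) (trans (cong ⊝_ eq) ⊝𝟘))

  x²≡y²⇒x≡±y : ∀ x y → x ⊗ x ≡ y ⊗ y → x ≡ y ⊎ x ≡ ⊝ y
  x²≡y²⇒x≡±y x y eq with ⊗-integral (x ⊕ ⊝ y) {x ⊕ y}
      (trans (solve 2 (λ x y → (x :- y) :* (x :+ y) := x :* x :- y :* y) refl x y) (x≡y⇒x⊝y≡𝟘 eq))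
  ... | inj₁ d = inj₁ (x⊝y≡𝟘⇒x≡y d)
  ... | inj₂ d = inj₂ (x⊝y≡𝟘⇒x≡y (trans (cong (x ⊕_) (⊝-involutive y)) d))

  -- Sums over the field are invariant under its permutations.
  sum-translate : ∀ c (f : Fin q → ℤ) → sum (λ x → f (x ⊕ c)) ≡ sum f
  sum-translate c = sum-reindex (_⊕ c) (_⊕ ⊝ c)
    (λ x → solve 2 (λ x c → (x :+ :- c) :+ c := x) refl x c)
    (λ x → solve 2 (λ x c → (x :+ c) :+ :- c := x) refl x c)

  sum-scale : ∀ {c} → c ≢ 𝟘 → (f : Fin q → ℤ) → sum (λ x → f (c ⊗ x)) ≡ sum f
  sum-scale {c} c≢𝟘 = sum-reindex (c ⊗_) (c ⁻¹ ⊗_) (λ x → cancel-⁻¹ x c≢𝟘) (λ x → cancel-⁻¹′ x c≢𝟘)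

  sum-⁻¹ : (f : Fin q → ℤ) → sum (λ x → f (x ⁻¹)) ≡ sum f
  sum-⁻¹ = sum-reindex _⁻¹ _⁻¹ ⁻¹-involutive ⁻¹-involutive

-- A sum in a commutative monoid with a single nontrivial term.
module SumSingle {c ℓ : Level} (M : CommutativeMonoid c ℓ) where
  open CommutativeMonoid M
    renaming (sym to ≈-sym; trans to ≈-trans)
  open Algebra.Properties.CommutativeMonoid.Sum M renaming (sum to ∑)

  sum-single : ∀ {n} (i : Fin n) (f : Fin n → Carrier) → (∀ j → j ≢ i → f j ≈ ε) → ∑ f ≈ f i
  sum-single {suc n} i f vanish = ≈-trans (sum-remove {i = i} f) (≈-trans
    (∙-congˡ (≈-trans (sum-cong-≋ λ j → vanish (punchIn i j) (Fin.punchInᵢ≢i i j)) (sum-replicate-zero n)))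
    (identityʳ (f i)))

module FermatAndRoots {q : ℕ} (𝔽 : FiniteField q) where
  open Field 𝔽
  open Solver using (solve; _:=_; _:+_; _:*_; :-_; _:-_)
  module F∑ = Algebra.Properties.Semiring.Sum semiring
  module F∏ = Algebra.Properties.CommutativeMonoid.Sum *-commutativeMonoid

  -- The order of the field is zero in the field: translation by 1 permutes
  -- the elements, so it does not change their sum.
  q·𝟙≡𝟘 : q · 𝟙 ≡ 𝟘
  q·𝟙≡𝟘 = R.+-identityʳ-unique (F∑.sum id) (q · 𝟙) (begin
    F∑.sum id ⊕ q · 𝟙               ≡⟨ cong (F∑.sum id ⊕_) (F∑.sum-replicate q {𝟙}) ⟨
    F∑.sum id ⊕ F∑.sum {q} (λ _ → 𝟙) ≡⟨ F∑.∑-distrib-+ id (λ _ → 𝟙) ⟨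
    F∑.sum (λ x → x ⊕ 𝟙)            ≡⟨ F∑.sum-permute id (permutation (_⊕ 𝟙) (_⊕ ⊝ 𝟙)
                                        (λ x → solve 2 (λ x c → (x :+ :- c) :+ c := x) refl x 𝟙)
                                        (λ x → solve 2 (λ x c → (x :+ c) :+ :- c := x) refl x 𝟙)) ⟨
    F∑.sum id                       ∎)
    where
    open ≡-Reasoning
    import Algebra.Properties.Ring ring as R

  -- Fermat: multiplication by c permutes the nonzero elements, so it does not
  -- change their product.  The product runs over all x, with 0 replaced by 1.
  module _ {c : Fin q} (c≢𝟘 : c ≢ 𝟘) where
    private
      -- At x = 0 the three functions are 1, 1 and c; elsewhere x, c and 1.
      unit weight special : Fin q → Fin q
      unit x with x ≟ 𝟘
      ... | yes _ = 𝟙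
      ... | no  _ = x
      weight x with x ≟ 𝟘
      ... | yes _ = 𝟙
      ... | no  _ = c
      special x with x ≟ 𝟘
      ... | yes _ = c
      ... | no  _ = 𝟙

      unit≢𝟘 : ∀ x → unit x ≢ 𝟘
      unit≢𝟘 x with x ≟ 𝟘
      ... | yes _   = 𝟙≢𝟘
      ... | no  x≢𝟘 = x≢𝟘

      unit-scale : ∀ x → unit (c ⊗ x) ≡ weight x ⊗ unit x
      unit-scale x with x ≟ 𝟘 | c ⊗ x ≟ 𝟘
      ... | yes _    | yes _ = sym (⊗-identityˡ 𝟙)
      ... | yes refl | no n  = contradiction (⊗-zeroʳ c) n
      ... | no x≢𝟘   | yes z = contradiction z (⊗-≢𝟘 c≢𝟘 x≢𝟘)
      ... | no _     | no _  = refl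

      weight-special : ∀ x → weight x ⊗ special x ≡ c
      weight-special x with x ≟ 𝟘
      ... | yes _ = ⊗-identityˡ c
      ... | no _  = ⊗-identityʳ c

      special-𝟘 : special 𝟘 ≡ c
      special-𝟘 with 𝟘 ≟ 𝟘
      ... | yes _ = refl
      ... | no  n = contradiction refl n

      special-≢𝟘 : ∀ x → x ≢ 𝟘 → special x ≡ 𝟙
      special-≢𝟘 x x≢𝟘 with x ≟ 𝟘
      ... | yes x≡𝟘 = contradiction x≡𝟘 x≢𝟘
      ... | no _    = refl

      ∏-≢𝟘 : ∀ {n} (f : Fin n → Fin q) → (∀ i → f i ≢ 𝟘) → F∏.sum f ≢ 𝟘
      ∏-≢𝟘 {zero}  f f≢𝟘 = 𝟙≢𝟘
      ∏-≢𝟘 {suc n} f f≢𝟘 = ⊗-≢𝟘 (f≢𝟘 zero) (∏-≢𝟘 (f ∘ suc) (f≢𝟘 ∘ suc))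

      ∏weight≡𝟙 : F∏.sum weight ≡ 𝟙
      ∏weight≡𝟙 = ⊗-cancelˡ (∏-≢𝟘 unit unit≢𝟘) (begin
        F∏.sum unit ⊗ F∏.sum weight         ≡⟨ ⊗-comm _ _ ⟩
        F∏.sum weight ⊗ F∏.sum unit         ≡⟨ F∏.∑-distrib-+ weight unit ⟨
        F∏.sum (λ x → weight x ⊗ unit x)    ≡⟨ F∏.sum-cong-≗ unit-scale ⟨
        F∏.sum (λ x → unit (c ⊗ x))         ≡⟨ F∏.sum-permute unit (permutation (c ⊗_) (c ⁻¹ ⊗_)
                                                 (λ x → cancel-⁻¹ x c≢𝟘) (λ x → cancel-⁻¹′ x c≢𝟘)) ⟨
        F∏.sum unit                         ≡⟨ ⊗-identityʳ _ ⟨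
        F∏.sum unit ⊗ 𝟙                     ∎)
        where open ≡-Reasoning

    fermat-q : c ^ q ≡ c
    fermat-q = begin
      c ^ q                                   ≡⟨ F∏.sum-replicate q ⟨
      F∏.sum {q} (λ _ → c)                    ≡⟨ F∏.sum-cong-≗ weight-special ⟨
      F∏.sum (λ x → weight x ⊗ special x)     ≡⟨ F∏.∑-distrib-+ weight special ⟩
      F∏.sum weight ⊗ F∏.sum special
        ≡⟨ cong₂ _⊗_ ∏weight≡𝟙 (SumSingle.sum-single *-commutativeMonoid 𝟘 special special-≢𝟘) ⟩
      𝟙 ⊗ special 𝟘                           ≡⟨ ⊗-identityˡ _ ⟩
      special 𝟘                               ≡⟨ special-𝟘 ⟩
      c                                       ∎
      where open ≡-Reasoning

    fermat : ∀ {k} → q ≡ suc k → c ^ k ≡ 𝟙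
    fermat {k} q≡1+k = ⊗-cancelˡ c≢𝟘 (trans (trans (cong (c ^_) (sym q≡1+k)) fermat-q) (sym (⊗-identityʳ c)))

  -- Monic polynomial functions of degree n, in Horner form.
  data Monic : ℕ → (Fin q → Fin q) → Set where
    const : ∀ {f} → (∀ x → f x ≡ 𝟙) → Monic 0 f
    horner : ∀ {n f g} c → Monic n g → (∀ x → f x ≡ c ⊕ x ⊗ g x) → Monic (suc n) f

  monic-+ : ∀ {n f g} a → Monic (suc n) f → Monic n g → Monic (suc n) (λ x → f x ⊕ a ⊗ g x)
  monic-+ {zero} {f} {g} a (horner c one f≡) (const g≡𝟙) =
    horner (c ⊕ a) one λ x → trans (cong₂ (λ u v → u ⊕ a ⊗ v) (f≡ x) (g≡𝟙 x))
      (trans (cong (_ ⊕_) (⊗-identityʳ a))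
        (solve 3 (λ c a y → (c :+ y) :+ a := (c :+ a) :+ y) refl c a _))
  monic-+ {suc n} a (horner c f′ f≡) (horner d g′ g≡) =
    horner (c ⊕ a ⊗ d) (monic-+ a f′ g′) λ x → trans (cong₂ (λ u v → u ⊕ a ⊗ v) (f≡ x) (g≡ x))
      (solve 6 (λ c a d x u v → (c :+ x :* u) :+ a :* (d :+ x :* v) := (c :+ a :* d) :+ x :* (u :+ a :* v)) refl c a d x _ _)

  -- f(x) - f(a) = (x - a) h(x) with h monic of one degree less.
  monic-difference : ∀ {n f} a → Monic (suc n) f →
                     ∃ λ h → Monic n h × (∀ x → f x ⊕ ⊝ f a ≡ (x ⊕ ⊝ a) ⊗ h x)
  monic-difference {zero} {f} a (horner {g = g} c (const g≡𝟙) f≡) =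
    (λ _ → 𝟙) , const (λ _ → refl) , λ x → begin
      f x ⊕ ⊝ f a                       ≡⟨ cong₂ (λ u v → u ⊕ ⊝ v) (value x) (value a) ⟩
      (c ⊕ x) ⊕ ⊝ (c ⊕ a)               ≡⟨ solve 3 (λ c x a → (c :+ x) :- (c :+ a) := x :- a) refl c x a ⟩
      x ⊕ ⊝ a                           ≡⟨ ⊗-identityʳ _ ⟨
      (x ⊕ ⊝ a) ⊗ 𝟙                     ∎
    where
    open ≡-Reasoning
    value : ∀ x → f x ≡ c ⊕ x
    value x = trans (f≡ x) (cong (c ⊕_) (trans (cong (x ⊗_) (g≡𝟙 x)) (⊗-identityʳ x)))
  monic-difference {suc n} {f} a (horner {g = g} c g-monic f≡) with monic-difference a g-monic
  ... | h , h-monic , g≡ = (λ x → g x ⊕ a ⊗ h x) , monic-+ a g-monic h-monic , λ x → begin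
      f x ⊕ ⊝ f a                                 ≡⟨ cong₂ (λ u v → u ⊕ ⊝ v) (f≡ x) (f≡ a) ⟩
      (c ⊕ x ⊗ g x) ⊕ ⊝ (c ⊕ a ⊗ g a)             ≡⟨ solve 5 (λ c x a u v → (c :+ x :* u) :- (c :+ a :* v)
                                                       := (x :- a) :* u :+ a :* (u :- v)) refl c x a (g x) (g a) ⟩
      (x ⊕ ⊝ a) ⊗ g x ⊕ a ⊗ (g x ⊕ ⊝ g a)         ≡⟨ cong (λ u → (x ⊕ ⊝ a) ⊗ g x ⊕ a ⊗ u) (g≡ x) ⟩
      (x ⊕ ⊝ a) ⊗ g x ⊕ a ⊗ ((x ⊕ ⊝ a) ⊗ h x)
        ≡⟨ solve 4 (λ d u a v → d :* u :+ a :* (d :* v) := d :* (u :+ a :* v)) refl (x ⊕ ⊝ a) (g x) a (h x) ⟩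
      (x ⊕ ⊝ a) ⊗ (g x ⊕ a ⊗ h x)                 ∎
    where open ≡-Reasoning

  #roots≤degree : ∀ {n f} → Monic n f → sum (λ x → δ (f x) 𝟘) ≤ + n
  #roots≤degree {zero} (const f≡𝟙) = ℤ.≤-reflexive (trans
    (sum-cong λ x → δ-≢ λ fx≡𝟘 → 𝟙≢𝟘 (trans (sym (f≡𝟙 x)) fx≡𝟘)) (sum-0 q))
  #roots≤degree {suc n} {f} f-monic with Fin.any? (λ a → f a ≟ 𝟘)
  ... | no no-root = ℤ.≤-trans
    (ℤ.≤-reflexive (trans (sum-cong λ x → δ-≢ λ fx≡𝟘 → no-root (x , fx≡𝟘)) (sum-0 q)))
    (ℤ.+≤+ ℕ.z≤n)
  ... | yes (a , fa≡𝟘) with monic-difference a f-monic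
  ...   | h , h-monic , f≡ = begin
      sum (λ x → δ (f x) 𝟘)                  ≤⟨ sum-mono split ⟩
      sum (λ x → 1ℤ * δ a x + δ (h x) 𝟘)     ≡⟨ ∑-distrib-+ (λ x → 1ℤ * δ a x) (λ x → δ (h x) 𝟘) ⟩
      sum (λ x → 1ℤ * δ a x) + sum (λ x → δ (h x) 𝟘) ≡⟨ cong (_+ sum (λ x → δ (h x) 𝟘)) (sum-δ a (λ _ → 1ℤ)) ⟩
      1ℤ + sum (λ x → δ (h x) 𝟘)             ≤⟨ ℤ.+-monoʳ-≤ 1ℤ (#roots≤degree h-monic) ⟩
      + suc n                                ∎
    where
    open ℤ.≤-Reasoning
    split : ∀ x → δ (f x) 𝟘 ≤ 1ℤ * δ a x + δ (h x) 𝟘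
    split x with f x ≟ 𝟘 | a ≟ x
    ... | no _     | a≟x     = ℤ.+-mono-≤ {0ℤ} {1ℤ * ind a≟x} {0ℤ} (ℤ.≤-trans (ind≥0 a≟x) (ℤ.≤-reflexive (sym (ℤ.*-identityˡ _)))) (ind≥0 (h x ≟ 𝟘))
    ... | yes _    | yes _   = ℤ.+-monoʳ-≤ 1ℤ (ind≥0 (h x ≟ 𝟘))
    ... | yes fx≡𝟘 | no a≢x  = ℤ.≤-reflexive (sym (trans (ℤ.+-identityˡ _) (δ-≡
      ([ (λ d → contradiction (sym (x⊝y≡𝟘⇒x≡y d)) a≢x) , id ]′ (⊗-integral (x ⊕ ⊝ a)
        (trans (sym (f≡ x)) (x≡y⇒x⊝y≡𝟘 (trans fx≡𝟘 (sym fa≡𝟘)))))))))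

  monic-^ : ∀ n → Monic n (_^ n)
  monic-^ zero    = const λ _ → refl
  monic-^ (suc n) = horner 𝟘 (monic-^ n) λ x → sym (⊕-identityˡ _)

  -- For 0 < k < q - 1 the equation x^k = 1 has fewer than q - 1 solutions; k is
  -- written as a successor.
  nontrivial-power : ∀ k → suc (suc k) ℕ.< q → ∃ λ g → g ≢ 𝟘 × g ^ suc k ≢ 𝟙
  nontrivial-power k 2+k<q with Fin.any? (λ g → ¬? (g ≟ 𝟘) ×-dec ¬? (g ^ suc k ≟ 𝟙))
  ... | yes found = found
  ... | no  none  = contradiction 2+k<q (ℕ.≤⇒≯ (ℤ.drop‿+≤+ (begin
      + q                                     ≡⟨ trans (sum-const q 1ℤ) (ℤ.*-identityʳ (+ q)) ⟨
      sum {q} (λ _ → 1ℤ)                      ≤⟨ sum-mono cover ⟩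
      sum (λ x → 1ℤ * δ 𝟘 x + δ (p x) 𝟘)      ≡⟨ ∑-distrib-+ (λ x → 1ℤ * δ 𝟘 x) (λ x → δ (p x) 𝟘) ⟩
      sum (λ x → 1ℤ * δ 𝟘 x) + sum (λ x → δ (p x) 𝟘) ≡⟨ cong (_+ sum (λ x → δ (p x) 𝟘)) (sum-δ 𝟘 (λ _ → 1ℤ)) ⟩
      1ℤ + sum (λ x → δ (p x) 𝟘)              ≤⟨ ℤ.+-monoʳ-≤ 1ℤ (#roots≤degree p-monic) ⟩
      + suc (suc k)                           ∎)))
    where
    open ℤ.≤-Reasoning
    p : Fin q → Fin q
    p x = ⊝ 𝟙 ⊕ x ⊗ x ^ k
    p-monic : Monic (suc k) p
    p-monic = horner (⊝ 𝟙) (monic-^ k) λ _ → refl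
    cover : ∀ x → 1ℤ ≤ 1ℤ * δ 𝟘 x + δ (p x) 𝟘
    cover x with 𝟘 ≟ x
    ... | yes _  = ℤ.+-monoʳ-≤ 1ℤ (ind≥0 (p x ≟ 𝟘))
    ... | no 𝟘≢x = ℤ.≤-reflexive (sym (trans (ℤ.+-identityˡ _) (δ-≡ {i = p x}
      (trans (cong (⊝ 𝟙 ⊕_) xᵏ≡𝟙) (trans (CommutativeRing.+-comm commutativeRing _ _) (⊝-inverseʳ 𝟙))))))
      where
      xᵏ≡𝟙 : x ^ suc k ≡ 𝟙
      xᵏ≡𝟙 = decidable-stable (x ^ suc k ≟ 𝟙) λ xᵏ≢𝟙 → none (x , 𝟘≢x ∘ sym , xᵏ≢𝟙)

-- The quadratic character of a field of odd order.

module QuadraticCharacter {q : ℕ} (𝔽 : FiniteField q) (m : ℕ) (q≡1+2m : q ≡ suc (m ℕ.+ m)) where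
  open Field 𝔽
  open FermatAndRoots 𝔽
  open Solver using (solve; _:=_; _:+_; _:*_; :-_; _:-_)

  private
    instance
      m≢0 : ℕ.NonZero m
      m≢0 = ℕ.≢-nonZero λ m≡0 → no-element (trans q≡1+2m (cong (λ k → suc (k ℕ.+ k)) m≡0)) 𝟙 𝟘 𝟙≢𝟘
        where
        no-element : ∀ {n} → n ≡ 1 → (i j : Fin n) → i ≢ j → ⊥
        no-element refl zero zero i≢j = i≢j refl

  q≡1+2m-ℤ : + q ≡ 1ℤ + (+ m + + m)
  q≡1+2m-ℤ = cong +_ q≡1+2m

  ι-q : ι (+ q) ≡ 𝟘
  ι-q = q·𝟙≡𝟘

  -- If 1 = -1 then q = 1 + 2 m would be 1 in the field.
  𝟙≢⊝𝟙 : 𝟙 ≢ ⊝ 𝟙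
  𝟙≢⊝𝟙 eq = 𝟙≢𝟘 (begin
    𝟙                          ≡⟨ solve 2 (λ u k → u := u :+ k :* (u :- u)) refl 𝟙 (ι (+ m)) ⟩
    𝟙 ⊕ ι (+ m) ⊗ (𝟙 ⊕ ⊝ 𝟙)    ≡⟨ cong (λ u → 𝟙 ⊕ ι (+ m) ⊗ (𝟙 ⊕ u)) eq ⟨
    𝟙 ⊕ ι (+ m) ⊗ (𝟙 ⊕ 𝟙)
      ≡⟨ cong (𝟙 ⊕_) (trans (CommutativeRing.distribˡ commutativeRing _ 𝟙 𝟙) (cong₂ _⊕_ (⊗-identityʳ _) (⊗-identityʳ _))) ⟩
    𝟙 ⊕ (ι (+ m) ⊕ ι (+ m))    ≡⟨ cong₂ _⊕_ ι-1 (×-homo-+ 𝟙 m m) ⟨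
    ι 1ℤ ⊕ ι (+ m + + m)       ≡⟨ ι-+ 1ℤ (+ m + + m) ⟨
    ι (1ℤ + (+ m + + m))       ≡⟨ cong ι q≡1+2m-ℤ ⟨
    ι (+ q)                    ≡⟨ ι-q ⟩
    𝟘                          ∎)
    where open ≡-Reasoning

  x≢⊝x : ∀ {x} → x ≢ 𝟘 → x ≢ ⊝ x
  x≢⊝x {x} x≢𝟘 eq = 𝟙≢⊝𝟙 (⊗-cancelˡ x≢𝟘 (begin
    x ⊗ 𝟙       ≡⟨ ⊗-identityʳ x ⟩
    x           ≡⟨ eq ⟩
    ⊝ x         ≡⟨ cong ⊝_ (⊗-identityʳ x) ⟨
    ⊝ (x ⊗ 𝟙)   ≡⟨ solve 2 (λ x u → :- (x :* u) := x :* :- u) refl x 𝟙 ⟩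
    x ⊗ ⊝ 𝟙     ∎))
    where open ≡-Reasoning

  -- The possible values of the quadratic character.
  data Sign : ℤ → Set where
    s0 : Sign 0ℤ
    s+ : Sign 1ℤ
    s- : Sign (- 1ℤ)

  sign-* : ∀ {i j} → Sign i → Sign j → Sign (i * j)
  sign-* {j = j} s0 t = subst Sign (sym (ℤ.*-zeroˡ j)) s0
  sign-* {j = j} s+ t = subst Sign (sym (ℤ.*-identityˡ j)) t
  sign-* s- s0 = s0
  sign-* s- s+ = s-
  sign-* s- s- = s+

  ι--1 : ι (- 1ℤ) ≡ ⊝ 𝟙
  ι--1 = cong ⊝_ ι-1

  -- The integers 0, 1 and -1 stay distinct in a field of odd order.
  ι-injective-sign : ∀ {i j} → Sign i → Sign j → ι i ≡ ι j → i ≡ j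
  ι-injective-sign s0 s0 eq = refl
  ι-injective-sign s0 s+ eq = contradiction (sym (trans eq ι-1)) 𝟙≢𝟘
  ι-injective-sign s0 s- eq = contradiction (sym (trans eq ι--1)) (⊝-≢𝟘 𝟙≢𝟘)
  ι-injective-sign s+ s0 eq = contradiction (trans (sym ι-1) eq) 𝟙≢𝟘
  ι-injective-sign s+ s+ eq = refl
  ι-injective-sign s+ s- eq = contradiction (trans (sym ι-1) (trans eq ι--1)) 𝟙≢⊝𝟙
  ι-injective-sign s- s0 eq = contradiction (trans (sym ι--1) eq) (⊝-≢𝟘 𝟙≢𝟘)
  ι-injective-sign s- s+ eq = contradiction (trans (sym ι-1) (trans (sym eq) ι--1)) 𝟙≢⊝𝟙
  ι-injective-sign s- s- eq = refl

  -- The quadratic character: the integer among 0, 1, -1 that represents the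
  -- power x^((q-1)/2).
  η : Fin q → ℤ
  η x with x ≟ 𝟘 | x ^ m ≟ 𝟙
  ... | yes _ | _     = 0ℤ
  ... | no _  | yes _ = 1ℤ
  ... | no _  | no _  = - 1ℤ

  η-sign : ∀ x → Sign (η x)
  η-sign x with x ≟ 𝟘 | x ^ m ≟ 𝟙
  ... | yes _ | _     = s0
  ... | no _  | yes _ = s+
  ... | no _  | no _  = s-

  𝟙^n : ∀ n → 𝟙 ^ n ≡ 𝟙
  𝟙^n zero    = refl
  𝟙^n (suc n) = trans (⊗-identityˡ _) (𝟙^n n)

  𝟘^n : ∀ n → .{{ℕ.NonZero n}} → 𝟘 ^ n ≡ 𝟘
  𝟘^n (suc n) = ⊗-zeroˡ _

  ι-η : ∀ x → ι (η x) ≡ x ^ m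
  ι-η x with x ≟ 𝟘 | x ^ m ≟ 𝟙
  ... | yes refl | _        = sym (𝟘^n m)
  ... | no _     | yes xᵐ≡𝟙 = trans ι-1 (sym xᵐ≡𝟙)
  ... | no x≢𝟘   | no  xᵐ≢𝟙 = trans ι--1 (sym ([ (λ xᵐ≡𝟙 → contradiction xᵐ≡𝟙 xᵐ≢𝟙) , id ]′
          (x²≡y²⇒x≡±y (x ^ m) 𝟙 (trans (sym (^-homo-* x m m)) (trans (fermat x≢𝟘 q≡1+2m) (sym (⊗-identityˡ 𝟙)))))))

  -- Multiplicativity and the special values of η follow from this.
  η-unique : ∀ {x v} → Sign v → ι v ≡ x ^ m → η x ≡ v
  η-unique {x} sv eq = ι-injective-sign (η-sign x) sv (trans (ι-η x) (sym eq))

  η-⊗ : ∀ x y → η (x ⊗ y) ≡ η x * η y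
  η-⊗ x y = η-unique (sign-* (η-sign x) (η-sign y)) (begin
    ι (η x * η y)     ≡⟨ ι-* (η x) (η y) ⟩
    ι (η x) ⊗ ι (η y) ≡⟨ cong₂ _⊗_ (ι-η x) (ι-η y) ⟩
    x ^ m ⊗ y ^ m     ≡⟨ ^-distrib-* x y m ⟨
    (x ⊗ y) ^ m       ∎)
    where open ≡-Reasoning

  η-𝟘 : η 𝟘 ≡ 0ℤ
  η-𝟘 = η-unique s0 (sym (𝟘^n m))

  η-𝟙 : η 𝟙 ≡ 1ℤ
  η-𝟙 = η-unique s+ (trans ι-1 (sym (𝟙^n m)))

  η²-≢𝟘 : ∀ {x} → x ≢ 𝟘 → η x * η x ≡ 1ℤ
  η²-≢𝟘 {x} x≢𝟘 with x ≟ 𝟘 | x ^ m ≟ 𝟙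
  ... | yes x≡𝟘 | _     = contradiction x≡𝟘 x≢𝟘
  ... | no _    | yes _ = refl
  ... | no _    | no _  = refl

  η-square : ∀ {x} → x ≢ 𝟘 → η (x ⊗ x) ≡ 1ℤ
  η-square {x} x≢𝟘 = trans (η-⊗ x x) (η²-≢𝟘 x≢𝟘)

  η-⁻¹ : ∀ x → η (x ⁻¹) ≡ η x
  η-⁻¹ x = by-cases (x ≟ 𝟘)
    where
    open ≡-Reasoning
    by-cases : Dec (x ≡ 𝟘) → η (x ⁻¹) ≡ η x
    by-cases (yes refl) = cong η 𝟘⁻¹
    by-cases (no x≢𝟘) = begin
      η (x ⁻¹)                 ≡⟨ ℤ.*-identityˡ _ ⟨
      1ℤ * η (x ⁻¹)            ≡⟨ cong (_* η (x ⁻¹)) (η²-≢𝟘 x≢𝟘) ⟨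
      η x * η x * η (x ⁻¹)     ≡⟨ ℤ.*-assoc (η x) (η x) _ ⟩
      η x * (η x * η (x ⁻¹))   ≡⟨ cong (η x *_) (trans (sym (η-⊗ x (x ⁻¹))) (trans (cong η (⁻¹-inverseʳ x≢𝟘)) η-𝟙)) ⟩
      η x * 1ℤ                 ≡⟨ ℤ.*-identityʳ _ ⟩
      η x                      ∎

  x≡-x⇒x≡0 : ∀ x → x ≡ - x → x ≡ 0ℤ
  x≡-x⇒x≡0 (+ zero) _ = refl

  1+m<q : suc m ℕ.< q
  1+m<q = subst (suc m ℕ.<_) (sym q≡1+2m) (ℕ.s≤s (ℕ.m<m+n m (ℕ.>-nonZero⁻¹ m)))

  nonsquare : ∃ λ g → g ≢ 𝟘 × η g ≡ - 1ℤ
  nonsquare with nontrivial-power (ℕ.pred m) (subst (λ k → suc k ℕ.< q) (sym (ℕ.suc-pred m)) 1+m<q)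
  ... | g , g≢𝟘 , gᵐ≢𝟙 = g , g≢𝟘 , from-cases (η-sign g) refl
    where
    gᵐ≢𝟙′ : g ^ m ≢ 𝟙
    gᵐ≢𝟙′ = gᵐ≢𝟙 ∘ trans (cong (g ^_) (ℕ.suc-pred m))
    from-cases : ∀ {v} → Sign v → v ≡ η g → η g ≡ - 1ℤ
    from-cases s0 eq = contradiction (trans (sym (ι-η g)) (cong ι (sym eq))) (^-≢𝟘 g≢𝟘 m)
    from-cases s+ eq = contradiction (trans (sym (ι-η g)) (trans (cong ι (sym eq)) ι-1)) gᵐ≢𝟙′
    from-cases s- eq = sym eq

  -- Multiplication by a nonsquare changes the sign of the sum.
  sum-η : sum η ≡ 0ℤ
  sum-η with nonsquare
  ... | g , g≢𝟘 , ηg≡-1 = x≡-x⇒x≡0 (sum η) (begin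
    sum η                   ≡⟨ sum-scale g≢𝟘 η ⟨
    sum (λ x → η (g ⊗ x))   ≡⟨ sum-cong (λ x → trans (η-⊗ g x) (trans (cong (_* η x) ηg≡-1) (ℤ.-1*i≡-i (η x)))) ⟩
    sum (λ x → - η x)       ≡⟨ sum-neg η ⟩
    - sum η                 ∎)
    where open ≡-Reasoning

  -- The number of square roots of c.
  #√ : Fin q → ℤ
  #√ c = sum (λ z → δ (z ⊗ z) c)

  -- The solutions of z^2 = u^2 are u and -u.
  δ-square : ∀ {u} → u ≢ 𝟘 → ∀ z → δ (z ⊗ z) (u ⊗ u) ≡ 1ℤ * δ u z + 1ℤ * δ (⊝ u) z
  δ-square {u} u≢𝟘 z with u ≟ z | ⊝ u ≟ z
  ... | yes refl | yes -u≡u = contradiction (sym -u≡u) (x≢⊝x u≢𝟘)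
  ... | yes refl | no _     = δ-refl (z ⊗ z)
  ... | no _     | yes refl = δ-≡ (solve 1 (λ u → :- u :* :- u := u :* u) refl u)
  ... | no u≢z   | no -u≢z  = δ-≢ λ eq → [ u≢z ∘ sym , -u≢z ∘ sym ]′ (x²≡y²⇒x≡±y z u eq)

  sum-δ-square : ∀ {u} → u ≢ 𝟘 → (f : Fin q → ℤ) → sum (λ z → f z * δ (z ⊗ z) (u ⊗ u)) ≡ f u + f (⊝ u)
  sum-δ-square {u} u≢𝟘 f = begin
    sum (λ z → f z * δ (z ⊗ z) (u ⊗ u))
      ≡⟨ sum-cong (λ z → trans (cong (f z *_) (δ-square u≢𝟘 z)) (distrib (f z) _ _)) ⟩
    sum (λ z → f z * δ u z + f z * δ (⊝ u) z)           ≡⟨ ∑-distrib-+ (λ z → f z * δ u z) _ ⟩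
    sum (λ z → f z * δ u z) + sum (λ z → f z * δ (⊝ u) z) ≡⟨ cong₂ _+_ (sum-δ u f) (sum-δ (⊝ u) f) ⟩
    f u + f (⊝ u)                                       ∎
    where
    open ≡-Reasoning
    distrib : ∀ a b c → a * (1ℤ * b + 1ℤ * c) ≡ a * b + a * c
    distrib = solve-∀

  sum-δ-square-𝟘 : (f : Fin q → ℤ) → sum (λ z → f z * δ (z ⊗ z) 𝟘) ≡ f 𝟘
  sum-δ-square-𝟘 f = trans (sum-cong λ z → cong (f z *_) (δ-cong {i = z ⊗ z} {𝟘} {𝟘} {z} (λ zz≡𝟘 → sym ([ id , id ]′ (⊗-integral z zz≡𝟘))) (λ 𝟘≡z → trans (cong (_⊗ z) (sym 𝟘≡z)) (⊗-zeroˡ z)))) (sum-δ 𝟘 f)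

  -- The count is at most 1 + η c for every c, and both sides have the same
  -- sum q over all c.  In particular this proves that η c = 1 forces c to be a
  -- square.
  #√≡1+η : ∀ c → #√ c ≡ 1ℤ + η c
  #√≡1+η = sum-≤-≡ #√ (λ c → 1ℤ + η c) bound (begin
      sum #√                                    ≡⟨ ∑-comm (λ c z → δ (z ⊗ z) c) ⟩
      sum (λ z → sum (λ c → δ (z ⊗ z) c))       ≡⟨ sum-cong (λ z → sum-δ-1 (z ⊗ z)) ⟩
      sum {q} (λ _ → 1ℤ)                        ≡⟨ ℤ.+-identityʳ _ ⟨
      sum {q} (λ _ → 1ℤ) + 0ℤ                   ≡⟨ cong (_+_ (sum {q} (λ _ → 1ℤ))) sum-η ⟨
      sum {q} (λ _ → 1ℤ) + sum η                ≡⟨ ∑-distrib-+ (λ _ → 1ℤ) η ⟨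
      sum (λ c → 1ℤ + η c)                      ∎)
    where
    open ≡-Reasoning
    nonneg : ∀ {v} → Sign v → 0ℤ ≤ 1ℤ + v
    nonneg s0 = ℤ.+≤+ ℕ.z≤n
    nonneg s+ = ℤ.+≤+ ℕ.z≤n
    nonneg s- = ℤ.+≤+ ℕ.z≤n
    bound : ∀ c → #√ c ≤ 1ℤ + η c
    bound c with Fin.any? (λ z → z ⊗ z ≟ c)
    ... | no none = ℤ.≤-trans (ℤ.≤-reflexive (trans (sum-cong λ z → δ-≢ λ eq → none (z , eq)) (sum-0 q))) (nonneg (η-sign c))
    ... | yes (u , refl) = ℤ.≤-reflexive (trans (sym (sum-1* (λ z → δ (z ⊗ z) (u ⊗ u)))) (roots (u ≟ 𝟘)))
      where
      roots : Dec (u ≡ 𝟘) → sum (λ z → 1ℤ * δ (z ⊗ z) (u ⊗ u)) ≡ 1ℤ + η (u ⊗ u)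
      roots (no u≢𝟘)   = trans (sum-δ-square u≢𝟘 (λ _ → 1ℤ)) (cong (_+_ 1ℤ) (sym (η-square u≢𝟘)))
      roots (yes refl) = trans (sum-cong λ z → cong (λ c → 1ℤ * δ (z ⊗ z) c) (⊗-zeroˡ 𝟘))
        (trans (sum-δ-square-𝟘 (λ _ → 1ℤ)) (cong (_+_ 1ℤ) (sym (trans (cong η (⊗-zeroˡ 𝟘)) η-𝟘))))

  √-exists : ∀ {c} → η c ≡ 1ℤ → ∃ λ u → u ⊗ u ≡ c
  √-exists {c} ηc≡1 with Fin.any? (λ z → z ⊗ z ≟ c)
  ... | yes found = found
  ... | no none   = contradiction (trans (sym (trans (sum-cong λ z → δ-≢ λ eq → none (z , eq)) (sum-0 q)))
                      (trans (#√≡1+η c) (cong (_+_ 1ℤ) ηc≡1))) λ ()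

  sum-over-squares : (f : Fin q → ℤ) → sum (λ z → f (z ⊗ z)) ≡ sum (λ c → (1ℤ + η c) * f c)
  sum-over-squares f = begin
    sum (λ z → f (z ⊗ z))                           ≡⟨ sum-cong (λ z → sum-δ (z ⊗ z) f) ⟨
    sum (λ z → sum (λ c → f c * δ (z ⊗ z) c))       ≡⟨ ∑-comm (λ z c → f c * δ (z ⊗ z) c) ⟩
    sum (λ c → sum (λ z → f c * δ (z ⊗ z) c))       ≡⟨ sum-cong (λ c → *-distribˡ-sum (f c) (λ z → δ (z ⊗ z) c)) ⟨
    sum (λ c → f c * #√ c)                          ≡⟨ sum-cong (λ c → trans (cong (f c *_) (#√≡1+η c)) (ℤ.*-comm (f c) _)) ⟩
    sum (λ c → (1ℤ + η c) * f c)                    ∎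
    where open ≡-Reasoning

  -- For nonzero x the factor η(x) η(x + c) is η(1 + c / x), and 1 + c / x runs
  -- over all elements except 1.
  sum-ηη-shift : ∀ {c} → c ≢ 𝟘 → sum (λ x → η x * η (x ⊕ c)) ≡ - 1ℤ
  sum-ηη-shift {c} c≢𝟘 = begin
    sum (λ x → η x * η (x ⊕ c))                              ≡⟨ sum-cong term ⟩
    sum (λ x → η (𝟙 ⊕ c ⊗ x ⁻¹) - 1ℤ * δ 𝟘 x)                 ≡⟨ sum-minus (λ x → η (𝟙 ⊕ c ⊗ x ⁻¹)) _ ⟩
    sum (λ x → η (𝟙 ⊕ c ⊗ x ⁻¹)) - sum (λ x → 1ℤ * δ 𝟘 x)     ≡⟨ cong₂ _-_ all (sum-δ 𝟘 (λ _ → 1ℤ)) ⟩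
    0ℤ - 1ℤ                                                  ∎
    where
    open ≡-Reasoning
    all : sum (λ x → η (𝟙 ⊕ c ⊗ x ⁻¹)) ≡ 0ℤ
    all = begin
      sum (λ x → η (𝟙 ⊕ c ⊗ x ⁻¹))  ≡⟨ sum-⁻¹ (λ x → η (𝟙 ⊕ c ⊗ x)) ⟩
      sum (λ x → η (𝟙 ⊕ c ⊗ x))     ≡⟨ sum-scale c≢𝟘 (λ x → η (𝟙 ⊕ x)) ⟩
      sum (λ x → η (𝟙 ⊕ x))         ≡⟨ sum-cong (λ x → cong η (CommutativeRing.+-comm commutativeRing 𝟙 x)) ⟩
      sum (λ x → η (x ⊕ 𝟙))         ≡⟨ sum-translate 𝟙 η ⟩
      sum η                         ≡⟨ sum-η ⟩
      0ℤ                            ∎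
    term : ∀ x → η x * η (x ⊕ c) ≡ η (𝟙 ⊕ c ⊗ x ⁻¹) - 1ℤ * δ 𝟘 x
    term x = by-cases (𝟘 ≟ x)
      where
      by-cases : (d : Dec (𝟘 ≡ x)) → η x * η (x ⊕ c) ≡ η (𝟙 ⊕ c ⊗ x ⁻¹) - 1ℤ * ind d
      by-cases (yes refl) = begin
        η 𝟘 * η (𝟘 ⊕ c)             ≡⟨ trans (cong (_* η (𝟘 ⊕ c)) η-𝟘) (ℤ.*-zeroˡ (η (𝟘 ⊕ c))) ⟩
        1ℤ - 1ℤ                     ≡⟨ cong (_- 1ℤ) η-𝟙 ⟨
        η 𝟙 - 1ℤ
          ≡⟨ cong (λ u → η u - 1ℤ) (trans (cong (𝟙 ⊕_) (trans (cong (c ⊗_) 𝟘⁻¹) (⊗-zeroʳ c))) (⊕-identityʳ 𝟙)) ⟨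
        η (𝟙 ⊕ c ⊗ 𝟘 ⁻¹) - 1ℤ * 1ℤ  ∎
      by-cases (no 𝟘≢x) = begin
        η x * η (x ⊕ c)                     ≡⟨ cong (λ u → η x * η u) factor ⟨
        η x * η (x ⊗ (𝟙 ⊕ c ⊗ x ⁻¹))        ≡⟨ cong (η x *_) (η-⊗ x _) ⟩
        η x * (η x * η (𝟙 ⊕ c ⊗ x ⁻¹))      ≡⟨ ℤ.*-assoc (η x) (η x) _ ⟨
        η x * η x * η (𝟙 ⊕ c ⊗ x ⁻¹)        ≡⟨ cong (_* η (𝟙 ⊕ c ⊗ x ⁻¹)) (η²-≢𝟘 (𝟘≢x ∘ sym)) ⟩
        1ℤ * η (𝟙 ⊕ c ⊗ x ⁻¹)               ≡⟨ simplify (η (𝟙 ⊕ c ⊗ x ⁻¹)) ⟩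
        η (𝟙 ⊕ c ⊗ x ⁻¹) - 1ℤ * 0ℤ          ∎
        where
        simplify : ∀ v → 1ℤ * v ≡ v - 1ℤ * 0ℤ
        simplify = solve-∀
        factor : x ⊗ (𝟙 ⊕ c ⊗ x ⁻¹) ≡ x ⊕ c
        factor = begin
          x ⊗ (𝟙 ⊕ c ⊗ x ⁻¹)     ≡⟨ solve 4 (λ x u c y → x :* (u :+ c :* y) := x :* u :+ c :* (x :* y)) refl x 𝟙 c (x ⁻¹) ⟩
          x ⊗ 𝟙 ⊕ c ⊗ (x ⊗ x ⁻¹) ≡⟨ cong₂ _⊕_ (⊗-identityʳ x) (trans (cong (c ⊗_) (⁻¹-inverseʳ (𝟘≢x ∘ sym))) (⊗-identityʳ c)) ⟩
          x ⊕ c                  ∎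

-- Jacobsthal sums.

-- The numbers h = (q - 1)/4 and m = (q - 1)/2 for q = order e = 5 + 8 e.
quarter half order : ℕ → ℕ
quarter e = suc (e ℕ.+ e)
half    e = quarter e ℕ.+ quarter e
order   e = suc (half e ℕ.+ half e)

module JacobsthalSums {q : ℕ} (𝔽 : FiniteField q) (e : ℕ) (q≡1+4h : q ≡ order e) where

  h m : ℕ
  h = quarter e
  m = half e

  open Field 𝔽
  open QuadraticCharacter 𝔽 m q≡1+4h
  open Solver using (solve; _:=_; _:+_; _:*_; :-_; _:-_)

  ⊕-comm : ∀ x y → x ⊕ y ≡ y ⊕ x
  ⊕-comm = CommutativeRing.+-comm commutativeRing

  ⊝𝟙-^-double : ∀ n → (⊝ 𝟙) ^ (n ℕ.+ n) ≡ 𝟙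
  ⊝𝟙-^-double n = begin
    (⊝ 𝟙) ^ (n ℕ.+ n)       ≡⟨ ^-homo-* (⊝ 𝟙) n n ⟩
    (⊝ 𝟙) ^ n ⊗ (⊝ 𝟙) ^ n   ≡⟨ ^-distrib-* (⊝ 𝟙) (⊝ 𝟙) n ⟨
    (⊝ 𝟙 ⊗ ⊝ 𝟙) ^ n         ≡⟨ cong (_^ n) (trans (solve 1 (λ u → :- u :* :- u := u :* u) refl 𝟙) (⊗-identityˡ 𝟙)) ⟩
    𝟙 ^ n                   ≡⟨ 𝟙^n n ⟩
    𝟙                       ∎
    where open ≡-Reasoning

  η-⊝𝟙 : η (⊝ 𝟙) ≡ 1ℤ
  η-⊝𝟙 = η-unique s+ (trans ι-1 (sym (⊝𝟙-^-double h)))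

  η-⊝ : ∀ x → η (⊝ x) ≡ η x
  η-⊝ x = begin
    η (⊝ x)         ≡⟨ cong η (trans (cong ⊝_ (sym (⊗-identityˡ x))) (⊝-distribˡ 𝟙 x)) ⟩
    η (⊝ 𝟙 ⊗ x)     ≡⟨ η-⊗ (⊝ 𝟙) x ⟩
    η (⊝ 𝟙) * η x   ≡⟨ cong (_* η x) η-⊝𝟙 ⟩
    1ℤ * η x        ≡⟨ ℤ.*-identityˡ _ ⟩
    η x             ∎
    where open ≡-Reasoning

  -- Since (q - 1) / 4 is odd, a square root of -1 is not itself a square.
  η-√-1 : ∀ {i} → i ⊗ i ≡ ⊝ 𝟙 → η i ≡ - 1ℤ
  η-√-1 {i} i²≡-1 = η-unique s- (begin
    ι (- 1ℤ)                    ≡⟨ ι--1 ⟩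
    ⊝ 𝟙                         ≡⟨ ⊗-identityʳ _ ⟨
    ⊝ 𝟙 ⊗ 𝟙                     ≡⟨ cong (⊝ 𝟙 ⊗_) (⊝𝟙-^-double e) ⟨
    (⊝ 𝟙) ^ h                   ≡⟨ cong (_^ h) i²≡-1 ⟨
    (i ⊗ i) ^ h                 ≡⟨ ^-distrib-* i i h ⟩
    i ^ h ⊗ i ^ h               ≡⟨ ^-homo-* i h h ⟨
    i ^ m                       ∎)
    where open ≡-Reasoning

  -- The Jacobsthal sum: the sum of η(t (t^2 + d)).
  φ : Fin q → ℤ
  φ d = sum (λ t → η t * η (t ⊗ t ⊕ d))

  φ-scale : ∀ {k} → k ≢ 𝟘 → ∀ d → φ (k ⊗ k ⊗ d) ≡ η k * φ d
  φ-scale {k} k≢𝟘 d = begin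
    φ (k ⊗ k ⊗ d)                                               ≡⟨ sum-scale k≢𝟘 (λ t → η t * η (t ⊗ t ⊕ k ⊗ k ⊗ d)) ⟨
    sum (λ t → η (k ⊗ t) * η ((k ⊗ t) ⊗ (k ⊗ t) ⊕ k ⊗ k ⊗ d))   ≡⟨ sum-cong term ⟩
    sum (λ t → η k * (η t * η (t ⊗ t ⊕ d)))                     ≡⟨ *-distribˡ-sum (η k) (λ t → η t * η (t ⊗ t ⊕ d)) ⟨
    η k * φ d                                                   ∎
    where
    open ≡-Reasoning
    regroup : ∀ a b c → a * b * (1ℤ * c) ≡ a * (b * c)
    regroup = solve-∀
    term : ∀ t → η (k ⊗ t) * η ((k ⊗ t) ⊗ (k ⊗ t) ⊕ k ⊗ k ⊗ d) ≡ η k * (η t * η (t ⊗ t ⊕ d))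
    term t = begin
      η (k ⊗ t) * η ((k ⊗ t) ⊗ (k ⊗ t) ⊕ k ⊗ k ⊗ d)   ≡⟨ cong₂ _*_ (η-⊗ k t) (cong η
        (solve 3 (λ k t d → (k :* t) :* (k :* t) :+ k :* k :* d := (k :* k) :* (t :* t :+ d)) refl k t d)) ⟩
      η k * η t * η ((k ⊗ k) ⊗ (t ⊗ t ⊕ d))
        ≡⟨ cong (η k * η t *_) (trans (η-⊗ (k ⊗ k) _) (cong (_* η (t ⊗ t ⊕ d)) (η-square k≢𝟘))) ⟩
      η k * η t * (1ℤ * η (t ⊗ t ⊕ d))                ≡⟨ regroup (η k) (η t) _ ⟩
      η k * (η t * η (t ⊗ t ⊕ d))                     ∎

  φ-𝟘 : φ 𝟘 ≡ 0ℤ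
  φ-𝟘 = trans (sum-cong λ t → by-cases t (t ≟ 𝟘)) sum-η
    where
    open ≡-Reasoning
    by-cases : ∀ t → Dec (t ≡ 𝟘) → η t * η (t ⊗ t ⊕ 𝟘) ≡ η t
    by-cases t (yes refl) = trans (cong (_* η (𝟘 ⊗ 𝟘 ⊕ 𝟘)) η-𝟘) (trans (ℤ.*-zeroˡ (η (𝟘 ⊗ 𝟘 ⊕ 𝟘))) (sym η-𝟘))
    by-cases t (no t≢𝟘)   = trans (cong (η t *_) (trans (cong η (⊕-identityʳ (t ⊗ t))) (η-square t≢𝟘))) (ℤ.*-identityʳ (η t))

  -- φ(-1) = η(i) φ(1) for a square root i of -1.
  φ-𝟙 : φ 𝟙 ≡ - φ (⊝ 𝟙)
  φ-𝟙 with √-exists η-⊝𝟙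
  ... | i , i²≡-1 = begin
    φ 𝟙              ≡⟨ ℤ.neg-involutive (φ 𝟙) ⟨
    - - φ 𝟙          ≡⟨ cong -_ (ℤ.-1*i≡-i (φ 𝟙)) ⟨
    - (- 1ℤ * φ 𝟙)   ≡⟨ cong (λ v → - (v * φ 𝟙)) (η-√-1 i²≡-1) ⟨
    - (η i * φ 𝟙)    ≡⟨ cong -_ (φ-scale i≢𝟘 𝟙) ⟨
    - φ (i ⊗ i ⊗ 𝟙)  ≡⟨ cong (λ v → - φ v) (trans (⊗-identityʳ _) i²≡-1) ⟩
    - φ (⊝ 𝟙)        ∎
    where
    open ≡-Reasoning
    i≢𝟘 : i ≢ 𝟘
    i≢𝟘 refl = ⊝-≢𝟘 𝟙≢𝟘 (trans (sym i²≡-1) (⊗-zeroˡ 𝟘))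

  sum-ηη : sum (λ x → η x * η x) ≡ + q - 1ℤ
  sum-ηη = begin
    sum (λ x → η x * η x)             ≡⟨ sum-cong (λ x → by-cases x (𝟘 ≟ x)) ⟩
    sum (λ x → 1ℤ - δ 𝟘 x)            ≡⟨ sum-minus {q} (λ _ → 1ℤ) (δ 𝟘) ⟩
    sum {q} (λ _ → 1ℤ) - sum (δ 𝟘)    ≡⟨ cong₂ _-_ (trans (sum-const q 1ℤ) (ℤ.*-identityʳ (+ q))) (sum-δ-1 𝟘) ⟩
    + q - 1ℤ                          ∎
    where
    open ≡-Reasoning
    by-cases : ∀ x (d : Dec (𝟘 ≡ x)) → η x * η x ≡ 1ℤ - ind d
    by-cases x (yes refl) = cong₂ _*_ η-𝟘 η-𝟘
    by-cases x (no 𝟘≢x)   = η²-≢𝟘 (𝟘≢x ∘ sym)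

  η-correlation : ∀ a b → sum (λ d → η (a ⊕ d) * η (b ⊕ d)) ≡ + q * δ a b - 1ℤ
  η-correlation a b = begin
    sum (λ d → η (a ⊕ d) * η (b ⊕ d))              ≡⟨ sum-cong (λ d → cong₂ (λ u v → η u * η v) (⊕-comm a d)
                                                       (solve 3 (λ a b d → b :+ d := (d :+ a) :+ (b :- a)) refl a b d)) ⟩
    sum (λ d → η (d ⊕ a) * η ((d ⊕ a) ⊕ (b ⊕ ⊝ a))) ≡⟨ sum-translate a (λ x → η x * η (x ⊕ (b ⊕ ⊝ a))) ⟩
    sum (λ x → η x * η (x ⊕ (b ⊕ ⊝ a)))            ≡⟨ by-cases (a ≟ b) ⟩
    + q * δ a b - 1ℤ                               ∎
    where
    open ≡-Reasoning
    by-cases : (d : Dec (a ≡ b)) → sum (λ x → η x * η (x ⊕ (b ⊕ ⊝ a))) ≡ + q * ind d - 1ℤ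
    by-cases (yes refl) = trans (sum-cong λ x → cong (λ u → η x * η u) (solve 2 (λ x a → x :+ (a :- a) := x) refl x a))
                                (trans sum-ηη (cong (_- 1ℤ) (sym (ℤ.*-identityʳ (+ q)))))
    by-cases (no a≢b)   = trans (sum-ηη-shift (a≢b ∘ sym ∘ x⊝y≡𝟘⇒x≡y)) (cong (_- 1ℤ) (sym (ℤ.*-zeroʳ (+ q))))

  sum-*-sum : ∀ {k l} (f : Fin k → ℤ) (g : Fin l → ℤ) → sum f * sum g ≡ sum (λ i → sum (λ j → f i * g j))
  sum-*-sum f g = trans (*-distribʳ-sum (sum g) f) (sum-cong λ i → *-distribˡ-sum (f i) g)

  -- Summing over d first leaves, by η-correlation, the pairs with s^2 = t^2.
  φ-second-moment : sum (λ d → φ d * φ d) ≡ + 2 * (+ q * (+ q - 1ℤ))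
  φ-second-moment = begin
    sum (λ d → φ d * φ d)                                       ≡⟨ sum-cong (λ d → sum-*-sum (T d) (T d)) ⟩
    sum (λ d → sum (λ s → sum (λ t → T d s * T d t)))           ≡⟨ ∑-comm (λ d s → sum (λ t → T d s * T d t)) ⟩
    sum (λ s → sum (λ d → sum (λ t → T d s * T d t)))           ≡⟨ sum-cong (λ s → ∑-comm (λ d t → T d s * T d t)) ⟩
    sum (λ s → sum (λ t → sum (λ d → T d s * T d t)))           ≡⟨ sum-cong (λ s → sum-cong (correlate s)) ⟩
    sum (λ s → sum (λ t → + q * η s * (η t * δ (t ⊗ t) (s ⊗ s)) - η s * η t))
      ≡⟨ sum-cong (λ s → trans (sum-minus (λ t → + q * η s * (η t * δ (t ⊗ t) (s ⊗ s))) (λ t → η s * η t))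
                                                                     (cong₂ _-_ (sym (*-distribˡ-sum (+ q * η s) (λ t → η t * δ (t ⊗ t) (s ⊗ s)))) (sym (*-distribˡ-sum (η s) η)))) ⟩
    sum (λ s → + q * η s * sum (λ t → η t * δ (t ⊗ t) (s ⊗ s)) - η s * sum η) ≡⟨ sum-cong (λ s → diagonal s (s ≟ 𝟘)) ⟩
    sum (λ s → + 2 * + q * (η s * η s))                         ≡⟨ *-distribˡ-sum (+ 2 * + q) (λ s → η s * η s) ⟨
    + 2 * + q * sum (λ s → η s * η s)                           ≡⟨ cong (+ 2 * + q *_) sum-ηη ⟩
    + 2 * + q * (+ q - 1ℤ)                                      ≡⟨ ℤ.*-assoc (+ 2) (+ q) _ ⟩
    + 2 * (+ q * (+ q - 1ℤ))                                    ∎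
    where
    open ≡-Reasoning
    T : Fin q → Fin q → ℤ
    T d t = η t * η (t ⊗ t ⊕ d)

    interchange : ∀ a b c d → a * b * (c * d) ≡ a * c * (b * d)
    interchange = solve-∀
    expand : ∀ Q a b d → a * b * (Q * d - 1ℤ) ≡ Q * a * (b * d) - a * b
    expand = solve-∀
    correlate : ∀ s t → sum (λ d → T d s * T d t) ≡ + q * η s * (η t * δ (t ⊗ t) (s ⊗ s)) - η s * η t
    correlate s t = begin
      sum (λ d → T d s * T d t)
        ≡⟨ sum-cong (λ d → interchange (η s) (η (s ⊗ s ⊕ d)) (η t) (η (t ⊗ t ⊕ d))) ⟩
      sum (λ d → η s * η t * (η (s ⊗ s ⊕ d) * η (t ⊗ t ⊕ d)))
        ≡⟨ *-distribˡ-sum (η s * η t) (λ d → η (s ⊗ s ⊕ d) * η (t ⊗ t ⊕ d)) ⟨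
      η s * η t * sum (λ d → η (s ⊗ s ⊕ d) * η (t ⊗ t ⊕ d))
        ≡⟨ cong (η s * η t *_) (η-correlation (s ⊗ s) (t ⊗ t)) ⟩
      η s * η t * (+ q * δ (s ⊗ s) (t ⊗ t) - 1ℤ)
        ≡⟨ cong (λ v → η s * η t * (+ q * v - 1ℤ)) (δ-sym (s ⊗ s) (t ⊗ t)) ⟩
      η s * η t * (+ q * δ (t ⊗ t) (s ⊗ s) - 1ℤ)                            ≡⟨ expand (+ q) (η s) (η t) _ ⟩
      + q * η s * (η t * δ (t ⊗ t) (s ⊗ s)) - η s * η t                     ∎

    double : ∀ Q a → Q * a * (a + a) - a * 0ℤ ≡ + 2 * Q * (a * a)
    double = solve-∀
    vanish : ∀ Q a b → Q * 0ℤ * a - 0ℤ * b ≡ + 2 * Q * (0ℤ * 0ℤ)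
    vanish = solve-∀
    diagonal : ∀ s → Dec (s ≡ 𝟘) → + q * η s * sum (λ t → η t * δ (t ⊗ t) (s ⊗ s)) - η s * sum η ≡ + 2 * + q * (η s * η s)
    diagonal s (no s≢𝟘) = begin
      + q * η s * sum (λ t → η t * δ (t ⊗ t) (s ⊗ s)) - η s * sum η   ≡⟨ cong₂ (λ u v → + q * η s * u - η s * v)
        (trans (sum-δ-square s≢𝟘 η) (cong (_+_ (η s)) (η-⊝ s))) sum-η ⟩
      + q * η s * (η s + η s) - η s * 0ℤ                              ≡⟨ double (+ q) (η s) ⟩
      + 2 * + q * (η s * η s)                                         ∎
    diagonal s (yes refl) = subst (λ v → + q * v * A - v * sum η ≡ + 2 * + q * (v * v)) (sym η-𝟘) (vanish (+ q) A (sum η))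
      where
      A : ℤ
      A = sum (λ t → η t * δ (t ⊗ t) (𝟘 ⊗ 𝟘))

  -- On nonzero squares φ^2 is φ(1)^2, on nonsquares it is φ(g)^2, and φ(0) = 0,
  -- so the second moment is (q - 1)/2 * (φ(1)^2 + φ(g)^2).
  jacobsthal : ∃ λ g → φ (⊝ 𝟙) * φ (⊝ 𝟙) + φ g * φ g ≡ + 4 * + q
  jacobsthal with nonsquare
  ... | g , g≢𝟘 , ηg≡-1 = g , ℤ.*-cancelʳ-≡ _ _ (+ (m ℕ.+ m)) (begin
      (φ (⊝ 𝟙) * φ (⊝ 𝟙) + φ g * φ g) * + (m ℕ.+ m)   ≡⟨ cong₂ (λ u v → (u + φ g * φ g) * v) (sym φ1²≡φ-1²) 2m≡q-1 ⟩
      (A + B) * (+ q - 1ℤ)                            ≡⟨ total ⟨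
      sum (λ d → + 2 * (φ d * φ d))                   ≡⟨ *-distribˡ-sum (+ 2) (λ d → φ d * φ d) ⟨
      + 2 * sum (λ d → φ d * φ d)                     ≡⟨ cong (+ 2 *_) φ-second-moment ⟩
      + 2 * (+ 2 * (+ q * (+ q - 1ℤ)))                ≡⟨ regroup (+ q) _ ⟩
      + 4 * + q * (+ q - 1ℤ)                          ≡⟨ cong (+ 4 * + q *_) 2m≡q-1 ⟨
      + 4 * + q * + (m ℕ.+ m)                         ∎)
    where
    open ≡-Reasoning
    A B : ℤ
    A = φ 𝟙 * φ 𝟙
    B = φ g * φ g
    φ1²≡φ-1² : A ≡ φ (⊝ 𝟙) * φ (⊝ 𝟙)
    φ1²≡φ-1² = trans (cong₂ _*_ φ-𝟙 φ-𝟙) (neg*neg (φ (⊝ 𝟙)))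
      where
      neg*neg : ∀ a → - a * - a ≡ a * a
      neg*neg = solve-∀
    2m≡q-1 : + (m ℕ.+ m) ≡ + q - 1ℤ
    2m≡q-1 = trans (shift (+ (m ℕ.+ m))) (cong (_- 1ℤ) (cong +_ (sym q≡1+4h)))
      where
      shift : ∀ a → a ≡ (1ℤ + a) - 1ℤ
      shift = solve-∀
    regroup : ∀ Q r → + 2 * (+ 2 * (Q * r)) ≡ + 4 * Q * r
    regroup = solve-∀

    scaled : ∀ {k} → k ≢ 𝟘 → ∀ d → φ (k ⊗ k ⊗ d) * φ (k ⊗ k ⊗ d) ≡ φ d * φ d
    scaled {k} k≢𝟘 d = begin
      φ (k ⊗ k ⊗ d) * φ (k ⊗ k ⊗ d)  ≡⟨ cong₂ _*_ (φ-scale k≢𝟘 d) (φ-scale k≢𝟘 d) ⟩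
      η k * φ d * (η k * φ d)        ≡⟨ square (η k) (φ d) ⟩
      η k * η k * (φ d * φ d)        ≡⟨ cong (_* (φ d * φ d)) (η²-≢𝟘 k≢𝟘) ⟩
      1ℤ * (φ d * φ d)               ≡⟨ ℤ.*-identityˡ _ ⟩
      φ d * φ d                      ∎
      where
      square : ∀ a b → a * b * (a * b) ≡ a * a * (b * b)
      square = solve-∀

    root≢𝟘 : ∀ {k c} → k ⊗ k ≡ c → c ≢ 𝟘 → k ≢ 𝟘
    root≢𝟘 k²≡c c≢𝟘 refl = c≢𝟘 (trans (sym k²≡c) (⊗-zeroˡ 𝟘))

    residue : ∀ {d} → d ≢ 𝟘 → η d ≡ 1ℤ → φ d * φ d ≡ A
    residue {d} d≢𝟘 ηd with √-exists ηd
    ... | k , k²≡d = trans (cong (λ c → φ c * φ c) (sym (trans (⊗-identityʳ _) k²≡d))) (scaled (root≢𝟘 k²≡d d≢𝟘) 𝟙)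

    nonresidue : ∀ {d} → d ≢ 𝟘 → η d ≡ - 1ℤ → φ d * φ d ≡ B
    nonresidue {d} d≢𝟘 ηd with √-exists {d ⊗ g ⁻¹} (trans (η-⊗ d (g ⁻¹)) (cong₂ _*_ ηd (trans (η-⁻¹ g) ηg≡-1)))
    ... | k , k²≡d/g = trans (cong (λ c → φ c * φ c) (sym k²g≡d)) (scaled (root≢𝟘 k²≡d/g (⊗-≢𝟘 d≢𝟘 (⁻¹-≢𝟘 g≢𝟘))) g)
      where
      k²g≡d : k ⊗ k ⊗ g ≡ d
      k²g≡d = trans (cong (_⊗ g) k²≡d/g) (trans (⊗-assoc d _ g) (trans (cong (d ⊗_) (⁻¹-inverseˡ g≢𝟘)) (⊗-identityʳ d)))

    pointwise : ∀ d (z : Dec (𝟘 ≡ d)) → + 2 * (φ d * φ d) ≡ (A + B + (A - B) * η d) - (A + B) * ind z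
    pointwise d (yes refl) = trans (cong (λ v → + 2 * (v * v)) φ-𝟘) (subst (λ v → + 2 * (0ℤ * 0ℤ) ≡ (A + B + (A - B) * v) - (A + B) * 1ℤ) (sym η-𝟘) (at-0 A B))
      where
      at-0 : ∀ a b → + 2 * (0ℤ * 0ℤ) ≡ (a + b + (a - b) * 0ℤ) - (a + b) * 1ℤ
      at-0 = solve-∀
    pointwise d (no 𝟘≢d) = by-sign (η-sign d) refl
      where
      at+ : ∀ a b → + 2 * a ≡ (a + b + (a - b) * 1ℤ) - (a + b) * 0ℤ
      at+ = solve-∀
      at- : ∀ a b → + 2 * b ≡ (a + b + (a - b) * - 1ℤ) - (a + b) * 0ℤ
      at- = solve-∀
      by-sign : ∀ {v} → Sign v → v ≡ η d → + 2 * (φ d * φ d) ≡ (A + B + (A - B) * η d) - (A + B) * 0ℤ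
      by-sign s0 eq = contradiction (trans (sym (η²-≢𝟘 (𝟘≢d ∘ sym))) (cong (λ v → v * v) (sym eq))) λ ()
      by-sign s+ eq = trans (cong (+ 2 *_) (residue (𝟘≢d ∘ sym) (sym eq))) (trans (at+ A B) (cong (λ v → (A + B + (A - B) * v) - (A + B) * 0ℤ) eq))
      by-sign s- eq = trans (cong (+ 2 *_) (nonresidue (𝟘≢d ∘ sym) (sym eq))) (trans (at- A B) (cong (λ v → (A + B + (A - B) * v) - (A + B) * 0ℤ) eq))

    total : sum (λ d → + 2 * (φ d * φ d)) ≡ (A + B) * (+ q - 1ℤ)
    total = begin
      sum (λ d → + 2 * (φ d * φ d))                                                 ≡⟨ sum-cong (λ d → pointwise d (𝟘 ≟ d)) ⟩
      sum (λ d → (A + B + (A - B) * η d) - (A + B) * δ 𝟘 d)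
        ≡⟨ sum-minus (λ d → A + B + (A - B) * η d) (λ d → (A + B) * δ 𝟘 d) ⟩
      sum (λ d → A + B + (A - B) * η d) - sum (λ d → (A + B) * δ 𝟘 d)               ≡⟨ cong₂ _-_
        (trans (∑-distrib-+ {q} (λ _ → A + B) (λ d → (A - B) * η d)) (cong₂ _+_ (sum-const q (A + B)) (sym (*-distribˡ-sum (A - B) η))))
        (sum-δ 𝟘 (λ _ → A + B)) ⟩
      (+ q * (A + B) + (A - B) * sum η) - (A + B)
        ≡⟨ cong (λ v → (+ q * (A + B) + (A - B) * v) - (A + B)) sum-η ⟩
      (+ q * (A + B) + (A - B) * 0ℤ) - (A + B)                                      ≡⟨ collect (+ q) A B ⟩
      (A + B) * (+ q - 1ℤ)                                                          ∎
      where
      collect : ∀ Q a b → (Q * (a + b) + (a - b) * 0ℤ) - (a + b) ≡ (a + b) * (Q - 1ℤ)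
      collect = solve-∀

-- Consecutive fourth powers.

module FourthPowers {q : ℕ} (𝔽 : FiniteField q) (e : ℕ) (q≡1+4h : q ≡ order e) where

  open JacobsthalSums 𝔽 e q≡1+4h
  open Field 𝔽
  open QuadraticCharacter 𝔽 m q≡1+4h
  open Solver using (solve; _:=_; _:+_; _:*_; :-_; _:-_; _:^_)

  Fourth : Fin q → Set
  Fourth = IsNonzeroPower commutativeRing 4

  fourth? : ∀ s → Dec (Fourth s)
  fourth? s = ¬? (s ≟ 𝟘) ×-dec Fin.any? (λ w → s ≟ w ^ 4)

  -- The indicator of the nonzero fourth powers.
  ψ : Fin q → ℤ
  ψ s = ind (fourth? s)

  fourth-⊗ : ∀ {s t} → Fourth s → Fourth t → Fourth (s ⊗ t)
  fourth-⊗ (s≢𝟘 , v , s≡v⁴) (t≢𝟘 , w , t≡w⁴) =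
    ⊗-≢𝟘 s≢𝟘 t≢𝟘 , v ⊗ w , trans (cong₂ _⊗_ s≡v⁴ t≡w⁴) (sym (^-distrib-* v w 4))

  fourth-root≢𝟘 : ∀ {s w} → s ≢ 𝟘 → s ≡ w ^ 4 → w ≢ 𝟘
  fourth-root≢𝟘 s≢𝟘 s≡w⁴ refl = s≢𝟘 (trans s≡w⁴ (𝟘^n 4))

  fourth-⁻¹ : ∀ {s} → Fourth s → Fourth (s ⁻¹)
  fourth-⁻¹ {s} (s≢𝟘 , w , s≡w⁴) = ⁻¹-≢𝟘 s≢𝟘 , w ⁻¹ , ⊗-cancelˡ s≢𝟘 (begin
    s ⊗ s ⁻¹               ≡⟨ ⁻¹-inverseʳ s≢𝟘 ⟩
    𝟙                      ≡⟨ 𝟙^n 4 ⟨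
    𝟙 ^ 4                  ≡⟨ cong (_^ 4) (⁻¹-inverseʳ (fourth-root≢𝟘 s≢𝟘 s≡w⁴)) ⟨
    (w ⊗ w ⁻¹) ^ 4         ≡⟨ ^-distrib-* w (w ⁻¹) 4 ⟩
    w ^ 4 ⊗ w ⁻¹ ^ 4       ≡⟨ cong (_⊗ w ⁻¹ ^ 4) s≡w⁴ ⟨
    s ⊗ w ⁻¹ ^ 4           ∎)
    where open ≡-Reasoning

  ψ-scale : ∀ {u} → Fourth u → ∀ s → ψ (u ⊗ s) ≡ ψ s
  ψ-scale {u} fu s = ind-cong (fourth? (u ⊗ s)) (fourth? s)
    (λ fus → subst Fourth (cancel-⁻¹′ s (proj₁ fu)) (fourth-⊗ (fourth-⁻¹ fu) fus)) (fourth-⊗ fu)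

  ψ-𝟙 : ψ 𝟙 ≡ 1ℤ
  ψ-𝟙 = ind-yes (fourth? 𝟙) (𝟙≢𝟘 , 𝟙 , sym (𝟙^n 4))

  w⁴≡w²w² : ∀ w → w ^ 4 ≡ (w ⊗ w) ⊗ (w ⊗ w)
  w⁴≡w²w² = solve 1 (λ w → w :^ 4 := (w :* w) :* (w :* w)) refl

  -- -1 is not a fourth power, as its square roots are not squares.
  ψ-⊝𝟙 : ψ (⊝ 𝟙) ≡ 0ℤ
  ψ-⊝𝟙 = ind-no (fourth? (⊝ 𝟙)) λ (_ , w , -1≡w⁴) →
    let w²w²≡-1 = sym (trans -1≡w⁴ (w⁴≡w²w² w))
        w≢𝟘     = fourth-root≢𝟘 (⊝-≢𝟘 𝟙≢𝟘) -1≡w⁴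
    in contradiction (trans (sym (η-square w≢𝟘)) (η-√-1 w²w²≡-1)) λ ()

  -- The number of fourth roots of s.
  #⁴√ : Fin q → ℤ
  #⁴√ s = sum (λ a → δ ((a ⊗ a) ⊗ (a ⊗ a)) s)

  -- A fourth root of s is a square root of a square root z of s, and z has
  -- 1 + η z square roots.
  #⁴√-squares : ∀ s → #⁴√ s ≡ sum (λ z → (1ℤ + η z) * δ (z ⊗ z) s)
  #⁴√-squares s = sum-over-squares (λ z → δ (z ⊗ z) s)

  -- A nonzero fourth power u² with u = w² has the square roots u and -u, both
  -- of which are squares.
  #⁴√≡4ψ+δ : ∀ s → #⁴√ s ≡ + 4 * ψ s + δ 𝟘 s
  #⁴√≡4ψ+δ s = by-cases (fourth? s) (𝟘 ≟ s)
    where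
    open ≡-Reasoning
    by-cases : (f : Dec (Fourth s)) (z : Dec (𝟘 ≡ s)) → #⁴√ s ≡ + 4 * ind f + ind z
    by-cases (yes (s≢𝟘 , _)) (yes 𝟘≡s) = contradiction (sym 𝟘≡s) s≢𝟘
    by-cases (yes (s≢𝟘 , w , s≡w⁴)) (no _) = begin
      #⁴√ s                                               ≡⟨ cong #⁴√ (trans s≡w⁴ (w⁴≡w²w² w)) ⟩
      #⁴√ (u ⊗ u)                                         ≡⟨ #⁴√-squares (u ⊗ u) ⟩
      sum (λ z → (1ℤ + η z) * δ (z ⊗ z) (u ⊗ u))          ≡⟨ sum-δ-square (⊗-≢𝟘 w≢𝟘 w≢𝟘) (λ z → 1ℤ + η z) ⟩
      (1ℤ + η u) + (1ℤ + η (⊝ u))                         ≡⟨ cong₂ (λ a b → (1ℤ + a) + (1ℤ + b)) ηu (trans (η-⊝ u) ηu) ⟩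
      + 4                                                 ∎
      where
      u : Fin q
      u = w ⊗ w
      w≢𝟘 : w ≢ 𝟘
      w≢𝟘 = fourth-root≢𝟘 s≢𝟘 s≡w⁴
      ηu : η u ≡ 1ℤ
      ηu = η-square w≢𝟘
    by-cases (no _) (yes refl) = trans (#⁴√-squares 𝟘) (trans (sum-δ-square-𝟘 (λ z → 1ℤ + η z)) (cong (_+_ 1ℤ) η-𝟘))
    by-cases (no ¬f) (no 𝟘≢s) = trans (sum-cong λ a → δ-≢ λ a⁴≡s → ¬f (𝟘≢s ∘ sym , a , trans (sym a⁴≡s) (sym (w⁴≡w²w² a)))) (sum-0 q)

  sum-ψ : + 4 * sum ψ ≡ + q - 1ℤ
  sum-ψ = begin
    + 4 * sum ψ                                    ≡⟨ isolate (+ 4 * sum ψ) ⟩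
    (+ 4 * sum ψ + 1ℤ) - 1ℤ                        ≡⟨ cong (_- 1ℤ) (cong₂ _+_ (*-distribˡ-sum (+ 4) ψ) (sym (sum-δ-1 𝟘))) ⟩
    (sum (λ s → + 4 * ψ s) + sum (δ 𝟘)) - 1ℤ
      ≡⟨ cong (_- 1ℤ) (trans (sum-cong #⁴√≡4ψ+δ) (∑-distrib-+ (λ s → + 4 * ψ s) (δ 𝟘))) ⟨
    sum #⁴√ - 1ℤ
      ≡⟨ cong (_- 1ℤ) (trans (∑-comm (λ s a → δ ((a ⊗ a) ⊗ (a ⊗ a)) s)) (sum-cong λ a → sum-δ-1 ((a ⊗ a) ⊗ (a ⊗ a)))) ⟩
    sum {q} (λ _ → 1ℤ) - 1ℤ                        ≡⟨ cong (_- 1ℤ) (trans (sum-const q 1ℤ) (ℤ.*-identityʳ (+ q))) ⟩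
    + q - 1ℤ                                       ∎
    where
    open ≡-Reasoning
    isolate : ∀ a → a ≡ (a + 1ℤ) - 1ℤ
    isolate = solve-∀

  -- The cyclotomic number (0,0) of order 4: the number of s such that s and
  -- s - 1 are nonzero fourth powers.
  N : ℤ
  N = sum (λ s → ψ s * ψ (s ⊕ ⊝ 𝟙))

  -- The number of points (a , b) of a^4 - b^4 = 1, grouped by s = a^4.
  M : ℤ
  M = sum (λ s → #⁴√ s * #⁴√ (s ⊕ ⊝ 𝟙))

  δ-pred : ∀ s → δ 𝟘 (s ⊕ ⊝ 𝟙) ≡ δ 𝟙 s
  δ-pred s = δ-cong (λ eq → sym (x⊝y≡𝟘⇒x≡y (sym eq))) (λ eq → sym (x≡y⇒x⊝y≡𝟘 (sym eq)))

  M≡16N+4 : M ≡ + 16 * N + + 4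
  M≡16N+4 = begin
    M                                                                   ≡⟨ sum-cong term ⟩
    sum (λ s → (+ 16 * (ψ s * ψ′ s) + + 4 * ψ s * δ 𝟙 s) + (+ 4 * ψ′ s + δ 𝟙 s) * δ 𝟘 s)
      ≡⟨ trans (∑-distrib-+ (λ s → + 16 * (ψ s * ψ′ s) + + 4 * ψ s * δ 𝟙 s) (λ s → (+ 4 * ψ′ s + δ 𝟙 s) * δ 𝟘 s))
                                                                             (cong₂ _+_ (∑-distrib-+ (λ s → + 16 * (ψ s * ψ′ s)) (λ s → + 4 * ψ s * δ 𝟙 s)) (sum-δ 𝟘 (λ s → + 4 * ψ′ s + δ 𝟙 s))) ⟩
    (sum (λ s → + 16 * (ψ s * ψ′ s)) + sum (λ s → + 4 * ψ s * δ 𝟙 s)) + (+ 4 * ψ′ 𝟘 + δ 𝟙 𝟘)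
      ≡⟨ cong₂ (λ a b → (a + b) + (+ 4 * ψ′ 𝟘 + δ 𝟙 𝟘))
                                                                             (sym (*-distribˡ-sum (+ 16) (λ s → ψ s * ψ′ s))) (sum-δ 𝟙 (λ s → + 4 * ψ s)) ⟩
    (+ 16 * N + + 4 * ψ 𝟙) + (+ 4 * ψ′ 𝟘 + δ 𝟙 𝟘)
      ≡⟨ cong₂ (λ a b → (+ 16 * N + + 4 * a) + b) ψ-𝟙 (cong₂ (λ a b → + 4 * a + b)
                                                                             (trans (cong ψ (⊕-identityˡ (⊝ 𝟙))) ψ-⊝𝟙) (δ-≢ 𝟙≢𝟘)) ⟩
    (+ 16 * N + + 4 * 1ℤ) + 0ℤ                                          ≡⟨ ℤ.+-identityʳ _ ⟩
    + 16 * N + + 4                                                      ∎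
    where
    open ≡-Reasoning
    ψ′ : Fin q → ℤ
    ψ′ s = ψ (s ⊕ ⊝ 𝟙)
    expand : ∀ a b c d → (+ 4 * a + c) * (+ 4 * b + d) ≡ (+ 16 * (a * b) + + 4 * a * d) + (+ 4 * b + d) * c
    expand = solve-∀
    term : ∀ s → #⁴√ s * #⁴√ (s ⊕ ⊝ 𝟙) ≡ (+ 16 * (ψ s * ψ′ s) + + 4 * ψ s * δ 𝟙 s) + (+ 4 * ψ′ s + δ 𝟙 s) * δ 𝟘 s
    term s = trans (cong₂ _*_ (#⁴√≡4ψ+δ s) (trans (#⁴√≡4ψ+δ (s ⊕ ⊝ 𝟙)) (cong (_+_ (+ 4 * ψ (s ⊕ ⊝ 𝟙))) (δ-pred s))))
                   (expand (ψ s) (ψ′ s) (δ 𝟘 s) (δ 𝟙 s))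

  sum-η⊕ : ∀ c → sum (λ x → η (x ⊕ c)) ≡ 0ℤ
  sum-η⊕ c = trans (sum-translate c η) sum-η

  sum-1 : sum {q} (λ _ → 1ℤ) ≡ + q
  sum-1 = trans (sum-const q 1ℤ) (ℤ.*-identityʳ (+ q))

  -- The number of solutions z of d z^2 = 1.
  #1/√ : ∀ d → sum (λ z → δ (z ⊗ z ⊗ d) 𝟙) ≡ 1ℤ + η d - δ 𝟘 d
  #1/√ d = by-cases (𝟘 ≟ d)
    where
    open ≡-Reasoning
    by-cases : (z : Dec (𝟘 ≡ d)) → sum (λ z → δ (z ⊗ z ⊗ d) 𝟙) ≡ 1ℤ + η d - ind z
    by-cases (yes refl) = trans (sum-cong λ z → δ-≢ λ eq → 𝟙≢𝟘 (trans (sym eq) (⊗-zeroʳ (z ⊗ z))))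
      (trans (sum-0 q) (cong (λ v → 1ℤ + v - 1ℤ) (sym η-𝟘)))
    by-cases (no 𝟘≢d) = begin
      sum (λ z → δ (z ⊗ z ⊗ d) 𝟙)  ≡⟨ sum-cong (λ z → δ-cong {i = z ⊗ z ⊗ d} {𝟙} {z ⊗ z} {d ⁻¹}
        (λ eq → ⊗-cancelˡ d≢𝟘 (trans (⊗-comm d (z ⊗ z)) (trans eq (sym (⁻¹-inverseʳ d≢𝟘)))))
        (λ eq → trans (cong (_⊗ d) eq) (⁻¹-inverseˡ d≢𝟘))) ⟩
      #√ (d ⁻¹)                    ≡⟨ #√≡1+η (d ⁻¹) ⟩
      1ℤ + η (d ⁻¹)                ≡⟨ cong (_+_ 1ℤ) (η-⁻¹ d) ⟩
      1ℤ + η d                     ≡⟨ ℤ.+-identityʳ _ ⟨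
      1ℤ + η d - 0ℤ                ∎
      where
      d≢𝟘 : d ≢ 𝟘
      d≢𝟘 = 𝟘≢d ∘ sym

  -- The sum of η(z) η(w) over the hyperbola z^2 - w^2 = 1.  Lines w = v z through
  -- the origin turn η(z) η(w) into η(v) and the equation into
  -- z^2 (1 - v^2) = 1.
  hyperbola-ηη : sum (λ z → sum (λ w → η z * (η w * δ (w ⊗ w) (z ⊗ z ⊕ ⊝ 𝟙)))) ≡ φ (⊝ 𝟙) - + 2
  hyperbola-ηη = begin
    sum (λ z → sum (λ w → η z * (η w * δ (w ⊗ w) (z ⊗ z ⊕ ⊝ 𝟙))))   ≡⟨ sum-cong (λ z → slope z (z ≟ 𝟘)) ⟩
    sum (λ z → sum (λ v → η v * δ (z ⊗ z ⊗ (𝟙 ⊕ ⊝ (v ⊗ v))) 𝟙))     ≡⟨ ∑-comm (λ z v → η v * δ (z ⊗ z ⊗ (𝟙 ⊕ ⊝ (v ⊗ v))) 𝟙) ⟩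
    sum (λ v → sum (λ z → η v * δ (z ⊗ z ⊗ (𝟙 ⊕ ⊝ (v ⊗ v))) 𝟙))
      ≡⟨ sum-cong (λ v → trans (sym (*-distribˡ-sum (η v) (λ z → δ (z ⊗ z ⊗ (𝟙 ⊕ ⊝ (v ⊗ v))) 𝟙)))
                                                                          (trans (cong (η v *_) (#1/√ (𝟙 ⊕ ⊝ (v ⊗ v)))) (term v))) ⟩
    sum (λ v → η v + η v * η (v ⊗ v ⊕ ⊝ 𝟙) - η v * δ (v ⊗ v) (𝟙 ⊗ 𝟙))
      ≡⟨ sum-minus (λ v → η v + η v * η (v ⊗ v ⊕ ⊝ 𝟙)) (λ v → η v * δ (v ⊗ v) (𝟙 ⊗ 𝟙)) ⟩
    sum (λ v → η v + η v * η (v ⊗ v ⊕ ⊝ 𝟙)) - sum (λ v → η v * δ (v ⊗ v) (𝟙 ⊗ 𝟙))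
      ≡⟨ cong₂ _-_ (∑-distrib-+ η (λ v → η v * η (v ⊗ v ⊕ ⊝ 𝟙))) (sum-δ-square 𝟙≢𝟘 η) ⟩
    (sum η + φ (⊝ 𝟙)) - (η 𝟙 + η (⊝ 𝟙))
      ≡⟨ cong₂ (λ a b → (a + φ (⊝ 𝟙)) - b) sum-η (cong₂ _+_ η-𝟙 η-⊝𝟙) ⟩
    (0ℤ + φ (⊝ 𝟙)) - + 2                                            ≡⟨ cong (_- + 2) (ℤ.+-identityˡ (φ (⊝ 𝟙))) ⟩
    φ (⊝ 𝟙) - + 2                                                   ∎
    where
    open ≡-Reasoning
    d : Fin q → Fin q
    d v = 𝟙 ⊕ ⊝ (v ⊗ v)

    slope : ∀ z → Dec (z ≡ 𝟘) → sum (λ w → η z * (η w * δ (w ⊗ w) (z ⊗ z ⊕ ⊝ 𝟙))) ≡ sum (λ v → η v * δ (z ⊗ z ⊗ d v) 𝟙)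
    slope z (yes refl) = trans (sum-cong λ w → trans (cong (_* (η w * δ (w ⊗ w) (𝟘 ⊗ 𝟘 ⊕ ⊝ 𝟙))) η-𝟘) (ℤ.*-zeroˡ (η w * δ (w ⊗ w) (𝟘 ⊗ 𝟘 ⊕ ⊝ 𝟙))))
      (sym (sum-cong λ v → trans (cong (η v *_) (δ-≢ {i = 𝟘 ⊗ 𝟘 ⊗ d v} λ eq → 𝟙≢𝟘 (trans (sym eq) (trans (cong (_⊗ d v) (⊗-zeroˡ 𝟘)) (⊗-zeroˡ (d v)))))) (ℤ.*-zeroʳ (η v))))
    slope z (no z≢𝟘) = begin
      sum (λ w → η z * (η w * δ (w ⊗ w) (z ⊗ z ⊕ ⊝ 𝟙)))
        ≡⟨ sum-scale z≢𝟘 (λ w → η z * (η w * δ (w ⊗ w) (z ⊗ z ⊕ ⊝ 𝟙))) ⟨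
      sum (λ v → η z * (η (z ⊗ v) * δ ((z ⊗ v) ⊗ (z ⊗ v)) (z ⊗ z ⊕ ⊝ 𝟙)))       ≡⟨ sum-cong each ⟩
      sum (λ v → η v * δ (z ⊗ z ⊗ d v) 𝟙)                                       ∎
      where
      regroup : ∀ a b c → a * (a * b * c) ≡ a * a * (b * c)
      regroup = solve-∀
      each : ∀ v → η z * (η (z ⊗ v) * δ ((z ⊗ v) ⊗ (z ⊗ v)) (z ⊗ z ⊕ ⊝ 𝟙)) ≡ η v * δ (z ⊗ z ⊗ d v) 𝟙
      each v = begin
        η z * (η (z ⊗ v) * δ ((z ⊗ v) ⊗ (z ⊗ v)) (z ⊗ z ⊕ ⊝ 𝟙))
          ≡⟨ cong₂ (λ a b → η z * (a * b)) (η-⊗ z v) (δ-cong {i = (z ⊗ v) ⊗ (z ⊗ v)} {z ⊗ z ⊕ ⊝ 𝟙} {z ⊗ z ⊗ d v} {𝟙}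
          (λ eq → x⊝y≡𝟘⇒x≡y (trans (flip z v 𝟙 (⊗-identityʳ (z ⊗ z))) (x≡y⇒x⊝y≡𝟘 (sym eq))))
          (λ eq → sym (x⊝y≡𝟘⇒x≡y (trans (sym (flip z v 𝟙 (⊗-identityʳ (z ⊗ z)))) (x≡y⇒x⊝y≡𝟘 eq))))) ⟩
        η z * (η z * η v * δ (z ⊗ z ⊗ d v) 𝟙)                     ≡⟨ regroup (η z) (η v) _ ⟩
        η z * η z * (η v * δ (z ⊗ z ⊗ d v) 𝟙)                     ≡⟨ cong (_* (η v * δ (z ⊗ z ⊗ d v) 𝟙)) (η²-≢𝟘 z≢𝟘) ⟩
        1ℤ * (η v * δ (z ⊗ z ⊗ d v) 𝟙)                            ≡⟨ ℤ.*-identityˡ _ ⟩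
        η v * δ (z ⊗ z ⊗ d v) 𝟙                                   ∎
        where
        flip : ∀ z v u → z ⊗ z ⊗ u ≡ z ⊗ z → z ⊗ z ⊗ (u ⊕ ⊝ (v ⊗ v)) ⊕ ⊝ u ≡ (z ⊗ z ⊕ ⊝ u) ⊕ ⊝ ((z ⊗ v) ⊗ (z ⊗ v))
        flip z v u eq = trans (solve 3 (λ z v u → z :* z :* (u :- v :* v) :- u := (z :* z :* u :- u) :- (z :* v) :* (z :* v)) refl z v u)
          (cong (λ t → (t ⊕ ⊝ u) ⊕ ⊝ ((z ⊗ v) ⊗ (z ⊗ v))) eq)

    distrib : ∀ a b c → a * (1ℤ + b - c) ≡ a + a * b - a * c
    distrib = solve-∀
    term : ∀ v → η v * (1ℤ + η (d v) - δ 𝟘 (d v)) ≡ η v + η v * η (v ⊗ v ⊕ ⊝ 𝟙) - η v * δ (v ⊗ v) (𝟙 ⊗ 𝟙)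
    term v = trans (cong₂ (λ a b → η v * (1ℤ + a - b))
      (trans (cong η (solve 2 (λ u v → u :- v :* v := :- (v :* v :- u)) refl 𝟙 v)) (η-⊝ _))
      (δ-cong {i = 𝟘} {d v} {v ⊗ v} {𝟙 ⊗ 𝟙}
        (λ eq → trans (sym (x⊝y≡𝟘⇒x≡y (sym eq))) (sym (⊗-identityˡ 𝟙)))
        (λ eq → sym (x≡y⇒x⊝y≡𝟘 (sym (trans eq (⊗-identityˡ 𝟙)))))))
      (distrib (η v) _ _)

  -- The parts of (1 + η z)(1 + η w) contribute q - 1, φ(-1), φ(1) = -φ(-1) and
  -- φ(-1) - 2.  Here c z = z^2 - 1, and B z is the sum of η w over w^2 = c z.
  M≡q-3+φ : M ≡ + q - + 3 + φ (⊝ 𝟙)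
  M≡q-3+φ = begin
    sum (λ s → #⁴√ s * #⁴√ (s ⊕ ⊝ 𝟙))                             ≡⟨ sum-over-fourths (λ s → #⁴√ (s ⊕ ⊝ 𝟙)) ⟩
    sum (λ z → (1ℤ + η z) * #⁴√ (c z))                            ≡⟨ sum-cong split ⟩
    sum (λ z → ((1ℤ + η (c z)) + (η z + η z * η (c z))) + (B z + η z * B z))
      ≡⟨ trans (∑-distrib-+ (λ z → (1ℤ + η (c z)) + (η z + η z * η (c z))) (λ z → B z + η z * B z))
                                                                       (cong₂ _+_ (trans (∑-distrib-+ (λ z → 1ℤ + η (c z)) (λ z → η z + η z * η (c z)))
                                                                                    (cong₂ _+_ (∑-distrib-+ {q} (λ _ → 1ℤ) (λ z → η (c z))) (∑-distrib-+ η (λ z → η z * η (c z)))))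
                                                                                  (∑-distrib-+ B (λ z → η z * B z))) ⟩
    ((sum {q} (λ _ → 1ℤ) + sum (λ z → η (c z))) + (sum η + φ (⊝ 𝟙))) + (sum B + sum (λ z → η z * B z)) ≡⟨ cong₂ _+_
                                                                       (cong₂ _+_ (cong₂ _+_ sum-1 sum-ηc) (cong (_+ φ (⊝ 𝟙)) sum-η)) (cong₂ _+_ sum-B sum-ηB) ⟩
    ((+ q + - 1ℤ) + (0ℤ + φ (⊝ 𝟙))) + (- φ (⊝ 𝟙) + (φ (⊝ 𝟙) - + 2)) ≡⟨ collect (+ q) (φ (⊝ 𝟙)) ⟩
    + q - + 3 + φ (⊝ 𝟙)                                           ∎
    where
    open ≡-Reasoning
    c : Fin q → Fin q
    c z = z ⊗ z ⊕ ⊝ 𝟙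
    B : Fin q → ℤ
    B z = sum (λ w → η w * δ (w ⊗ w) (c z))

    collect : ∀ Q f → ((Q + - 1ℤ) + (0ℤ + f)) + (- f + (f - + 2)) ≡ Q - + 3 + f
    collect = solve-∀

    sum-over-fourths : (f : Fin q → ℤ) → sum (λ s → #⁴√ s * f s) ≡ sum (λ z → (1ℤ + η z) * f (z ⊗ z))
    sum-over-fourths f = begin
      sum (λ s → #⁴√ s * f s)                                        ≡⟨ sum-cong (λ s → cong (_* f s) (#⁴√-squares s)) ⟩
      sum (λ s → sum (λ z → (1ℤ + η z) * δ (z ⊗ z) s) * f s)
        ≡⟨ sum-cong (λ s → trans (*-distribʳ-sum (f s) (λ z → (1ℤ + η z) * δ (z ⊗ z) s)) (sum-cong λ z → regroup (1ℤ + η z) (δ (z ⊗ z) s) (f s))) ⟩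
      sum (λ s → sum (λ z → (1ℤ + η z) * (f s * δ (z ⊗ z) s)))       ≡⟨ ∑-comm (λ s z → (1ℤ + η z) * (f s * δ (z ⊗ z) s)) ⟩
      sum (λ z → sum (λ s → (1ℤ + η z) * (f s * δ (z ⊗ z) s)))
        ≡⟨ sum-cong (λ z → trans (sym (*-distribˡ-sum (1ℤ + η z) (λ s → f s * δ (z ⊗ z) s))) (cong ((1ℤ + η z) *_) (sum-δ (z ⊗ z) f))) ⟩
      sum (λ z → (1ℤ + η z) * f (z ⊗ z))                             ∎
      where
      regroup : ∀ a b c → a * b * c ≡ a * (c * b)
      regroup = solve-∀

    split : ∀ z → (1ℤ + η z) * #⁴√ (c z) ≡ ((1ℤ + η (c z)) + (η z + η z * η (c z))) + (B z + η z * B z)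
    split z = trans (cong ((1ℤ + η z) *_) (begin
        #⁴√ (c z)                                         ≡⟨ #⁴√-squares (c z) ⟩
        sum (λ w → (1ℤ + η w) * δ (w ⊗ w) (c z))          ≡⟨ sum-cong (λ w → distrib (η w) (δ (w ⊗ w) (c z))) ⟩
        sum (λ w → δ (w ⊗ w) (c z) + η w * δ (w ⊗ w) (c z)) ≡⟨ ∑-distrib-+ (λ w → δ (w ⊗ w) (c z)) (λ w → η w * δ (w ⊗ w) (c z)) ⟩
        #√ (c z) + B z                                    ≡⟨ cong (_+ B z) (#√≡1+η (c z)) ⟩
        1ℤ + η (c z) + B z                                ∎))
      (expand (η z) (η (c z)) (B z))
      where
      distrib : ∀ a b → (1ℤ + a) * b ≡ b + a * b
      distrib = solve-∀
      expand : ∀ a b c → (1ℤ + a) * (1ℤ + b + c) ≡ ((1ℤ + b) + (a + a * b)) + (c + a * c)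
      expand = solve-∀

    sum-ηc : sum (λ z → η (c z)) ≡ - 1ℤ
    sum-ηc = begin
      sum (λ z → η (c z))                                                ≡⟨ sum-over-squares (λ s → η (s ⊕ ⊝ 𝟙)) ⟩
      sum (λ s → (1ℤ + η s) * η (s ⊕ ⊝ 𝟙))                               ≡⟨ sum-cong (λ s → distrib (η s) (η (s ⊕ ⊝ 𝟙))) ⟩
      sum (λ s → η (s ⊕ ⊝ 𝟙) + η s * η (s ⊕ ⊝ 𝟙))
        ≡⟨ ∑-distrib-+ (λ s → η (s ⊕ ⊝ 𝟙)) (λ s → η s * η (s ⊕ ⊝ 𝟙)) ⟩
      sum (λ s → η (s ⊕ ⊝ 𝟙)) + sum (λ s → η s * η (s ⊕ ⊝ 𝟙))            ≡⟨ cong₂ _+_ (sum-η⊕ (⊝ 𝟙)) (sum-ηη-shift (⊝-≢𝟘 𝟙≢𝟘)) ⟩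
      0ℤ + - 1ℤ                                                          ∎
      where
      distrib : ∀ a b → (1ℤ + a) * b ≡ b + a * b
      distrib = solve-∀

    sum-B : sum B ≡ - φ (⊝ 𝟙)
    sum-B = begin
      sum (λ z → sum (λ w → η w * δ (w ⊗ w) (c z)))     ≡⟨ ∑-comm (λ z w → η w * δ (w ⊗ w) (c z)) ⟩
      sum (λ w → sum (λ z → η w * δ (w ⊗ w) (c z)))
        ≡⟨ sum-cong (λ w → trans (sym (*-distribˡ-sum (η w) (λ z → δ (w ⊗ w) (c z)))) (cong (η w *_) (trans (sum-cong (swap w)) (#√≡1+η (w ⊗ w ⊕ 𝟙))))) ⟩
      sum (λ w → η w * (1ℤ + η (w ⊗ w ⊕ 𝟙)))            ≡⟨ sum-cong (λ w → distrib (η w) (η (w ⊗ w ⊕ 𝟙))) ⟩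
      sum (λ w → η w + η w * η (w ⊗ w ⊕ 𝟙))             ≡⟨ ∑-distrib-+ η (λ w → η w * η (w ⊗ w ⊕ 𝟙)) ⟩
      sum η + φ 𝟙                                       ≡⟨ cong₂ _+_ sum-η φ-𝟙 ⟩
      0ℤ + - φ (⊝ 𝟙)                                    ≡⟨ ℤ.+-identityˡ _ ⟩
      - φ (⊝ 𝟙)                                         ∎
      where
      distrib : ∀ a b → a * (1ℤ + b) ≡ a + a * b
      distrib = solve-∀
      swap : ∀ w z → δ (w ⊗ w) (c z) ≡ δ (z ⊗ z) (w ⊗ w ⊕ 𝟙)
      swap w z = δ-cong {i = w ⊗ w} {c z}
        (λ eq → trans (solve 2 (λ s u → s := (s :- u) :+ u) refl (z ⊗ z) 𝟙) (cong (_⊕ 𝟙) (sym eq)))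
        (λ eq → trans (solve 2 (λ s u → s := (s :+ u) :- u) refl (w ⊗ w) 𝟙) (cong (_⊕ ⊝ 𝟙) (sym eq)))

    sum-ηB : sum (λ z → η z * B z) ≡ φ (⊝ 𝟙) - + 2
    sum-ηB = trans (sum-cong λ z → *-distribˡ-sum (η z) (λ w → η w * δ (w ⊗ w) (c z))) hyperbola-ηη

  16N≡q-7+φ : + 16 * N ≡ + q - + 7 + φ (⊝ 𝟙)
  16N≡q-7+φ = begin
    + 16 * N                        ≡⟨ isolate (+ 16 * N) ⟩
    (+ 16 * N + + 4) - + 4          ≡⟨ cong (_- + 4) (trans (sym M≡16N+4) M≡q-3+φ) ⟩
    (+ q - + 3 + φ (⊝ 𝟙)) - + 4     ≡⟨ collect (+ q) (φ (⊝ 𝟙)) ⟩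
    + q - + 7 + φ (⊝ 𝟙)             ∎
    where
    open ≡-Reasoning
    isolate : ∀ a → a ≡ (a + + 4) - + 4
    isolate = solve-∀
    collect : ∀ a b → (a - + 3 + b) - + 4 ≡ a - + 7 + b
    collect = solve-∀

  -- The number of triples (a , b , c) whose differences b - a, c - b, c - a are
  -- nonzero fourth powers.
  #triples : ℤ
  #triples = sum (λ a → sum (λ b → sum (λ c → ψ (b ⊕ ⊝ a) * ψ (c ⊕ ⊝ b) * ψ (c ⊕ ⊝ a))))

  #triples≡ : #triples ≡ + q * (sum ψ * N)
  #triples≡ = trans (sum-cong per-vertex) (sum-const q (sum ψ * N))
    where
    open ≡-Reasoning
    regroup : ∀ a b c → a * b * c ≡ a * (c * b)
    regroup = solve-∀
    -- For a fourth power u substitute v = u s.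
    dilate : ∀ u → (f : Dec (Fourth u)) → sum (λ v → ind f * ψ (v ⊕ ⊝ u) * ψ v) ≡ ind f * N
    dilate u (no _)  = trans (sum-cong λ v → trans (cong (_* ψ v) (ℤ.*-zeroˡ (ψ (v ⊕ ⊝ u)))) (ℤ.*-zeroˡ (ψ v))) (trans (sum-0 q) (sym (ℤ.*-zeroˡ N)))
    dilate u (yes f) = begin
      sum (λ v → 1ℤ * ψ (v ⊕ ⊝ u) * ψ v)                 ≡⟨ sum-scale (proj₁ f) (λ v → 1ℤ * ψ (v ⊕ ⊝ u) * ψ v) ⟨
      sum (λ s → 1ℤ * ψ (u ⊗ s ⊕ ⊝ u) * ψ (u ⊗ s))       ≡⟨ sum-cong (λ s → cong₂ (λ a b → 1ℤ * a * b)
        (trans (cong ψ (factor s)) (ψ-scale f (s ⊕ ⊝ 𝟙))) (ψ-scale f s)) ⟩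
      sum (λ s → 1ℤ * ψ (s ⊕ ⊝ 𝟙) * ψ s)                 ≡⟨ sum-cong (λ s → regroup 1ℤ (ψ (s ⊕ ⊝ 𝟙)) (ψ s)) ⟩
      sum (λ s → 1ℤ * (ψ s * ψ (s ⊕ ⊝ 𝟙)))               ≡⟨ *-distribˡ-sum 1ℤ (λ s → ψ s * ψ (s ⊕ ⊝ 𝟙)) ⟨
      1ℤ * N                                             ∎
      where
      factor : ∀ s → u ⊗ s ⊕ ⊝ u ≡ u ⊗ (s ⊕ ⊝ 𝟙)
      factor s = trans (cong (λ t → u ⊗ s ⊕ ⊝ t) (sym (⊗-identityʳ u))) (solve 3 (λ u s w → u :* s :- u :* w := u :* (s :- w)) refl u s 𝟙)
    per-vertex : ∀ a → sum (λ b → sum (λ c → ψ (b ⊕ ⊝ a) * ψ (c ⊕ ⊝ b) * ψ (c ⊕ ⊝ a))) ≡ sum ψ * N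
    per-vertex a = begin
      sum (λ b → sum (λ c → ψ (b ⊕ ⊝ a) * ψ (c ⊕ ⊝ b) * ψ (c ⊕ ⊝ a)))
        ≡⟨ sum-translate a (λ b → sum (λ c → ψ (b ⊕ ⊝ a) * ψ (c ⊕ ⊝ b) * ψ (c ⊕ ⊝ a))) ⟨
      sum (λ u → sum (λ c → ψ ((u ⊕ a) ⊕ ⊝ a) * ψ (c ⊕ ⊝ (u ⊕ a)) * ψ (c ⊕ ⊝ a)))
        ≡⟨ sum-cong (λ u → sum-translate a (λ c → ψ ((u ⊕ a) ⊕ ⊝ a) * ψ (c ⊕ ⊝ (u ⊕ a)) * ψ (c ⊕ ⊝ a))) ⟨
      sum (λ u → sum (λ v → ψ ((u ⊕ a) ⊕ ⊝ a) * ψ ((v ⊕ a) ⊕ ⊝ (u ⊕ a)) * ψ ((v ⊕ a) ⊕ ⊝ a)))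
        ≡⟨ sum-cong (λ u → sum-cong λ v → cong₂ _*_
        (cong₂ _*_ (cong ψ (untranslate u)) (cong ψ (solve 3 (λ a u v → (v :+ a) :- (u :+ a) := v :- u) refl a u v))) (cong ψ (untranslate v))) ⟩
      sum (λ u → sum (λ v → ψ u * ψ (v ⊕ ⊝ u) * ψ v))                    ≡⟨ sum-cong (λ u → dilate u (fourth? u)) ⟩
      sum (λ u → ψ u * N)                                               ≡⟨ *-distribʳ-sum N ψ ⟨
      sum ψ * N                                                         ∎
      where
      untranslate : ∀ x → (x ⊕ a) ⊕ ⊝ a ≡ x
      untranslate x = solve 2 (λ x a → (x :+ a) :- a := x) refl x a

  64#triples : #triples * + 64 ≡ + q * (+ q - 1ℤ) * (+ q + φ (⊝ 𝟙) - + 7)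
  64#triples = begin
    #triples * + 64                                 ≡⟨ cong (_* + 64) #triples≡ ⟩
    + q * (sum ψ * N) * + 64                        ≡⟨ regroup (+ q) (sum ψ) N ⟩
    + q * (+ 4 * sum ψ) * (+ 16 * N)                ≡⟨ cong₂ (λ a b → + q * a * b) sum-ψ 16N≡q-7+φ ⟩
    + q * (+ q - 1ℤ) * (+ q - + 7 + φ (⊝ 𝟙))        ≡⟨ cong (+ q * (+ q - 1ℤ) *_) (reorder (+ q) (φ (⊝ 𝟙))) ⟩
    + q * (+ q - 1ℤ) * (+ q + φ (⊝ 𝟙) - + 7)        ∎
    where
    open ≡-Reasoning
    regroup : ∀ a b c → a * (b * c) * + 64 ≡ a * (+ 4 * b) * (+ 16 * c)
    regroup = solve-∀
    reorder : ∀ a b → a - + 7 + b ≡ a + b - + 7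
    reorder = solve-∀

-- The Jacobsthal sum modulo the characteristic.

module HasseInvariant {q : ℕ} (𝔽 : FiniteField q) (e : ℕ) (q≡1+4h : q ≡ order e) where

  open JacobsthalSums 𝔽 e q≡1+4h
  open Field 𝔽
  open FermatAndRoots 𝔽
  open QuadraticCharacter 𝔽 m q≡1+4h
  open Solver using (solve; _:=_; _:+_; _:*_; :-_; _:-_)
  open Algebra.Properties.CommutativeSemiring.Binomial commutativeSemiring using (theorem)

  ι-sum : ∀ {n} (f : Fin n → ℤ) → ι (sum f) ≡ F∑.sum (λ i → ι (f i))
  ι-sum {zero}  f = refl
  ι-sum {suc n} f = trans (ι-+ (f zero) _) (cong (ι (f zero) ⊕_) (ι-sum (f ∘ suc)))

  -- The sum of the k-th powers of all elements.
  P : ℕ → Fin q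
  P k = F∑.sum (λ t → t ^ k)

  -- The substitution g t for t multiplies the sum by g^k.
  P-vanishes : ∀ k → (∃ λ g → g ≢ 𝟘 × g ^ k ≢ 𝟙) → P k ≡ 𝟘
  P-vanishes k (g , g≢𝟘 , gᵏ≢𝟙) = [ (λ eq → contradiction (x⊝y≡𝟘⇒x≡y eq) gᵏ≢𝟙) , id ]′
      (⊗-integral (g ^ k ⊕ ⊝ 𝟙) (trans (solve 3 (λ a u p → (a :- u) :* p := a :* p :- u :* p) refl (g ^ k) 𝟙 (P k))
        (x≡y⇒x⊝y≡𝟘 (trans (sym invariant) (sym (⊗-identityˡ (P k)))))))
    where
    open ≡-Reasoning
    invariant : P k ≡ g ^ k ⊗ P k
    invariant = begin
      P k                                 ≡⟨ F∑.sum-permute (λ t → t ^ k) (permutation (g ⊗_) (g ⁻¹ ⊗_)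
                                               (λ x → cancel-⁻¹ x g≢𝟘) (λ x → cancel-⁻¹′ x g≢𝟘)) ⟩
      F∑.sum (λ t → (g ⊗ t) ^ k)          ≡⟨ F∑.sum-cong-≗ (λ t → ^-distrib-* g t k) ⟩
      F∑.sum (λ t → g ^ k ⊗ t ^ k)        ≡⟨ F∑.*-distribˡ-sum (g ^ k) (λ t → t ^ k) ⟨
      g ^ k ⊗ P k                         ∎

  -- The sum of the (q-1)-st powers is q - 1, that is -1.
  P-full : P (m ℕ.+ m) ≡ ⊝ 𝟙
  P-full = begin
    P (m ℕ.+ m)
      ≡⟨ solve 2 (λ a b → a := (a :+ b) :- b) refl (P (m ℕ.+ m)) (F∑.sum zero-indicator) ⟩
    (P (m ℕ.+ m) ⊕ F∑.sum zero-indicator) ⊕ ⊝ F∑.sum zero-indicator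
      ≡⟨ cong₂ (λ a b → a ⊕ ⊝ b) total (trans (SumSingle.sum-single (CommutativeRing.+-commutativeMonoid commutativeRing) 𝟘 zero-indicator off-zero) at-zero) ⟩
    𝟘 ⊕ ⊝ 𝟙                                                ≡⟨ ⊕-identityˡ _ ⟩
    ⊝ 𝟙                                                    ∎
    where
    open ≡-Reasoning
    zero-indicator : Fin q → Fin q
    zero-indicator t with t ≟ 𝟘
    ... | yes _ = 𝟙
    ... | no _  = 𝟘
    off-zero : ∀ t → t ≢ 𝟘 → zero-indicator t ≡ 𝟘
    off-zero t t≢𝟘 with t ≟ 𝟘
    ... | yes t≡𝟘 = contradiction t≡𝟘 t≢𝟘
    ... | no _    = refl
    at-zero : zero-indicator 𝟘 ≡ 𝟙
    at-zero with 𝟘 ≟ 𝟘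
    ... | yes _ = refl
    ... | no n  = contradiction refl n
    complement : ∀ t → t ^ (m ℕ.+ m) ⊕ zero-indicator t ≡ 𝟙
    complement t with t ≟ 𝟘
    ... | yes refl = trans (cong (_⊕ 𝟙) (𝟘^n (m ℕ.+ m))) (⊕-identityˡ 𝟙)
    ... | no t≢𝟘   = trans (⊕-identityʳ _) (fermat t≢𝟘 q≡1+4h)
    total : P (m ℕ.+ m) ⊕ F∑.sum zero-indicator ≡ 𝟘
    total = begin
      P (m ℕ.+ m) ⊕ F∑.sum zero-indicator              ≡⟨ F∑.∑-distrib-+ (λ t → t ^ (m ℕ.+ m)) zero-indicator ⟨
      F∑.sum (λ t → t ^ (m ℕ.+ m) ⊕ zero-indicator t)  ≡⟨ F∑.sum-cong-≗ complement ⟩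
      F∑.sum {q} (λ _ → 𝟙)                             ≡⟨ F∑.sum-replicate q ⟩
      q · 𝟙                                            ≡⟨ q·𝟙≡𝟘 ⟩
      𝟘                                                ∎

  -- Only the exponent q - 1 contributes among m, m + 2, ..., 3m.
  P-other : ∀ k → k ℕ.≤ m → k ≢ h → P (m ℕ.+ (k ℕ.+ k)) ≡ 𝟘
  P-other k k≤m k≢h with ℕ.<-cmp k h
  ... | tri≈ _ k≡h _ = contradiction k≡h k≢h
  ... | tri< k<h _ _ = P-vanishes (m ℕ.+ (k ℕ.+ k)) (nontrivial-power (ℕ.pred m ℕ.+ (k ℕ.+ k))
          (subst (suc (m ℕ.+ (k ℕ.+ k)) ℕ.<_) (sym q≡1+4h) (ℕ.s≤s (ℕ.+-monoʳ-< m (ℕ.+-mono-< k<h k<h)))))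
  ... | tri> _ _ h<k with ℕ.m≤n⇒∃[o]m+o≡n h<k
  ...   | d , refl = P-vanishes (m ℕ.+ (k ℕ.+ k)) (g , g≢𝟘 , λ gᵏ≡𝟙 → gᵈ≢𝟙 (trans (sym reduce) gᵏ≡𝟙))
    where
    open ≡-Reasoning
    1+d≤h : suc d ℕ.≤ h
    1+d≤h = ℕ.+-cancelˡ-≤ h _ _ (subst (ℕ._≤ m) (sym (ℕ.+-suc h d)) k≤m)
    found : ∃ λ g → g ≢ 𝟘 × g ^ suc (d ℕ.+ suc d) ≢ 𝟙
    found = nontrivial-power (d ℕ.+ suc d) (subst (suc (suc (d ℕ.+ suc d)) ℕ.<_) (sym q≡1+4h)
              (ℕ.s≤s (ℕ.≤-<-trans (ℕ.+-mono-≤ 1+d≤h 1+d≤h) (ℕ.m<m+n m (ℕ.s≤s ℕ.z≤n)))))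
    g : Fin q
    g = proj₁ found
    g≢𝟘 : g ≢ 𝟘
    g≢𝟘 = proj₁ (proj₂ found)
    gᵈ≢𝟙 : g ^ (suc d ℕ.+ suc d) ≢ 𝟙
    gᵈ≢𝟙 = proj₂ (proj₂ found)
    exponent : ∀ h d → h ℕ.+ h ℕ.+ (suc h ℕ.+ d ℕ.+ (suc h ℕ.+ d)) ≡ h ℕ.+ h ℕ.+ (h ℕ.+ h) ℕ.+ (suc d ℕ.+ suc d)
    exponent = ℕSolver.solve-∀
    reduce : g ^ (m ℕ.+ (suc h ℕ.+ d ℕ.+ (suc h ℕ.+ d))) ≡ g ^ (suc d ℕ.+ suc d)
    reduce = begin
      g ^ (m ℕ.+ (suc h ℕ.+ d ℕ.+ (suc h ℕ.+ d)))  ≡⟨ cong (g ^_) (exponent h d) ⟩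
      g ^ (m ℕ.+ m ℕ.+ (suc d ℕ.+ suc d))          ≡⟨ ^-homo-* g (m ℕ.+ m) (suc d ℕ.+ suc d) ⟩
      g ^ (m ℕ.+ m) ⊗ g ^ (suc d ℕ.+ suc d)        ≡⟨ cong (_⊗ g ^ (suc d ℕ.+ suc d)) (fermat g≢𝟘 q≡1+4h) ⟩
      𝟙 ⊗ g ^ (suc d ℕ.+ suc d)                    ≡⟨ ⊗-identityˡ _ ⟩
      g ^ (suc d ℕ.+ suc d)                        ∎

  -- Expand t^m (t^2 + 1)^m by the binomial theorem and sum over t.
  ι-φ𝟙 : ι (φ 𝟙) ≡ ⊝ ((m C h) · 𝟙)
  ι-φ𝟙 = begin
    ι (φ 𝟙)                                                       ≡⟨ ι-sum (λ t → η t * η (t ⊗ t ⊕ 𝟙)) ⟩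
    F∑.sum (λ t → ι (η t * η (t ⊗ t ⊕ 𝟙)))                        ≡⟨ F∑.sum-cong-≗ expand ⟩
    F∑.sum (λ t → F∑.sum (λ k → term k t))                        ≡⟨ F∑.∑-comm (λ t k → term k t) ⟩
    F∑.sum (λ k → F∑.sum (λ t → term k t))
      ≡⟨ F∑.sum-cong-≗ (λ k → F∑.*-distribˡ-sum (c k) (λ t → t ^ (m ℕ.+ (toℕ k ℕ.+ toℕ k)))) ⟨
    F∑.sum (λ k → c k ⊗ P (m ℕ.+ (toℕ k ℕ.+ toℕ k)))
      ≡⟨ SumSingle.sum-single (CommutativeRing.+-commutativeMonoid commutativeRing) k₀ _ (λ k k≢k₀ →
      trans (cong (c k ⊗_) (P-other (toℕ k) (ℕ.≤-pred (Fin.toℕ<n k)) (λ k≡h → k≢k₀ (Fin.toℕ-injective (trans k≡h (sym k₀≡h)))))) (⊗-zeroʳ (c k))) ⟩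
    c k₀ ⊗ P (m ℕ.+ (toℕ k₀ ℕ.+ toℕ k₀))                          ≡⟨ cong (λ k → (m C k) · 𝟙 ⊗ P (m ℕ.+ (k ℕ.+ k))) k₀≡h ⟩
    (m C h) · 𝟙 ⊗ P (m ℕ.+ m)                                     ≡⟨ cong ((m C h) · 𝟙 ⊗_) P-full ⟩
    (m C h) · 𝟙 ⊗ ⊝ 𝟙
      ≡⟨ solve 2 (λ b u → b :* :- u := :- (b :* u)) refl ((m C h) · 𝟙) 𝟙 ⟩
    ⊝ ((m C h) · 𝟙 ⊗ 𝟙)                                           ≡⟨ cong ⊝_ (⊗-identityʳ _) ⟩
    ⊝ ((m C h) · 𝟙)                                               ∎
    where
    open ≡-Reasoning
    c : Fin (suc m) → Fin q
    c k = (m C toℕ k) · 𝟙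
    term : Fin (suc m) → Fin q → Fin q
    term k t = c k ⊗ t ^ (m ℕ.+ (toℕ k ℕ.+ toℕ k))
    h<1+m : h ℕ.< suc m
    h<1+m = ℕ.s≤s (ℕ.m≤m+n h h)
    k₀ : Fin (suc m)
    k₀ = fromℕ< h<1+m
    k₀≡h : toℕ k₀ ≡ h
    k₀≡h = Fin.toℕ-fromℕ< h<1+m

    binomial : Fin q → Fin (suc m) → Fin q
    binomial t k = (m C toℕ k) · ((t ⊗ t) ^ toℕ k ⊗ 𝟙 ^ (m ℕ.∸ toℕ k))

    monomial : ∀ t k → t ^ m ⊗ binomial t k ≡ term k t
    monomial t k = begin
      t ^ m ⊗ binomial t k                                           ≡⟨ cong (λ z → t ^ m ⊗ ((m C toℕ k) · z))
        (trans (cong ((t ⊗ t) ^ toℕ k ⊗_) (𝟙^n (m ℕ.∸ toℕ k))) (trans (⊗-identityʳ _)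
          (trans (^-distrib-* t t (toℕ k)) (sym (^-homo-* t (toℕ k) (toℕ k)))))) ⟩
      t ^ m ⊗ ((m C toℕ k) · t ^ (toℕ k ℕ.+ toℕ k))
        ≡⟨ cong (t ^ m ⊗_) (trans (cong ((m C toℕ k) ·_) (sym (⊗-identityˡ _))) (sym (×-assoc-* (m C toℕ k) 𝟙 _))) ⟩
      t ^ m ⊗ (c k ⊗ t ^ (toℕ k ℕ.+ toℕ k))
        ≡⟨ solve 3 (λ a b d → a :* (b :* d) := b :* (a :* d)) refl (t ^ m) (c k) _ ⟩
      c k ⊗ (t ^ m ⊗ t ^ (toℕ k ℕ.+ toℕ k))                          ≡⟨ cong (c k ⊗_) (^-homo-* t m (toℕ k ℕ.+ toℕ k)) ⟨
      term k t                                                       ∎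

    expand : ∀ t → ι (η t * η (t ⊗ t ⊕ 𝟙)) ≡ F∑.sum (λ k → term k t)
    expand t = begin
      ι (η t * η (t ⊗ t ⊕ 𝟙))          ≡⟨ ι-* (η t) _ ⟩
      ι (η t) ⊗ ι (η (t ⊗ t ⊕ 𝟙))      ≡⟨ cong₂ _⊗_ (ι-η t) (ι-η (t ⊗ t ⊕ 𝟙)) ⟩
      t ^ m ⊗ (t ⊗ t ⊕ 𝟙) ^ m          ≡⟨ cong (t ^ m ⊗_) (theorem m (t ⊗ t) 𝟙) ⟩
      t ^ m ⊗ F∑.sum (binomial t)     ≡⟨ F∑.*-distribˡ-sum (t ^ m) (binomial t) ⟩
      F∑.sum (λ k → t ^ m ⊗ binomial t k) ≡⟨ F∑.sum-cong-≗ (monomial t) ⟩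
      F∑.sum (λ k → term k t)          ∎

  module _ {p r : ℕ} (p-prime : Prime p) (q≡pʳ : q ≡ p ℕ.^ r) where

    p·𝟙≡𝟘 : p · 𝟙 ≡ 𝟘
    p·𝟙≡𝟘 = nilpotent r (trans (cong (_· 𝟙) (sym q≡pʳ)) q·𝟙≡𝟘)
      where
      nilpotent : ∀ r → (p ℕ.^ r) · 𝟙 ≡ 𝟘 → p · 𝟙 ≡ 𝟘
      nilpotent zero    1≡𝟘 = contradiction (trans (sym ι-1) 1≡𝟘) 𝟙≢𝟘
      nilpotent (suc r) eq  = [ id , nilpotent r ]′ (⊗-integral (p · 𝟙) (trans (sym (×1-homo-* p (p ℕ.^ r))) eq))

    multiple·𝟙 : ∀ k n → n · 𝟙 ≡ 𝟘 → (k ℕ.* n) · 𝟙 ≡ 𝟘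
    multiple·𝟙 k n eq = trans (×1-homo-* k n) (trans (cong (k · 𝟙 ⊗_) eq) (⊗-zeroʳ _))

    -- Otherwise a Bézout identity for p and n would give 1 = 0.
    n·𝟙≡𝟘⇒p∣n : ∀ n → n · 𝟙 ≡ 𝟘 → p ℕ.∣ n
    n·𝟙≡𝟘⇒p∣n n n·𝟙≡𝟘 with p ℕ.∣? n
    ... | yes p∣n = p∣n
    ... | no  p∤n with Coprime.coprime-Bézout (prime∤⇒coprime p-prime p∤n)
    ...   | GCD.Bézout.+- x y 1+yn≡xp = contradiction (begin
              𝟙                               ≡⟨ ⊕-identityʳ 𝟙 ⟨
              𝟙 ⊕ 𝟘                           ≡⟨ cong (𝟙 ⊕_) (multiple·𝟙 y n n·𝟙≡𝟘) ⟨
              suc (y ℕ.* n) · 𝟙               ≡⟨ cong (_· 𝟙) 1+yn≡xp ⟩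
              (x ℕ.* p) · 𝟙                   ≡⟨ multiple·𝟙 x p p·𝟙≡𝟘 ⟩
              𝟘                               ∎) 𝟙≢𝟘
      where open ≡-Reasoning
    ...   | GCD.Bézout.-+ x y 1+xp≡yn = contradiction (begin
              𝟙                               ≡⟨ ⊕-identityʳ 𝟙 ⟨
              𝟙 ⊕ 𝟘                           ≡⟨ cong (𝟙 ⊕_) (multiple·𝟙 x p p·𝟙≡𝟘) ⟨
              suc (x ℕ.* p) · 𝟙               ≡⟨ cong (_· 𝟙) 1+xp≡yn ⟩
              (y ℕ.* n) · 𝟙                   ≡⟨ multiple·𝟙 y n n·𝟙≡𝟘 ⟩
              𝟘                               ∎) 𝟙≢𝟘
      where open ≡-Reasoning

    ∣i∣·𝟙≡𝟘⇒ι≡𝟘 : ∀ i → ℤ.∣ i ∣ · 𝟙 ≡ 𝟘 → ι i ≡ 𝟘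
    ∣i∣·𝟙≡𝟘⇒ι≡𝟘 (+ n)    eq = eq
    ∣i∣·𝟙≡𝟘⇒ι≡𝟘 -[1+ n ] eq = trans (cong ⊝_ eq) ⊝𝟘

    p∣φ⇒p∣C : + p ∣ φ (⊝ 𝟙) → p ℕ.∣ (m C h)
    p∣φ⇒p∣C (ℕ.divides k ∣φ∣≡kp) = n·𝟙≡𝟘⇒p∣n (m C h) (begin
      (m C h) · 𝟙         ≡⟨ ⊝-involutive _ ⟨
      ⊝ ⊝ ((m C h) · 𝟙)   ≡⟨ cong ⊝_ ι-φ𝟙 ⟨
      ⊝ ι (φ 𝟙)           ≡⟨ cong (λ v → ⊝ ι v) φ-𝟙 ⟩
      ⊝ ι (- φ (⊝ 𝟙))     ≡⟨ ι-neg (- φ (⊝ 𝟙)) ⟨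
      ι (- - φ (⊝ 𝟙))     ≡⟨ cong ι (ℤ.neg-involutive (φ (⊝ 𝟙))) ⟩
      ι (φ (⊝ 𝟙))         ≡⟨ ∣i∣·𝟙≡𝟘⇒ι≡𝟘 (φ (⊝ 𝟙)) (trans (cong (_· 𝟙) ∣φ∣≡kp) (multiple·𝟙 k p p·𝟙≡𝟘)) ⟩
      𝟘                   ∎)
      where open ≡-Reasoning

-- Transitive tournaments and their listings.

private variable
  a p : Level

-- Exactly n elements of A satisfy P.  Elements are counted up to propositional
-- equality, and different proofs of P for one element are not distinguished.
record Counts {A : Set a} (P : A → Set p) (n : ℕ) : Set (a ⊔ p) where
  field
    index     : ∀ {x} → P x → Fin n
    elem      : Fin n → A
    elem-P    : ∀ i → P (elem i)
    elem-index : ∀ {x} (px : P x) → elem (index px) ≡ x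
    elem-injective : ∀ {i j} → elem i ≡ elem j → i ≡ j

open Counts

-- P has z elements, for an integer z that is not known to be a natural number
-- beforehand.
HasCount : {A : Set a} → (A → Set p) → ℤ → Set (a ⊔ p)
HasCount P z = ∃ λ n → Counts P n × + n ≡ z

count-dec : {P : Set p} (P? : Dec P) → HasCount (λ (_ : ⊤) → P) (ind P?)
count-dec (yes p) = 1 , record
  { index = λ _ → 0F ; elem = λ _ → tt ; elem-P = λ _ → p ; elem-index = λ _ → refl
  ; elem-injective = λ { {0F} {0F} _ → refl } } , refl
count-dec (no ¬p) = 0 , record
  { index = λ p → contradiction p ¬p ; elem = λ () ; elem-P = λ () ; elem-index = λ p → contradiction p ¬p
  ; elem-injective = λ { {()} } } , refl

module _ {A : Set a} where

  counts-suc : ∀ {k n₀ n₁} {P : Fin (suc k) × A → Set p} →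
               Counts (λ x → P (zero , x)) n₀ → Counts (λ (i , x) → P (suc i , x)) n₁ → Counts P (n₀ ℕ.+ n₁)
  counts-suc {k = k} {n₀} {n₁} {P} C₀ C₁ = record
    { index = λ { {zero , _} p → index C₀ p ↑ˡ n₁ ; {suc _ , _} p → n₀ ↑ʳ index C₁ p }
    ; elem = λ i → element (splitAt n₀ i)
    ; elem-P = λ i → element-P (splitAt n₀ i)
    ; elem-index = λ
      { {zero , _} p → trans (cong element (Fin.splitAt-↑ˡ n₀ (index C₀ p) n₁)) (cong (zero ,_) (elem-index C₀ p))
      ; {suc _ , _} p → trans (cong element (Fin.splitAt-↑ʳ n₀ n₁ (index C₁ p))) (cong shift (elem-index C₁ p)) }
    ; elem-injective = λ {i} {j} eq → trans (sym (Fin.join-splitAt n₀ n₁ i))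
        (trans (cong (join n₀ n₁) (element-injective (splitAt n₀ i) (splitAt n₀ j) eq)) (Fin.join-splitAt n₀ n₁ j)) }
    where
    shift : Fin k × A → Fin (suc k) × A
    shift (i , x) = suc i , x
    shift-injective : ∀ {s t} → shift s ≡ shift t → s ≡ t
    shift-injective refl = refl
    element : Fin n₀ ⊎ Fin n₁ → Fin (suc k) × A
    element (inj₁ i) = zero , elem C₀ i
    element (inj₂ i) = shift (elem C₁ i)
    element-P : ∀ i → P (element i)
    element-P (inj₁ i) = elem-P C₀ i
    element-P (inj₂ i) = elem-P C₁ i
    element-injective : ∀ i j → element i ≡ element j → i ≡ j
    element-injective (inj₁ i) (inj₁ j) eq = cong inj₁ (elem-injective C₀ (cong proj₂ eq))
    element-injective (inj₁ i) (inj₂ j) ()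
    element-injective (inj₂ i) (inj₁ j) ()
    element-injective (inj₂ i) (inj₂ j) eq = cong inj₂ (elem-injective C₁ (shift-injective eq))

  count-sum : ∀ {k} {P : Fin k × A → Set p} {f : Fin k → ℤ} →
              (∀ i → HasCount (λ x → P (i , x)) (f i)) → HasCount P (sum f)
  count-sum {k = zero}  _ = 0 , record
    { index = λ { {() , _} } ; elem = λ () ; elem-P = λ () ; elem-index = λ { {() , _} } ; elem-injective = λ { {()} } } , refl
  count-sum {k = suc k} count with count zero | count-sum (λ i → count (suc i))
  ... | n₀ , C₀ , eq₀ | n₁ , C₁ , eq₁ = n₀ ℕ.+ n₁ , counts-suc C₀ C₁ , cong₂ ℤ._+_ eq₀ eq₁

increasing⇒≤ : ∀ {m n} (σ : Fin m → Fin n) → (∀ {i j} → i Fin.< j → σ i Fin.< σ j) → ∀ i → toℕ i ℕ.≤ toℕ (σ i)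
increasing⇒≤ {m} σ σ-mono i = go (toℕ i) i refl
  where
  go : ∀ k i → toℕ i ≡ k → k ℕ.≤ toℕ (σ i)
  go zero    i _   = ℕ.z≤n
  go (suc k) i i≡1+k = ℕ.≤-<-trans (go k i′ i′≡k) (σ-mono (ℕ.≤-reflexive (trans (cong suc i′≡k) (sym i≡1+k))))
    where
    k<m : k ℕ.< m
    k<m = ℕ.<-trans (ℕ.n<1+n k) (subst (ℕ._< m) i≡1+k (Fin.toℕ<n i))
    i′ : Fin m
    i′ = fromℕ< k<m
    i′≡k : toℕ i′ ≡ k
    i′≡k = Fin.toℕ-fromℕ< k<m

module Tournaments {c ℓ e : Level} (G : Digraph c ℓ e) where
  open Digraph G
  open Setoid vertices using () renaming (refl to ≈-refl; sym to ≈-sym; trans to ≈-trans)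
  open Subdigraph
  open IsTournament
  open IsTransitiveOfOrder

  module _ {m : ℕ} {H K : Subdigraph G}
           (H-tournament : IsTournament G H) (H-order : IsTransitiveOfOrder G m H)
           (K-tournament : IsTournament G K) (K-order : IsTransitiveOfOrder G m K) where

    -- The position in the listing of K of the i-th vertex of H.
    position : Setoid._≈_ (subdigraphs G) H K → ∀ i → ∃ λ j → vertex K-order j ≈ vertex H-order i
    position ((H⊆K , _) , _) i = exhaustive K-order (H⊆K (vertex∈V H-order i))

    position-increasing : (H≈K : Setoid._≈_ (subdigraphs G) H K) →
      ∀ {i j} → i Fin.< j → proj₁ (position H≈K i) Fin.< proj₁ (position H≈K j)
    position-increasing H≈K@(_ , (E⊆ , _)) {i} {j} i<j with position H≈K i | position H≈K j
    ... | k , wₖ≈vᵢ | l , wₗ≈vⱼ = compare (Fin.<-cmp k l)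
      where
      edge : E K (vertex K-order k) (vertex K-order l)
      edge = proj₁ (E-resp K) (≈-sym wₗ≈vⱼ) (proj₂ (E-resp K) (≈-sym wₖ≈vᵢ) (E⊆ (ordered H-order i<j)))
      compare : _ → k Fin.< l
      compare (tri< k<l _ _) = k<l
      compare (tri≈ _ refl _) = contradiction edge (asymmetric K-tournament edge)
      compare (tri> _ _ l<k) = contradiction (ordered K-order l<k) (asymmetric K-tournament edge)

  -- A transitive tournament has only one listing: the position maps between two
  -- listings are mutually inverse and increasing, hence the identity.
  listing-unique : ∀ {m} {H K : Subdigraph G}
    (H-tournament : IsTournament G H) (H-order : IsTransitiveOfOrder G m H)
    (K-tournament : IsTournament G K) (K-order : IsTransitiveOfOrder G m K) →
    Setoid._≈_ (subdigraphs G) H K → ∀ i → vertex H-order i ≈ vertex K-order i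
  listing-unique {m} {H} {K} Ht Ho Kt Ko H≈K i = ≈-sym (subst (λ j → vertex Ko j ≈ vertex Ho i) σi≡i (proj₂ (position Ht Ho Kt Ko H≈K i)))
    where
    K≈H : Setoid._≈_ (subdigraphs G) K H
    K≈H = Setoid.sym (subdigraphs G) {H} {K} H≈K
    σ τ : Fin m → Fin m
    σ j = proj₁ (position Ht Ho Kt Ko H≈K j)
    τ j = proj₁ (position Kt Ko Ht Ho K≈H j)
    τσi≡i : τ (σ i) ≡ i
    τσi≡i = distinct Ho (≈-trans (proj₂ (position Kt Ko Ht Ho K≈H (σ i))) (proj₂ (position Ht Ho Kt Ko H≈K i)))
    σi≡i : σ i ≡ i
    σi≡i = Fin.toℕ-injective (ℕ.≤-antisym
      (subst (λ j → toℕ (σ i) ℕ.≤ toℕ j) τσi≡i (increasing⇒≤ τ (position-increasing Kt Ko Ht Ho K≈H) (σ i)))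
      (increasing⇒≤ σ (position-increasing Ht Ho Kt Ko H≈K) i))

  -- x and y are listed by v at positions i < j.
  data Before {m : ℕ} (v : Fin m → Carrier) (x y : Carrier) : Set (ℓ ⊔ e) where
    before : ∀ {i j} → i Fin.< j → v i ≈ x → v j ≈ y → Before v x y

  module _ {m : ℕ} (v : Fin m → Carrier) (chain : ∀ {i j} → i Fin.< j → v i ⟶ v j) where

    -- The transitive tournament with listing v.
    chainSubdigraph : Subdigraph G
    chainSubdigraph = record
      { V      = λ x → ∃ λ i → v i ≈ x
      ; E      = Before v
      ; V-resp = λ x≈y (i , vᵢ≈x) → i , ≈-trans vᵢ≈x x≈y
      ; E-resp = (λ y≈z → λ { (before i<j vᵢ≈x vⱼ≈y) → before i<j vᵢ≈x (≈-trans vⱼ≈y y≈z) })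
               , (λ x≈z → λ { (before i<j vᵢ≈x vⱼ≈y) → before i<j (≈-trans vᵢ≈x x≈z) vⱼ≈y })
      ; E⇒V    = λ { (before {i} {j} _ vᵢ≈x vⱼ≈y) → (i , vᵢ≈x) , (j , vⱼ≈y) }
      ; E⇒⟶    = λ { (before i<j vᵢ≈x vⱼ≈y) → proj₁ ⟶-resp vⱼ≈y (proj₂ ⟶-resp vᵢ≈x (chain i<j)) }
      }

    module _ (irreflexive : ∀ {x} → ¬ (x ⟶ x)) where

      chain-distinct : ∀ {i j} → v i ≈ v j → i ≡ j
      chain-distinct {i} {j} vᵢ≈vⱼ with Fin.<-cmp i j
      ... | tri< i<j _ _ = contradiction (proj₁ ⟶-resp (≈-sym vᵢ≈vⱼ) (chain i<j)) irreflexive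
      ... | tri≈ _ i≡j _ = i≡j
      ... | tri> _ _ j<i = contradiction (proj₁ ⟶-resp vᵢ≈vⱼ (chain j<i)) irreflexive

      chain-tournament : IsTournament G chainSubdigraph
      chain-tournament = record { asymmetric = asym ; total = tot }
        where
        asym : ∀ {x y} → Before v x y → ¬ Before v y x
        asym (before i<j vᵢ≈x vⱼ≈y) (before k<l vₖ≈y vₗ≈x)
          with chain-distinct (≈-trans vᵢ≈x (≈-sym vₗ≈x)) | chain-distinct (≈-trans vⱼ≈y (≈-sym vₖ≈y))
        ... | refl | refl = Fin.<-asym i<j k<l
        tot : ∀ {x y} → ∃ (λ i → v i ≈ x) → ∃ (λ i → v i ≈ y) → ¬ (x ≈ y) → Before v x y ⊎ Before v y x
        tot (i , vᵢ≈x) (j , vⱼ≈y) x≉y with Fin.<-cmp i j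
        ... | tri< i<j _ _ = inj₁ (before i<j vᵢ≈x vⱼ≈y)
        ... | tri≈ _ refl _ = contradiction (≈-trans (≈-sym vᵢ≈x) vⱼ≈y) x≉y
        ... | tri> _ _ j<i = inj₂ (before j<i vⱼ≈y vᵢ≈x)

      chain-order : IsTransitiveOfOrder G m chainSubdigraph
      chain-order = record
        { vertex = v ; vertex∈V = λ i → i , ≈-refl ; distinct = chain-distinct
        ; exhaustive = id ; ordered = λ i<j → before i<j ≈-refl ≈-refl }

    chain-recovers : ∀ {H} → IsTournament G H → (H-order : IsTransitiveOfOrder G m H) →
      (∀ i → v i ≈ vertex H-order i) → Setoid._≈_ (subdigraphs G) chainSubdigraph H
    chain-recovers {H} Ht Ho v≈ = (to-V , from-V) , (to-E , from-E)
      where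
      to-V : ∀ {x} → ∃ (λ i → v i ≈ x) → V H x
      to-V (i , vᵢ≈x) = V-resp H (≈-trans (≈-sym (v≈ i)) vᵢ≈x) (vertex∈V Ho i)
      from-V : ∀ {x} → V H x → ∃ λ i → v i ≈ x
      from-V x∈H with exhaustive Ho x∈H
      ... | i , hᵢ≈x = i , ≈-trans (v≈ i) hᵢ≈x
      to-E : ∀ {x y} → Before v x y → E H x y
      to-E (before {i} {j} i<j vᵢ≈x vⱼ≈y) = proj₁ (E-resp H) (≈-trans (≈-sym (v≈ j)) vⱼ≈y)
        (proj₂ (E-resp H) (≈-trans (≈-sym (v≈ i)) vᵢ≈x) (ordered Ho i<j))
      from-E : ∀ {x y} → E H x y → Before v x y
      from-E xy with from-V (proj₁ (E⇒V H xy)) | from-V (proj₂ (E⇒V H xy))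
      ... | i , vᵢ≈x | j , vⱼ≈y with Fin.<-cmp i j
      ...   | tri< i<j _ _ = before i<j vᵢ≈x vⱼ≈y
      ...   | tri≈ _ refl _ = contradiction xx (asymmetric Ht xx)
        where xx = proj₁ (E-resp H) (≈-trans (≈-sym vⱼ≈y) vᵢ≈x) xy
      ...   | tri> _ _ j<i = contradiction (to-E (before j<i vⱼ≈y vᵢ≈x)) (asymmetric Ht xy)

  -- Triples of codes of vertices; the unit component ends the nested product
  -- over which count-sum iterates.
  Triple : ℕ → Set
  Triple q = Fin q × Fin q × Fin q × ⊤

  module _ {q : ℕ} (finite : HasCardinality vertices q) where
    open Inverse finite

    -- The triples (i , j , k) with edges from i to j, from j to k and from i to k.
    TransitiveTriple : Triple q → Set e
    TransitiveTriple (i , j , k , _) = (from i ⟶ from j) × (from j ⟶ from k) × (from i ⟶ from k)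

    listing : Triple q → Fin 3 → Carrier
    listing (i , j , k , _) 0F = from i
    listing (i , j , k , _) 1F = from j
    listing (i , j , k , _) 2F = from k

    listing-chain : ∀ t → TransitiveTriple t → ∀ {i j} → i Fin.< j → listing t i ⟶ listing t j
    listing-chain t (ij , jk , ik) {0F} {1F} _ = ij
    listing-chain t (ij , jk , ik) {0F} {2F} _ = ik
    listing-chain t (ij , jk , ik) {1F} {2F} _ = jk
    listing-chain t _ {1F} {1F} (ℕ.s≤s ())
    listing-chain t _ {2F} {1F} (ℕ.s≤s ())
    listing-chain t _ {2F} {2F} (ℕ.s≤s (ℕ.s≤s ()))

    count-triples : ∀ {n} → (∀ {x} → ¬ (x ⟶ x)) → Counts TransitiveTriple n → 𝒦[ 3 ]⟨ G ⟩≡ n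
    count-triples {n} irreflexive triples = record
      { to        = code
      ; from      = tournament
      ; to-cong   = λ {x} {y} → code-cong x y
      ; from-cong = λ { refl → Setoid.refl (transitiveSubtournaments G 3) {tournament _} }
      ; inverse   = (λ {x} {y} y≈ → trans (code-cong y (tournament x) y≈) (code-tournament x))
                  , (λ {x} → λ { refl → tournament-code x })
      }
      where
      open Setoid (transitiveSubtournaments G 3) renaming (Carrier to Subtournament; _≈_ to _≋_) using ()

      vertices-of : Subtournament → Fin 3 → Carrier
      vertices-of (_ , _ , o) = vertex o

      triple : Subtournament → Triple q
      triple H = to (vertices-of H 0F) , to (vertices-of H 1F) , to (vertices-of H 2F) , tt

      listing-triple : ∀ H i → listing (triple H) i ≈ vertices-of H i
      listing-triple H 0F = strictlyInverseʳ _
      listing-triple H 1F = strictlyInverseʳ _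
      listing-triple H 2F = strictlyInverseʳ _

      edge : ∀ H {i j} → i Fin.< j → listing (triple H) i ⟶ listing (triple H) j
      edge H@(S , _ , o) {i} {j} i<j = proj₁ ⟶-resp (≈-sym (listing-triple H j))
        (proj₂ ⟶-resp (≈-sym (listing-triple H i)) (E⇒⟶ S (ordered o i<j)))

      triple-transitive : ∀ H → TransitiveTriple (triple H)
      triple-transitive H = edge H {0F} {1F} (ℕ.s≤s ℕ.z≤n) , edge H {1F} {2F} (ℕ.s≤s (ℕ.s≤s ℕ.z≤n)) , edge H {0F} {2F} (ℕ.s≤s ℕ.z≤n)

      code : Subtournament → Fin n
      code H = index triples (triple-transitive H)

      tournament : Fin n → Subtournament
      tournament x = chainSubdigraph (listing t) (listing-chain t t-transitive)
                   , chain-tournament (listing t) (listing-chain t t-transitive) irreflexive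
                   , chain-order (listing t) (listing-chain t t-transitive) irreflexive
        where
        t : Triple q
        t = elem triples x
        t-transitive : TransitiveTriple t
        t-transitive = elem-P triples x

      code-cong : ∀ H K → H ≋ K → code H ≡ code K
      code-cong H@(S , Ht , Ho) K@(T , Kt , Ko) H≈K = elem-injective triples
        (trans (elem-index triples (triple-transitive H)) (trans same-triple (sym (elem-index triples (triple-transitive K)))))
        where
        same : ∀ i → to (vertex Ho i) ≡ to (vertex Ko i)
        same i = to-cong (listing-unique Ht Ho Kt Ko H≈K i)
        same-triple : triple H ≡ triple K
        same-triple = cong₂ _,_ (same 0F) (cong₂ _,_ (same 1F) (cong (_, tt) (same 2F)))

      code-tournament : ∀ x → code (tournament x) ≡ x
      code-tournament x = elem-injective triples (trans (elem-index triples (triple-transitive (tournament x)))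
        (cong₂ _,_ (strictlyInverseˡ _) (cong₂ _,_ (strictlyInverseˡ _) (cong (_, tt) (strictlyInverseˡ _)))))

      tournament-code : ∀ H → tournament (code H) ≋ H
      tournament-code H@(S , Ht , Ho) = chain-recovers (listing t) (listing-chain t (elem-P triples (code H))) Ht Ho
        (λ i → ≈-trans (Setoid.reflexive vertices (cong (λ t → listing t i) (elem-index triples (triple-transitive H)))) (listing-triple H i))
        where
        t : Triple q
        t = elem triples (code H)

-- The count for the fourth-power digraph.

-- A finite field in the sense of a commutative ring with a setoid equality is
-- carried over to Fin q along its enumeration.
module Transport {c ℓ : Level} (F : CommutativeRing c ℓ) (F-field : IsField F)
                 {q : ℕ} (finite : HasCardinality (CommutativeRing.setoid F) q) where

  open CommutativeRing F
    using (_≈_; 0#; 1#; rawRing; isCommutativeRing; commutativeSemiring; +-congˡ; *-congˡ; -‿inverseʳ)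
    renaming (_+_ to _+ᶠ_; _*_ to _*ᶠ_; -_ to -ᶠ_; _-_ to _-ᶠ_; sym to ≈-sym; trans to ≈-trans)
  open Inverse finite
  open IsField F-field

  private
    rawRing-q : RawRing 0ℓ 0ℓ
    rawRing-q = record
      { Carrier = Fin q
      ; _≈_     = _≡_
      ; _+_     = λ i j → to (from i +ᶠ from j)
      ; _*_     = λ i j → to (from i *ᶠ from j)
      ; -_      = λ i → to (-ᶠ from i)
      ; 0#      = to 0#
      ; 1#      = to 1#
      }

    from-injective : ∀ {i j} → from i ≈ from j → i ≡ j
    from-injective {i} {j} eq = trans (sym (strictlyInverseˡ i)) (trans (to-cong eq) (strictlyInverseˡ j))

    from-isRingMonomorphism : IsRingMonomorphism rawRing-q rawRing from
    from-isRingMonomorphism = record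
      { isRingHomomorphism = record
        { isSemiringHomomorphism = record
          { isNearSemiringHomomorphism = record
            { +-isMonoidHomomorphism = record
              { isMagmaHomomorphism = record
                { isRelHomomorphism = record { cong = from-cong }
                ; homo = λ i j → strictlyInverseʳ _ }
              ; ε-homo = strictlyInverseʳ _ }
            ; *-homo = λ i j → strictlyInverseʳ _ }
          ; 1#-homo = strictlyInverseʳ _ }
        ; -‿homo = λ i → strictlyInverseʳ _ }
      ; injective = from-injective }

  finiteField : FiniteField q
  finiteField = record
    { isCommutativeRing = Algebra.Morphism.RingMonomorphism.isCommutativeRing from-isRingMonomorphism isCommutativeRing
    ; 𝟙≢𝟘 = λ eq → 1≉0 (≈-trans (≈-sym (strictlyInverseʳ 1#)) (≈-trans (from-cong eq) (strictlyInverseʳ 0#)))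
    ; inverse = λ i i≢𝟘 → to (proj₁ (inv i i≢𝟘)) , to-cong (≈-trans (*-congˡ (strictlyInverseʳ _)) (proj₂ (inv i i≢𝟘)))
    }
    where
    inv : ∀ i → i ≢ to 0# → ∃ λ y → from i *ᶠ y ≈ 1#
    inv i i≢𝟘 = IsField.inverse F-field (from i) λ eq → i≢𝟘 (from-injective (≈-trans eq (≈-sym (strictlyInverseʳ 0#))))

  open Field finiteField using (_⊕_; _⊗_; ⊝_; 𝟘; commutativeRing) renaming (_^_ to _^′_)
  open Algebra.Properties.CommutativeSemiring.Exp commutativeSemiring using (_^_; ^-congˡ)

  from-^ : ∀ i n → from (i ^′ n) ≈ from i ^ n
  from-^ i ℕ.zero    = strictlyInverseʳ 1#
  from-^ i (ℕ.suc n) = ≈-trans (strictlyInverseʳ _) (*-congˡ (from-^ i n))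

  from-⊝ : ∀ i j → from (j ⊕ ⊝ i) ≈ from j -ᶠ from i
  from-⊝ i j = ≈-trans (strictlyInverseʳ _) (+-congˡ (strictlyInverseʳ _))

  -- The enumeration preserves and reflects nonzero k-th powers.
  power-to : ∀ k {s a} → from s ≈ a → IsNonzeroPower F k a → IsNonzeroPower commutativeRing k s
  power-to k {s} {a} s≈a (a≉0 , w , a≈wᵏ) =
    (λ s≡𝟘 → a≉0 (≈-trans (≈-sym s≈a) (≈-trans (from-cong s≡𝟘) (strictlyInverseʳ 0#)))) , to w ,
    from-injective (≈-trans s≈a (≈-trans a≈wᵏ (≈-trans (^-congˡ k (≈-sym (strictlyInverseʳ w))) (≈-sym (from-^ (to w) k)))))

  power-from : ∀ k {s a} → from s ≈ a → IsNonzeroPower commutativeRing k s → IsNonzeroPower F k a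
  power-from k {s} {a} s≈a (s≢𝟘 , w , s≡wᵏ) =
    (λ a≈0 → s≢𝟘 (from-injective (≈-trans s≈a (≈-trans a≈0 (≈-sym (strictlyInverseʳ 0#)))))) , from w ,
    ≈-trans (≈-sym s≈a) (≈-trans (from-cong s≡wᵏ) (from-^ w k))

  no-loops : ∀ k {x} → ¬ IsNonzeroPower F k (x -ᶠ x)
  no-loops k (x-x≉0 , _) = x-x≉0 (-‿inverseʳ _)

/-≡ : ∀ n z d .{{_ : ℕ.NonZero d}} → + n ℤ.* + d ≡ z → + n / 1 ≡ z / d
/-≡ n z (ℕ.suc d) eq = ℚ.fromℚᵘ-cong {mkℚᵘ (+ n) 0} {mkℚᵘ z d} (*≡* (trans eq (sym (ℤ.*-identityʳ z))))

-- A number q = 5 (mod 8) is 5 + 8 e with e the quotient of q by 8.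
module Order5Mod8 {q : ℕ} (q≡5 : q ℕ.% 8 ≡ 5) where
  e : ℕ
  e = q ℕ./ 8
  q≡1+4h : q ≡ order e
  q≡1+4h = trans (ℕ.m≡m%n+[m/n]*n q 8) (trans (cong (ℕ._+ e ℕ.* 8) q≡5) (regroup e))
    where
    regroup : ∀ e → 5 ℕ.+ e ℕ.* 8 ≡ ℕ.suc ((ℕ.suc (e ℕ.+ e) ℕ.+ ℕ.suc (e ℕ.+ e)) ℕ.+ (ℕ.suc (e ℕ.+ e) ℕ.+ ℕ.suc (e ℕ.+ e)))
    regroup = ℕSolver.solve-∀

-- The value φ(-1) = 2 x.
module JacobsthalValue {q : ℕ} (𝔽 : FiniteField q) (q≡5 : q ℕ.% 8 ≡ 5) {p r : ℕ} (p-prime : Prime p) (q≡pʳ : q ≡ p ℕ.^ r) where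
  open Order5Mod8 {q} q≡5
  open Field 𝔽
  open JacobsthalSums 𝔽 e q≡1+4h
  open FourthPowers 𝔽 e q≡1+4h
  open HasseInvariant 𝔽 e q≡1+4h using (p∣φ⇒p∣C)

  p≡5 : p ℕ.% 8 ≡ 5
  p≡5 = power≡5⇒base≡5 p r (trans (cong (ℕ._% 8) (sym q≡pʳ)) q≡5)

  d : ℕ
  d = 1 ℕ.+ 2 ℕ.* (p ℕ./ 8)

  p≡5+8k : p ≡ 5 ℕ.+ p ℕ./ 8 ℕ.* 8
  p≡5+8k = trans (ℕ.m≡m%n+[m/n]*n p 8) (cong (ℕ._+ p ℕ./ 8 ℕ.* 8) p≡5)

  p≡1+4d : p ≡ 1 ℕ.+ 4 ℕ.* d
  p≡1+4d = trans p≡5+8k (regroup (p ℕ./ 8))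
    where
    regroup : ∀ k → 5 ℕ.+ k ℕ.* 8 ≡ 1 ℕ.+ 4 ℕ.* (1 ℕ.+ 2 ℕ.* k)
    regroup = ℕSolver.solve-∀

  p∤2 : ¬ (+ p ∣ + 2)
  p∤2 p∣2 = contradiction (ℕ.∣⇒≤ p∣2) (ℕ.<⇒≱ (subst (2 ℕ.<_) (sym p≡5+8k) (ℕ.s≤s (ℕ.s≤s (ℕ.s≤s ℕ.z≤n)))))

  p∣q : + p ∣ + q
  p∣q = positive-power r q≡pʳ
    where
    positive-power : ∀ r → q ≡ p ℕ.^ r → p ℕ.∣ q
    positive-power ℕ.zero    q≡1 = contradiction (trans (sym q≡5) (cong (ℕ._% 8) q≡1)) λ ()
    positive-power (ℕ.suc r) eq  = subst (p ℕ.∣_) (sym eq) (ℕ.m∣m*n (p ℕ.^ r))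

  q-odd : + q ≡ 1ℤ + + 2 * + m
  q-odd = trans (cong +_ (trans q≡1+4h (double m))) (cong (_+_ 1ℤ) (ℤ.pos-* 2 m))
    where
    double : ∀ k → ℕ.suc (k ℕ.+ k) ≡ 1 ℕ.+ 2 ℕ.* k
    double = ℕSolver.solve-∀

  -- Half of φ(-1), as given by 16 N = q - 7 + φ(-1) and q = 5 + 8 e.
  X : ℤ
  X = + 8 * N + 1ℤ - + 4 * + e

  φ≡2X : φ (⊝ 𝟙) ≡ + 2 * X
  φ≡2X = begin
    φ (⊝ 𝟙)                                      ≡⟨ isolate (+ q) (φ (⊝ 𝟙)) ⟩
    (+ q - + 7 + φ (⊝ 𝟙)) + (+ 7 - + q)          ≡⟨ cong₂ (λ a b → a + (+ 7 - b)) (sym 16N≡q-7+φ) q≡5+8e ⟩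
    + 16 * N + (+ 7 - (+ 5 + + 8 * + e))         ≡⟨ halve N (+ e) ⟩
    + 2 * X                                      ∎
    where
    open ≡-Reasoning
    isolate : ∀ a b → b ≡ (a - + 7 + b) + (+ 7 - a)
    isolate = solve-∀
    halve : ∀ n e → + 16 * n + (+ 7 - (+ 5 + + 8 * e)) ≡ + 2 * (+ 8 * n + 1ℤ - + 4 * e)
    halve = solve-∀
    q≡5+8e : + q ≡ + 5 + + 8 * + e
    q≡5+8e = trans (cong +_ (trans q≡1+4h (regroup e))) (cong (_+_ (+ 5)) (ℤ.pos-* 8 e))
      where
      regroup : ∀ e → ℕ.suc ((ℕ.suc (e ℕ.+ e) ℕ.+ ℕ.suc (e ℕ.+ e)) ℕ.+ (ℕ.suc (e ℕ.+ e) ℕ.+ ℕ.suc (e ℕ.+ e))) ≡ 5 ℕ.+ 8 ℕ.* e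
      regroup = ℕSolver.solve-∀

  4∣X-1 : + 4 ∣ X - 1ℤ
  4∣X-1 = S.∣⇒∣ᵤ {+ 4} {X - 1ℤ} (S.divides (+ 2 * N - + e) (shift N (+ e)))
    where
    shift : ∀ n e → (+ 8 * n + 1ℤ - + 4 * e) - 1ℤ ≡ (+ 2 * n - e) * + 4
    shift = solve-∀

  p∤X : ¬ (+ p ∣ X)
  p∤X p∣X = central-quarter p-prime {d} p≡1+4d r {h} (trans (sym q≡pʳ) (trans q≡1+4h (quadruple h)))
      (p∣φ⇒p∣C {p} {r} p-prime q≡pʳ (subst (+ p ∣_) (sym φ≡2X) (subst (p ℕ.∣_) (sym (ℤ.abs-* (+ 2) X)) (ℕ.∣n⇒∣m*n 2 p∣X))))
    where
    quadruple : ∀ h → ℕ.suc ((h ℕ.+ h) ℕ.+ (h ℕ.+ h)) ≡ 1 ℕ.+ 4 ℕ.* h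
    quadruple = ℕSolver.solve-∀

  two-squares : ∃ λ Y → + q ≡ X * X + Y * Y
  two-squares = S.quotient 2∣φg , ℤ.*-cancelˡ-≡ (+ 4) (+ q) _ (begin
      + 4 * + q                                  ≡⟨ proj₂ jacobsthal ⟨
      φ (⊝ 𝟙) * φ (⊝ 𝟙) + φ g * φ g              ≡⟨ cong₂ (λ a b → a * a + b * b) φ≡2X (S._∣_.equality 2∣φg) ⟩
      + 2 * X * (+ 2 * X) + Y * + 2 * (Y * + 2)  ≡⟨ regroup X Y ⟩
      + 4 * (X * X + Y * Y)                      ∎)
    where
    open ≡-Reasoning
    g : Fin q
    g = proj₁ jacobsthal
    isolate : ∀ a b → b ≡ (a * a + b) - a * a
    isolate = solve-∀
    even : ∀ Q X → + 4 * Q - + 2 * X * (+ 2 * X) ≡ (+ 2 * Q - + 2 * (X * X)) * + 2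
    even = solve-∀
    2∣φg² : + 2 ∣ φ g * φ g
    2∣φg² = S.∣⇒∣ᵤ {+ 2} {φ g * φ g} (S.divides (+ 2 * + q - + 2 * (X * X)) (begin
      φ g * φ g                                             ≡⟨ isolate (φ (⊝ 𝟙)) (φ g * φ g) ⟩
      (φ (⊝ 𝟙) * φ (⊝ 𝟙) + φ g * φ g) - φ (⊝ 𝟙) * φ (⊝ 𝟙)   ≡⟨ cong₂ (λ a b → a - b * b) (proj₂ jacobsthal) φ≡2X ⟩
      + 4 * + q - + 2 * X * (+ 2 * X)                       ≡⟨ even (+ q) X ⟩
      (+ 2 * + q - + 2 * (X * X)) * + 2                     ∎))
    2∣φg : + 2 S.∣ φ g
    2∣φg = S.∣ᵤ⇒∣ {+ 2} {φ g} ([ id , id ]′ (prime∣* prime[2] (φ g) (φ g) 2∣φg²))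
    Y : ℤ
    Y = S.quotient 2∣φg
    regroup : ∀ X Y → + 2 * X * (+ 2 * X) + Y * + 2 * (Y * + 2) ≡ + 4 * (X * X + Y * Y)
    regroup = solve-∀

  φ≡2x : ∀ {x y} → + q ≡ x * x + y * y → + 4 ∣ x - 1ℤ → ¬ (+ p ∣ x) → φ (⊝ 𝟙) ≡ + 2 * x
  φ≡2x {x} {y} q≡x²+y² 4∣x-1 p∤x = trans φ≡2X (cong (+ 2 *_) (sym
    (two-squares-unique {p} {r} p-prime p∤2 q≡pʳ p∣q {+ m} q-odd {x} {y} {X} {proj₁ two-squares}
      q≡x²+y² (proj₂ two-squares) p∤x p∤X 4∣x-1 4∣X-1)))

corollary2p8 : ∀ {c ℓ : Level} (p r q : ℕ) → Prime p → q ≡ p ℕ.^ r → q ℕ.% 8 ≡ 5 →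
    (F : CommutativeRing c ℓ) → IsField F → HasCardinality (CommutativeRing.setoid F) q →
    (x y : ℤ) → + q ≡ x ℤ.* x ℤ.+ y ℤ.* y → + 4 ∣ x ℤ.- + 1 → ¬ (+ p ∣ x) →
    ∃ λ (n : ℕ) → (𝒦[ 3 ]⟨ powerDigraph F 4 ⟩≡ n) ×
    (+ n / 1 ≡ (+ q ℤ.* (+ q ℤ.- + 1) ℤ.* (+ q ℤ.+ + 2 ℤ.* x ℤ.- + 7)) / (2 ℕ.^ 6))
corollary2p8 p r q p-prime q≡pʳ q≡5 F F-field finite x y q≡x²+y² 4∣x-1 p∤x =
  K₃ , count-triples finite (no-loops 4) triples , /-≡ K₃ _ 64 (begin
    + K₃ ℤ.* + 64                                                         ≡⟨ cong (ℤ._* + 64) K₃≡#triples ⟩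
    #triples ℤ.* + 64                                                     ≡⟨ 64#triples ⟩
    + q ℤ.* (+ q ℤ.- + 1) ℤ.* (+ q ℤ.+ φ (⊝ 𝟙) ℤ.- + 7)
      ≡⟨ cong (λ v → + q ℤ.* (+ q ℤ.- + 1) ℤ.* (+ q ℤ.+ v ℤ.- + 7)) (φ≡2x {x} {y} q≡x²+y² 4∣x-1 p∤x) ⟩
    + q ℤ.* (+ q ℤ.- + 1) ℤ.* (+ q ℤ.+ + 2 ℤ.* x ℤ.- + 7)                 ∎)
  where
  open ≡-Reasoning
  open Transport F F-field finite
  open Field finiteField using (⊝_; _⊕_; 𝟙)
  open Order5Mod8 {q} q≡5
  open JacobsthalSums finiteField e q≡1+4h using (φ)
  open FourthPowers finiteField e q≡1+4h
  open JacobsthalValue finiteField q≡5 {p} {r} p-prime q≡pʳ using (φ≡2x)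
  open Tournaments (powerDigraph F 4)
  open Digraph (powerDigraph F 4) using (_⟶_)
  open Inverse finite using (from)

  edge? : ∀ i j → Dec (from i ⟶ from j)
  edge? i j = map′ (power-from 4 (from-⊝ i j)) (power-to 4 (from-⊝ i j)) (fourth? (j ⊕ ⊝ i))

  ind-edge : ∀ i j → ind (edge? i j) ≡ ψ (j ⊕ ⊝ i)
  ind-edge i j = ind-cong (edge? i j) (fourth? (j ⊕ ⊝ i)) (power-to 4 (from-⊝ i j)) (power-from 4 (from-⊝ i j))

  transitive? : ∀ i j k → Dec ((from i ⟶ from j) × (from j ⟶ from k) × (from i ⟶ from k))
  transitive? i j k = edge? i j ×-dec edge? j k ×-dec edge? i k

  ind-transitive : ∀ i j k → ind (transitive? i j k) ≡ ψ (j ⊕ ⊝ i) ℤ.* ψ (k ⊕ ⊝ j) ℤ.* ψ (k ⊕ ⊝ i)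
  ind-transitive i j k = begin
    ind (transitive? i j k)                                       ≡⟨ ind-× (edge? i j) (edge? j k ×-dec edge? i k) ⟩
    ind (edge? i j) ℤ.* ind (edge? j k ×-dec edge? i k)           ≡⟨ cong (ind (edge? i j) ℤ.*_) (ind-× (edge? j k) (edge? i k)) ⟩
    ind (edge? i j) ℤ.* (ind (edge? j k) ℤ.* ind (edge? i k))
      ≡⟨ ℤ.*-assoc (ind (edge? i j)) (ind (edge? j k)) (ind (edge? i k)) ⟨
    ind (edge? i j) ℤ.* ind (edge? j k) ℤ.* ind (edge? i k)
      ≡⟨ cong₂ ℤ._*_ (cong₂ ℤ._*_ (ind-edge i j) (ind-edge j k)) (ind-edge i k) ⟩
    ψ (j ⊕ ⊝ i) ℤ.* ψ (k ⊕ ⊝ j) ℤ.* ψ (k ⊕ ⊝ i)                   ∎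

  counted : HasCount (TransitiveTriple finite) #triples
  counted = count-sum λ i → count-sum λ j → count-sum λ k →
    subst (HasCount _) (ind-transitive i j k) (count-dec (transitive? i j k))

  -- The number of transitive subtournaments of order 3.
  K₃ : ℕ
  K₃ = proj₁ counted

  triples : Counts (TransitiveTriple finite) K₃
  triples = proj₁ (proj₂ counted)

  K₃≡#triples : + K₃ ≡ #triples
  K₃≡#triples = proj₂ (proj₂ counted)
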